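{- For all integers $k > d \geq 1$ and every $\varepsilon > 0$ there exists $\ell_0$ such that for every integer $\ell \geq \ell_0$ there exist $c_0, \eta_0 > 0$ such that for all $0 < c \leq c_0$ and $0 < \eta \leq \eta_0$ there exists $n_0$ such that the following holds for every $n \geq n_0$. Let $m = (\log n)^c$ and let $H$ be an $n$-vertex $k$-graph with \[ \delta_d(H) \geq \left( \delta^{\mathrm{LHC}}_{k,d} + \varepsilon \right) \binom{n-d}{k-d}. \] Then all but at most $\eta n$ vertices of $H$ can be covered by pairwise vertex-disjoint $m$-blow-ups of $k$-uniform loose cycles of length $\ell$ (each a subgraph of $H$).
   Context: Rounding is ignored ($m$ treated as an integer). $\delta_d(H)$ is the minimum over $d$-subsets $S \subseteq V(H)$ of the number of edges of $H$ containing $S$. The $k$-expansion of a graph replaces each edge $uv$ by a $k$-edge consisting of $u$, $v$ and $k-2$ new vertices belonging to no other edge; a $k$-uniform loose cycle of length $\ell$ is the $k$-expansion of a graph cycle with $\ell$ edges, and a loose Hamilton cycle of $H$ is a loose cycle spanning $V(H)$. For $n$ divisible by $k-1$, $\delta^{\mathrm{LHC}}_{k,d}(n)$ is the maximum of $\delta_d(H)$ over $n$-vertex $k$-graphs $H$ without a loose Hamilton cycle, and $\delta^{\mathrm{LHC}}_{k,d} := \limsup_{n\to\infty} \delta^{\mathrm{LHC}}_{k,d}(n)/\binom{n-d}{k-d}$. The $m$-blow-up of a $k$-graph $F$ replaces each vertex $x$ by a set of $m$ vertices (a cluster) $V_x$ and each edge $\{x_1,\dots,x_k\}$ by the complete $k$-partite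 $k$-graph on $V_{x_1},\dots,V_{x_k}$. -}

module Defs where

open import Data.Bool.Base using (Bool; T)
open import Data.Nat.Base as ℕ using (ℕ; zero; suc; _∸_; _!)
import Data.Nat.Properties as ℕ
open import Data.Nat.Combinatorics using (_C_)
open import Data.Nat.Divisibility using (_∣_)
open import Data.Integer.Base as ℤ using (+_; -[1+_]; ∣_∣)
import Data.Integer.Properties as ℤ
open import Data.Rational.Base as ℚ
  using (ℚ; mkℚ; 0ℚ; 1ℚ; _+_; _*_; _-_; _<_; _≤_; _⊔_; _/_; ↥_; ↧ₙ_; *≤*; *<*; nonNegative; positive)
import Data.Rational.Properties as ℚ
import Data.Rational.Unnormalised.Base as ℚᵘ
import Data.Rational.Unnormalised.Properties as ℚᵘ
open import Algebra.Definitions.RawSemiring ℚ.+-*-rawSemiring using (_^_)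
open import Algebra.Bundles using (CommutativeRing)
open import Algebra.Properties.Semiring.Exp
  (CommutativeRing.semiring ℚ.+-*-commutativeRing) using (^-assocʳ)
open import Data.Fin.Base using (Fin; toℕ)
open import Data.Fin.Subset using (Subset; inside; outside; _∈_)
  renaming (∣_∣ to card)
open import Data.Fin.Subset.Properties using (_⊆?_)
open import Data.List.Base using (List; []; _∷_; _++_; map; filter; length)
open import Data.List.Extrema.Nat using (min; min≤⊤)
open import Data.Product.Base using (Σ; ∃; ∃₂; _×_; _,_; proj₁; proj₂)
open import Data.Sum.Base using (_⊎_; inj₁; inj₂)
open import Data.Empty using (⊥-elim)
open import Data.Vec.Base using () renaming ([] to []ᵛ; _∷_ to _∷ᵛ_)
open import Function.Base using (case_of_)
open import Function.Bundles using (_⇔_)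
open import Function.Definitions using (Injective)
open import Relation.Binary.Definitions using (tri<; tri≈; tri>)
open import Relation.Nullary using (¬_; yes; no)
open import Relation.Nullary.Decidable using (_×-dec_; T?)
open import Relation.Binary.PropositionalEquality
  using (_≡_; refl; sym; cong; subst)

-- A real number x is the (open lower) Dedekind cut { q ∈ ℚ : q < x }.
record ℝ : Set₁ where
  infix 4 _∋_
  field
    _∋_       : ℚ → Set
    inhabited : ∃ λ q → _∋_ q
    bounded   : ∃ λ q → ¬ _∋_ q
    downward  : ∀ {p q} → p < q → _∋_ q → _∋_ p
    open-up   : ∀ {q} → _∋_ q → ∃ λ r → q < r × _∋_ r

open ℝ using (_∋_)

infix 4 _≤ℝ_ _<ℝ_

_≤ℝ_ : ℝ → ℝ → Set
x ≤ℝ y = ∀ {q} → x ∋ q → y ∋ q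

_<ℝ_ : ℝ → ℝ → Set
x <ℝ y = ∃ λ q → ¬ (x ∋ q) × y ∋ q

private
  below : ∀ q → ∃ λ p → p < q
  below q = q - 1ℚ , subst (q - 1ℚ <_) (ℚ.+-identityʳ q)
                       (ℚ.+-monoʳ-< q (ℚ.negative⁻¹ (ℚ.- 1ℚ)))

  ∌⇒> : ∀ (x : ℝ) {p q} → x ∋ p → ¬ (x ∋ q) → p < q
  ∌⇒> x {p} {q} x∋p x∌q with ℚ.<-cmp p q
  ... | tri< p<q _ _  = p<q
  ... | tri≈ _ refl _ = ⊥-elim (x∌q x∋p)
  ... | tri> _ _ q<p  = ⊥-elim (x∌q (ℝ.downward x q<p x∋p))

fromℚ : ℚ → ℝ
fromℚ x = record
  { _∋_       = _< x
  ; inhabited = below x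
  ; bounded   = x , ℚ.<-irrefl refl
  ; downward  = ℚ.<-trans
  ; open-up   = λ q<x → let r , q<r , r<x = ℚ.<-dense q<x in r , q<r , r<x
  }

fromℕ : ℕ → ℝ
fromℕ n = fromℚ (+ n / 1)

infixl 6 _+ℝ_
infixl 7 _·_

_+ℝ_ : ℝ → ℝ → ℝ
x +ℝ y = record
  { _∋_       = λ q → ∃₂ λ r s → x ∋ r × y ∋ s × q < r + s
  ; inhabited = let r , x∋r = ℝ.inhabited x
                    s , y∋s = ℝ.inhabited y
                    q , q<r+s = below (r + s)
                in q , r , s , x∋r , y∋s , q<r+s
  ; bounded   = let b , x∌b = ℝ.bounded x
                    c , y∌c = ℝ.bounded y
                in b + c , λ (r , s , x∋r , y∋s , b+c<r+s) →
                     ℚ.<-asym b+c<r+s (ℚ.+-mono-< (∌⇒> x x∋r x∌b) (∌⇒> y y∋s y∌c))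
  ; downward  = λ p<q (r , s , x∋r , y∋s , q<r+s) → r , s , x∋r , y∋s , ℚ.<-trans p<q q<r+s
  ; open-up   = λ (r , s , x∋r , y∋s , q<r+s) →
                  let t , q<t , t<r+s = ℚ.<-dense q<r+s
                  in t , q<t , r , s , x∋r , y∋s , t<r+s
  }

_·_ : ℕ → ℝ → ℝ
zero  · x = fromℕ 0
suc n · x = x +ℝ n · x

-- The supremum of P ∪ {0}, for a set P of rationals bounded above.  It is
-- only used for sets of nonnegative rationals; adjoining 0 then matters
-- only when P is empty.
sup : (P : ℚ → Set) (B : ℚ) → (∀ {y} → P y → y ≤ B) → ℝ
sup P B P≤B = record
  { _∋_       = λ q → q < 0ℚ ⊎ ∃ λ y → P y × q < y
  ; inhabited = let q , q<0 = below 0ℚ in q , inj₁ q<0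
  ; bounded   = 0ℚ ⊔ B , λ
      { (inj₁ b<0)           → ℚ.<-irrefl refl (ℚ.≤-<-trans (ℚ.p≤p⊔q 0ℚ B) b<0)
      ; (inj₂ (y , Py , b<y)) → ℚ.<-irrefl refl
          (ℚ.≤-<-trans (ℚ.≤-trans (P≤B Py) (ℚ.p≤q⊔p 0ℚ B)) b<y) }
  ; downward  = λ
      { p<q (inj₁ q<0)            → inj₁ (ℚ.<-trans p<q q<0)
      ; p<q (inj₂ (y , Py , q<y)) → inj₂ (y , Py , ℚ.<-trans p<q q<y) }
  ; open-up   = λ
      { (inj₁ q<0)            → let r , q<r , r<0 = ℚ.<-dense q<0 in r , q<r , inj₁ r<0
      ; (inj₂ (y , Py , q<y)) → let r , q<r , r<y = ℚ.<-dense q<y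
                                in r , q<r , inj₂ (y , Py , r<y) }
  }

-- inf_N sup_{n ≥ N} aₙ for a sequence of rationals in [0,B] that need not be
-- defined for all n: S n y says that aₙ is defined and equal to y.
limsup : (S : ℕ → ℚ → Set) (B : ℚ) → (∀ {n y} → S n y → y ≤ B) → ℝ
limsup S B S≤B = record
  { _∋_       = λ q → ∃ λ r → q < r × ∀ N → supFrom N ∋ r
  ; inhabited = let r , r<0 = below 0ℚ
                    q , q<r = below r
                in q , r , q<r , λ N → inj₁ r<0
  ; bounded   = let b , ∌b = ℝ.bounded (supFrom 0)
                in b , λ (r , b<r , ∋r) → ∌b (ℝ.downward (supFrom 0) b<r (∋r 0))
  ; downward  = λ p<q (r , q<r , ∋r) → r , ℚ.<-trans p<q q<r , ∋r
  ; open-up   = λ (r , q<r , ∋r) → let t , q<t , t<r = ℚ.<-dense q<r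
                                   in t , q<t , r , t<r , ∋r
  }
  where
  supFrom : ℕ → ℝ
  supFrom N = sup (λ y → ∃ λ n → N ℕ.≤ n × S n y) B λ (n , _ , Sny) → S≤B Sny

-- ∑_{i ≤ N} yⁱ / i!
expSum : ℕ → ℚ → ℚ
expSum zero    y = 1ℚ
expSum (suc N) y = expSum N y + y ^ suc N * (_/_ (+ 1) (suc N !) {{ℕ._!≢0 (suc N)}})

-- log n = sup { y ≥ 0 : eʸ ≤ n } for n ≥ 1; the junk value log 0 is 0.
log : ℕ → ℝ
log n = sup (λ y → 0ℚ ≤ y × ∀ N → expSum N y ≤ + n / 1) (+ n / 1) λ (_ , e) → y≤n (e 1)
  where
  open ℚ.≤-Reasoning
  y≤n : ∀ {y} → expSum 1 y ≤ + n / 1 → y ≤ + n / 1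
  y≤n {y} h = begin
    y                    ≡⟨ ℚ.+-identityˡ y ⟨
    0ℚ + y               ≤⟨ ℚ.+-monoˡ-≤ y (ℚ.nonNegative⁻¹ 1ℚ) ⟩
    1ℚ + y               ≡⟨ cong (_+_ 1ℚ) (ℚ.*-identityʳ y) ⟨
    1ℚ + y * 1ℚ          ≡⟨ cong (_+_ 1ℚ) (ℚ.*-identityʳ (y * 1ℚ)) ⟨
    1ℚ + y * 1ℚ * 1ℚ     ≤⟨ h ⟩
    + n / 1              ∎

private
  ^-nonNeg : ∀ {x} → 0ℚ ≤ x → ∀ n → 0ℚ ≤ x ^ n
  ^-nonNeg         0≤x zero    = ℚ.nonNegative⁻¹ 1ℚ
  ^-nonNeg {x} 0≤x (suc n) =
    ℚ.nonNegative⁻¹ _ {{ℚ.nonNeg*nonNeg⇒nonNeg x {{nonNegative 0≤x}} (x ^ n) {{nonNegative (^-nonNeg 0≤x n)}}}}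

  ^-monoˡ : ∀ {x y} → 0ℚ ≤ x → x ≤ y → ∀ n → x ^ n ≤ y ^ n
  ^-monoˡ         0≤x x≤y zero    = ℚ.≤-refl
  ^-monoˡ {x} {y} 0≤x x≤y (suc n) = ℚ.≤-trans
    (ℚ.*-monoʳ-≤-nonNeg (x ^ n) {{nonNegative (^-nonNeg 0≤x n)}} x≤y)
    (ℚ.*-monoˡ-≤-nonNeg y {{nonNegative (ℚ.≤-trans 0≤x x≤y)}} (^-monoˡ 0≤x x≤y n))

  ^-monoˡ-< : ∀ {x y} → 0ℚ ≤ x → x < y → ∀ n → x ^ suc n < y ^ suc n
  ^-monoˡ-< {x} {y} 0≤x x<y zero =
    ℚ.*-monoˡ-<-pos 1ℚ x<y
  ^-monoˡ-< {x} {y} 0≤x x<y (suc n) = ℚ.≤-<-trans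
    (ℚ.*-monoʳ-≤-nonNeg (x ^ suc n) {{nonNegative (^-nonNeg 0≤x (suc n))}} (ℚ.<⇒≤ x<y))
    (ℚ.*-monoʳ-<-pos y {{positive (ℚ.≤-<-trans 0≤x x<y)}} (^-monoˡ-< 0≤x x<y n))

  1≤^ : ∀ {x} → 1ℚ ≤ x → ∀ n → 1ℚ ≤ x ^ n
  1≤^     1≤x zero    = ℚ.≤-refl
  1≤^ {x} 1≤x (suc n) = ℚ.≤-trans 1≤x (subst (_≤ x * x ^ n) (ℚ.*-identityʳ x)
    (ℚ.*-monoˡ-≤-nonNeg x {{nonNegative (ℚ.≤-trans (ℚ.nonNegative⁻¹ 1ℚ) 1≤x)}} (1≤^ 1≤x n)))

  ^-monoʳ : ∀ {x} → 1ℚ ≤ x → ∀ {m n} → m ℕ.≤ n → x ^ m ≤ x ^ n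
  ^-monoʳ     1≤x {n = n} ℕ.z≤n       = 1≤^ 1≤x n
  ^-monoʳ {x} 1≤x         (ℕ.s≤s m≤n) =
    ℚ.*-monoˡ-≤-nonNeg x {{nonNegative (ℚ.≤-trans (ℚ.nonNegative⁻¹ 1ℚ) 1≤x)}} (^-monoʳ 1≤x m≤n)

  num≤ : ∀ {t b} → 0ℚ ≤ t → t < b → ∣ ↥ t ∣ ℕ.≤ ∣ ↥ b ∣ ℕ.* ↧ₙ t
  num≤ {mkℚ (-[1+ _ ]) _ _} 0≤t _ = case 0≤t of λ { (*≤* ()) }
  num≤ {mkℚ (+ a) d _} {mkℚ (-[1+ m ]) e _} _ (*<* l) =
    case subst (ℤ._< _) (sym (ℤ.pos-* a (suc e))) l of λ ()
  num≤ {mkℚ (+ a) d _} {mkℚ (+ m) e _} _ (*<* l) = begin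
    a                ≤⟨ ℕ.m≤m*n a (suc e) ⟩
    a ℕ.* suc e      ≤⟨ ℕ.<⇒≤ (ℤ.drop‿+<+ l′) ⟩
    m ℕ.* suc d      ∎
    where
    open ℕ.≤-Reasoning
    l′ : + (a ℕ.* suc e) ℤ.< + (m ℕ.* suc d)
    l′ = subst₂′ (sym (ℤ.pos-* a (suc e))) (sym (ℤ.pos-* m (suc d))) l
      where
      subst₂′ : ∀ {i i′ j j′} → i ≡ i′ → j ≡ j′ → i ℤ.< j → i′ ℤ.< j′
      subst₂′ refl refl h = h

-- x ^ c for x ≥ 1 and c > 0, as the supremum of sᵗ over rationals 0 < s < x
-- and 0 ≤ t < c; here y ≤ sᵗ is expressed, for t = p/q, as y^q ≤ s^p.
-- For other x, c this is not the usual power.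
infixr 8 _^ℝ_
_^ℝ_ : ℝ → ℝ → ℝ
x ^ℝ c = sup Below (X ^ M) below≤
  where
  Below : ℚ → Set
  Below y = 0ℚ ≤ y × ∃₂ λ s t →
    0ℚ < s × x ∋ s × 0ℚ ≤ t × c ∋ t × y ^ (↧ₙ t) ≤ s ^ ∣ ↥ t ∣

  X : ℚ
  X = 1ℚ ⊔ proj₁ (ℝ.bounded x)
  M : ℕ
  M = ∣ ↥ proj₁ (ℝ.bounded c) ∣

  1≤X : 1ℚ ≤ X
  1≤X = ℚ.p≤p⊔q 1ℚ (proj₁ (ℝ.bounded x))

  below≤ : ∀ {y} → Below y → y ≤ X ^ M
  below≤ {y} (0≤y , s , t , 0<s , x∋s , 0≤t , c∋t , y^q≤s^p) with y ℚ.≤? X ^ M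
  ... | yes y≤ = y≤
  ... | no  y≰ = ⊥-elim (ℚ.<-irrefl refl (begin-strict
    (X ^ M) ^ ↧ₙ t    <⟨ ^-monoˡ-< (^-nonNeg 0≤X M) (ℚ.≰⇒> y≰) (ℚ.denominator-1 t) ⟩
    y ^ ↧ₙ t          ≤⟨ y^q≤s^p ⟩
    s ^ ∣ ↥ t ∣       ≤⟨ ^-monoˡ (ℚ.<⇒≤ 0<s) s≤X ∣ ↥ t ∣ ⟩
    X ^ ∣ ↥ t ∣       ≤⟨ ^-monoʳ 1≤X (num≤ 0≤t (∌⇒> c c∋t (proj₂ (ℝ.bounded c)))) ⟩
    X ^ (M ℕ.* ↧ₙ t)  ≡⟨ ^-assocʳ X M (↧ₙ t) ⟨
    (X ^ M) ^ ↧ₙ t    ∎))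
    where
    open ℚ.≤-Reasoning
    0≤X = ℚ.≤-trans (ℚ.nonNegative⁻¹ 1ℚ) 1≤X
    s≤X : s ≤ X
    s≤X = ℚ.≤-trans (ℚ.<⇒≤ (∌⇒> x x∋s (proj₂ (ℝ.bounded x)))) (ℚ.p≤q⊔p 1ℚ (proj₁ (ℝ.bounded x)))

-- |m − x| < 1, so m may be ⌊x⌋ or ⌈x⌉ (and m = x if x is an integer).
_RoundsTo_ : ℝ → ℕ → Set
x RoundsTo m = x <ℝ fromℕ (suc m) × fromℕ m <ℝ x +ℝ fromℕ 1

record KGraph (k n : ℕ) : Set where
  field
    isEdge : Subset n → Bool

  Edge : Subset n → Set
  Edge e = T (isEdge e)

  field
    uniform : ∀ {e} → Edge e → card e ≡ k

open KGraph

subsets : ∀ n → List (Subset n)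
subsets zero    = []ᵛ ∷ []
subsets (suc n) = map (outside ∷ᵛ_) (subsets n) ++ map (inside ∷ᵛ_) (subsets n)

degree : ∀ {k n} → KGraph k n → Subset n → ℕ
degree {n = n} H S = length (filter (λ e → (S ⊆? e) ×-dec T? (isEdge H e)) (subsets n))

-- δ_d(H).  A d-set lies in at most C(n-d,k-d) edges, so starting the minimum
-- at that number changes it only if there are no d-sets at all.
minDegree : ∀ {k n} → ℕ → KGraph k n → ℕ
minDegree {k} {n} d H =
  min ((n ∸ d) C (k ∸ d)) (map (degree H) (filter (λ S → card S ℕ.≟ d) (subsets n)))

-- A hypergraph given by an incidence relation; it need not be finite or
-- uniform, and distinct indices in E may have the same vertices.
record Hypergraph : Set₁ where
  field
    V   : Set
    E   : Set
    _∈ₑ_ : V → E → Set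

-- For ℓ ≥ 3, the graph cycle on Fin ℓ with i-th edge {i, i+1 mod ℓ}.
cycle : ℕ → Hypergraph
cycle ℓ = record
  { V    = Fin ℓ
  ; E    = Fin ℓ
  ; _∈ₑ_ = λ v e → v ≡ e ⊎ toℕ v ≡ suc (toℕ e) ⊎ (toℕ v ≡ 0 × suc (toℕ e) ≡ ℓ)
  }

expansion : ℕ → Hypergraph → Hypergraph
expansion k G = record
  { V    = G.V ⊎ (G.E × Fin (k ∸ 2))
  ; E    = G.E
  ; _∈ₑ_ = λ { (inj₁ v)       e → v G.∈ₑ e
             ; (inj₂ (e′ , _)) e → e′ ≡ e }
  }
  where module G = Hypergraph G

looseCycle : (k ℓ : ℕ) → Hypergraph
looseCycle k ℓ = expansion k (cycle ℓ)

-- The vertex (x , i) is the i-th vertex of the cluster of x.  Each edge of the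
-- blow-up arises from an edge e of F and a choice of one vertex in every
-- cluster, of which only the choices in the clusters of e matter.
blowUp : ℕ → Hypergraph → Hypergraph
blowUp m F = record
  { V    = F.V × Fin m
  ; E    = F.E × (F.V → Fin m)
  ; _∈ₑ_ = λ { (x , i) (e , f) → x F.∈ₑ e × f x ≡ i }
  }
  where module F = Hypergraph F

record Copy {k n : ℕ} (F : Hypergraph) (H : KGraph k n) : Set where
  open Hypergraph F
  field
    φ         : V → Fin n
    injective : Injective _≡_ _≡_ φ
    edges     : ∀ e → ∃ λ s → Edge H s × (∀ v → v ∈ s ⇔ ∃ λ x → x ∈ₑ e × φ x ≡ v)

  Covers : Fin n → Set
  Covers v = ∃ λ x → φ x ≡ v

LooseHamiltonian : ∀ {k n} → KGraph k n → Set
LooseHamiltonian {k} H =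
  ∃ λ ℓ → 3 ℕ.≤ ℓ × Σ (Copy (looseCycle k ℓ) H) λ K → ∀ v → Copy.Covers K v

-- D is the maximum of δ_d(H) over n-vertex k-graphs H without a loose
-- Hamilton cycle.
IsLHCThreshold : (k d n D : ℕ) → Set
IsLHCThreshold k d n D =
    (Σ (KGraph k n) λ H → ¬ LooseHamiltonian H × minDegree d H ≡ D)
  × (∀ (H : KGraph k n) → ¬ LooseHamiltonian H → minDegree d H ℕ.≤ D)

-- a / b, with a / 0 = 0.
_÷_ : ℕ → ℕ → ℚ
a ÷ zero  = 0ℚ
a ÷ suc b = + a / suc b

private
  ÷≤1 : ∀ {a b} → a ℕ.≤ b → a ÷ b ≤ 1ℚ
  ÷≤1 {b = zero}      _   = ℚ.nonNegative⁻¹ 1ℚ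
  ÷≤1 {a} {b = suc b} a≤b = ℚ.toℚᵘ-cancel-≤ (ℚᵘ.≤-respˡ-≃
    (ℚᵘ.≃-sym (ℚ.toℚᵘ-fromℚᵘ (ℚᵘ.mkℚᵘ (+ a) b)))
    (ℚᵘ.*≤* (ℤ.≤-trans (ℤ.≤-reflexive (ℤ.*-identityʳ (+ a)))
              (ℤ.≤-trans (ℤ.+≤+ a≤b) (ℤ.≤-reflexive (sym (ℤ.*-identityˡ (+ suc b))))))))

-- The threshold sequence is only considered for n divisible by k-1.
δLHC : (k d : ℕ) → ℝ
δLHC k d = limsup Ratio 1ℚ ratio≤1
  where
  Ratio : ℕ → ℚ → Set
  Ratio n y = (k ∸ 1) ∣ n × ∃ λ D → IsLHCThreshold k d n D × y ≡ D ÷ ((n ∸ d) C (k ∸ d))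

  ratio≤1 : ∀ {n y} → Ratio n y → y ≤ 1ℚ
  ratio≤1 {n} (_ , D , ((H , _ , refl) , _) , refl) =
    ÷≤1 (min≤⊤ ((n ∸ d) C (k ∸ d)) (map (degree H) (filter (λ S → card S ℕ.≟ d) (subsets n))))

-- Let s = (k-1)ℓ.  A random s-set of vertices inherits the minimum degree
-- condition up to ε/2 with probability exponentially close to 1 in a power of
-- s: otherwise a few disjoint random blocks inside it, which look independent,
-- would have to deviate by a Chernoff bound.  It then spans a loose Hamilton
-- cycle, of length ℓ.  So through every vertex all but a 1/(4s)-fraction of the
-- s-tuples span a loose cycle of length ℓ.
--
-- No regularity lemma is needed to pass to blow-ups.  Split almost all vertices
-- into rows of s vertices, and group rows into blow-ups (any choice of the w-th
-- coordinates from rows of one group is a loose cycle).  As long as many rows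
-- are ungrouped, for many (j₁,…,jₛ) with j₁ ungrouped the s × s array formed by
-- these rows splits, along cyclic shifts, into s transversals spanning loose
-- cycles.  Erdős' theorem on complete s-partite s-graphs turns this into s sets
-- of M rows, which can be regrouped into s blow-ups; here M may be any constant
-- multiple of m, since m is a small power of log n.  Groups that lose rows
-- remain blow-ups.  Each step groups M more rows and adds only s groups, so in
-- the end there are O(n/M) groups, and cutting them into pieces of size m wastes
-- only O(nm/M) vertices.
module Submission where

open import Level using (0ℓ)
open import Axiom.ExcludedMiddle using (ExcludedMiddle)
open import Defs
open import Data.Fin.Base using (Fin; zero; suc; toℕ; fromℕ<; combine; inject≤)
open import Data.List.Base as List
  using (List; []; _∷_; _++_; map; concatMap; length; allFin; filter; cartesianProduct)
open import Data.Product.Base using (Σ; ∃; ∃₂; _×_; _,_; proj₁; proj₂; uncurry)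
open import Data.Sum.Base as Sum using (_⊎_; inj₁; inj₂)
open import Data.Empty using (⊥-elim)
open import Function.Base using (_∘_; id; case_of_)
open import Relation.Nullary using (¬_; Dec; yes; no)
open import Relation.Binary.PropositionalEquality

-- The ungrouped rows may span no edge at all, so a new cycle must borrow from rows that are already
-- grouped. Only the first row of an array has to be free, and free rows may be a small fraction of
-- all rows. An average over all tuples would say nothing about them; hence typicality through every
-- vertex. The cyclic shifts make a step lossless: each vertex of the borrowed rows lands in one of
-- the s new groups.
--
-- Probabilities are counts with denominators cleared. In units of 1/w the density budget is: the
-- threshold is at most i; above a = i + 1 a loose Hamilton cycle on s vertices is forced; c = 2 + a
-- is the Markov cut-off for small samples; 4 + a = 2 + c is the density of joined tuples in H; 5 +
-- a = i + 6 is the minimum degree of H, one unit being lost between binomials and powers.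
--
-- The value c₀ = 1/(s + 1) comes from the box theorem, which asks for 2 ^ O(m ^ s) rows, while log
-- n is at least of order m ^ (s + 1).

module Finite where

  open import Data.Nat.Base
  open import Data.Nat.Properties
  open import Data.Nat.DivMod using (m/n*n≡m)
  open import Data.Nat.Combinatorics using (_C_; nCk≡nPk/k!)
  import Data.Nat.Combinatorics as Combinatorics
  open import Data.Nat.Combinatorics.Base using (_P′_)
  open import Data.Nat.Combinatorics.Specification using (k!∣nP′k; k>n⇒nCk≡0)
  open import Data.Nat.Tactic.RingSolver using (solve-∀)
  open import Data.Bool.Base using (true)
  import Data.Fin.Properties as Fin
  open import Data.List.Properties using (length-tabulate; map-tabulate)
  open import Data.List.Membership.Propositional using (_∈_)
  open import Data.List.Membership.Propositional.Properties using (∈-concatMap⁺; ∈-map⁺)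
  open import Data.List.Relation.Unary.Any as Any using (here; there)
  open import Data.Vec.Base using (Vec; []; _∷_)

  private variable
    A B : Set

  -- Finite sums over lists and tuples

  ∑ : List A → (A → ℕ) → ℕ
  ∑ []       f = 0
  ∑ (x ∷ xs) f = f x + ∑ xs f

  ∑-cong : ∀ (xs : List A) {f g : A → ℕ} → (∀ x → f x ≡ g x) → ∑ xs f ≡ ∑ xs g
  ∑-cong []       e = refl
  ∑-cong (x ∷ xs) e = cong₂ _+_ (e x) (∑-cong xs e)

  ∑-mono : ∀ (xs : List A) {f g : A → ℕ} → (∀ x → f x ≤ g x) → ∑ xs f ≤ ∑ xs g
  ∑-mono []       e = z≤n
  ∑-mono (x ∷ xs) e = +-mono-≤ (e x) (∑-mono xs e)

  ∑-+ : ∀ (xs : List A) (f g : A → ℕ) → ∑ xs (λ x → f x + g x) ≡ ∑ xs f + ∑ xs g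
  ∑-+ []       f g = refl
  ∑-+ (x ∷ xs) f g = trans (cong (f x + g x +_) (∑-+ xs f g)) (interchange (f x) (g x) _ _)
    where
    interchange : ∀ a b c d → a + b + (c + d) ≡ a + c + (b + d)
    interchange = solve-∀

  ∑-*ˡ : ∀ (xs : List A) c (f : A → ℕ) → ∑ xs (λ x → c * f x) ≡ c * ∑ xs f
  ∑-*ˡ []       c f = sym (*-zeroʳ c)
  ∑-*ˡ (x ∷ xs) c f = trans (cong (c * f x +_) (∑-*ˡ xs c f)) (sym (*-distribˡ-+ c (f x) _))

  ∑-*ʳ : ∀ (xs : List A) c (f : A → ℕ) → ∑ xs (λ x → f x * c) ≡ ∑ xs f * c
  ∑-*ʳ xs c f = trans (∑-cong xs λ x → *-comm (f x) c) (trans (∑-*ˡ xs c f) (*-comm c _))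

  ∑-const : ∀ (xs : List A) c → ∑ xs (λ _ → c) ≡ length xs * c
  ∑-const []       c = refl
  ∑-const (x ∷ xs) c = cong (c +_) (∑-const xs c)

  ∑-zero : ∀ (xs : List A) → ∑ xs (λ _ → 0) ≡ 0
  ∑-zero xs = trans (∑-const xs 0) (*-zeroʳ (length xs))

  ∑-swap : ∀ (xs : List A) (ys : List B) (f : A → B → ℕ) →
    ∑ xs (λ x → ∑ ys (f x)) ≡ ∑ ys (λ y → ∑ xs λ x → f x y)
  ∑-swap []       ys f = sym (∑-zero ys)
  ∑-swap (x ∷ xs) ys f = trans (cong (∑ ys (f x) +_) (∑-swap xs ys f)) (sym (∑-+ ys (f x) _))

  ∑-++ : ∀ (xs ys : List A) f → ∑ (xs ++ ys) f ≡ ∑ xs f + ∑ ys f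
  ∑-++ []       ys f = refl
  ∑-++ (x ∷ xs) ys f = trans (cong (f x +_) (∑-++ xs ys f)) (sym (+-assoc (f x) _ _))

  ∑-map : ∀ (g : A → B) (xs : List A) f → ∑ (map g xs) f ≡ ∑ xs (f ∘ g)
  ∑-map g []       f = refl
  ∑-map g (x ∷ xs) f = cong (f (g x) +_) (∑-map g xs f)

  ∑-concatMap : ∀ (g : A → List B) (xs : List A) f → ∑ (concatMap g xs) f ≡ ∑ xs λ x → ∑ (g x) f
  ∑-concatMap g []       f = refl
  ∑-concatMap g (x ∷ xs) f = trans (∑-++ (g x) _ f) (cong (∑ (g x) f +_) (∑-concatMap g xs f))

  ∑-∈ : ∀ {xs : List A} {x} (f : A → ℕ) → x ∈ xs → f x ≤ ∑ xs f
  ∑-∈ f (here refl)  = m≤m+n _ _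
  ∑-∈ f (there x∈xs) = ≤-trans (∑-∈ f x∈xs) (m≤n+m _ _)

  ∑-suc : ∀ (xs : List A) f → ∑ xs (λ x → suc (f x)) ≡ length xs + ∑ xs f
  ∑-suc xs f = trans (∑-+ xs (λ _ → 1) f) (cong (_+ ∑ xs f) (trans (∑-const xs 1) (*-identityʳ _)))

  vecs : List A → ∀ N → List (Vec A N)
  vecs xs zero    = [] ∷ []
  vecs xs (suc N) = concatMap (λ x → map (x ∷_) (vecs xs N)) xs

  ∑-vecs : ∀ (xs : List A) N (f : Vec A (suc N) → ℕ) →
    ∑ (vecs xs (suc N)) f ≡ ∑ xs λ x → ∑ (vecs xs N) λ v → f (x ∷ v)
  ∑-vecs xs N f = trans (∑-concatMap _ xs f) (∑-cong xs λ x → ∑-map (x ∷_) (vecs xs N) f)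

  ∈-vecs : ∀ {xs : List A} {N} → (∀ x → x ∈ xs) → (v : Vec A N) → v ∈ vecs xs N
  ∈-vecs h []      = here refl
  ∈-vecs h (x ∷ v) = ∈-concatMap⁺ _ (Any.map (λ { refl → ∈-map⁺ _ (∈-vecs h v) }) (h x))

  length-∑ : ∀ (xs : List A) → length xs ≡ ∑ xs (λ _ → 1)
  length-∑ xs = sym (trans (∑-const xs 1) (*-identityʳ _))

  length-vecs : ∀ (xs : List A) N → length (vecs xs N) ≡ length xs ^ N
  length-vecs xs zero    = refl
  length-vecs xs (suc N) = trans (length-∑ (vecs xs (suc N))) (trans (∑-vecs xs N (λ _ → 1))
    (trans (∑-cong xs λ _ → sym (length-∑ (vecs xs N)))
    (trans (∑-const xs _) (cong (length xs *_) (length-vecs xs N)))))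

  ∑-vecs-const : ∀ (xs : List A) N c → ∑ (vecs xs N) (λ _ → c) ≡ length xs ^ N * c
  ∑-vecs-const xs N c = trans (∑-const (vecs xs N) c) (cong (_* c) (length-vecs xs N))

  length-allFin : ∀ n → length (allFin n) ≡ n
  length-allFin n = length-tabulate id

  ∑-allFin-suc : ∀ n (f : Fin (suc n) → ℕ) → ∑ (allFin (suc n)) f ≡ f zero + ∑ (allFin n) (f ∘ suc)
  ∑-allFin-suc n f = cong (f zero +_)
    (trans (cong (λ l → ∑ l f) (sym (map-tabulate id suc))) (∑-map suc (allFin n) f))

  ∑-allFin-const : ∀ n c → ∑ (allFin n) (λ _ → c) ≡ n * c
  ∑-allFin-const n c = trans (∑-const (allFin n) c) (cong (_* c) (length-allFin n))

  ∑-cartesianProduct : ∀ {A B : Set} (xs : List A) (ys : List B) f →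
    ∑ (cartesianProduct xs ys) f ≡ ∑ xs λ x → ∑ ys λ y → f (x , y)
  ∑-cartesianProduct []       ys f = refl
  ∑-cartesianProduct (x ∷ xs) ys f = trans (∑-++ (List.map (x ,_) ys) _ f)
    (cong₂ _+_ (∑-map (x ,_) ys f) (∑-cartesianProduct xs ys f))

  length-cartesianProduct : ∀ {A B : Set} (xs : List A) (ys : List B) →
    length (cartesianProduct xs ys) ≡ length xs * length ys
  length-cartesianProduct xs ys = begin
    length (cartesianProduct xs ys)            ≡⟨ length-∑ (cartesianProduct xs ys) ⟩
    ∑ (cartesianProduct xs ys) (λ _ → 1)       ≡⟨ ∑-cartesianProduct xs ys (λ _ → 1) ⟩
    ∑ xs (λ _ → ∑ ys λ _ → 1)                  ≡⟨ ∑-cong xs (λ _ → length-∑ ys) ⟨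
    ∑ xs (λ _ → length ys)                     ≡⟨ ∑-const xs (length ys) ⟩
    length xs * length ys                      ∎
    where open ≡-Reasoning

  -- Bernoulli inequalities over the natural numbers

  bernoulli : ∀ x y w → x ^ suc w + suc w * y * x ^ w ≤ (x + y) ^ suc w
  bernoulli x y zero    = ≤-reflexive (e x y)
    where
    e : ∀ x y → x * 1 + (y + 0) * 1 ≡ (x + y) * 1
    e = solve-∀
  bernoulli x y (suc w) = begin
    x ^ (2 + w) + (2 + w) * y * x ^ suc w
      ≤⟨ m≤m+n _ _ ⟩
    x ^ (2 + w) + (2 + w) * y * x ^ suc w + suc w * y * y * x ^ w
      ≡⟨ e x y w (x ^ w) ⟩
    (x + y) * (x ^ suc w + suc w * y * x ^ w)
      ≤⟨ *-monoʳ-≤ (x + y) (bernoulli x y w) ⟩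
    (x + y) ^ (2 + w) ∎
    where
    open ≤-Reasoning
    e : ∀ x y w m → x * (x * m) + (2 + w) * y * (x * m) + suc w * y * y * m ≡ (x + y) *
        (x * m + suc w * y * m)
    e = solve-∀

  -- With n = h + k and r = n - ck this is (1 - k/n)^c ≥ 1 - ck/n after clearing denominators. An
  -- equation determines `r`, so that no truncated subtraction occurs.
  bernoulli-∸ : ∀ h k r c → r + c * k ≡ h + k → r * (h + k) ^ c ≤ (h + k) * h ^ c
  bernoulli-∸ h k r zero    e = ≤-reflexive (cong (_* 1) (trans (sym (+-identityʳ r)) e))
  bernoulli-∸ h k r (suc c) e = begin
    r * (n * n ^ c)       ≡⟨ *-assoc r n (n ^ c) ⟨
    r * n * n ^ c         ≤⟨ *-monoˡ-≤ (n ^ c) r*n ⟩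
    (r + k) * h * n ^ c   ≡⟨ e₁ (r + k) h (n ^ c) ⟩
    h * ((r + k) * n ^ c) ≤⟨ *-monoʳ-≤ h (bernoulli-∸ h k (r + k) c (trans (+-assoc r k _) e)) ⟩
    h * (n * h ^ c)       ≡⟨ e₂ h n (h ^ c) ⟩
    n * (h * h ^ c)       ∎
    where
    open ≤-Reasoning
    n = h + k
    e₁ : ∀ r h m → r * h * m ≡ h * (r * m)
    e₁ = solve-∀
    e₂ : ∀ h n m → h * (n * m) ≡ n * (h * m)
    e₂ = solve-∀
    e₃ : ∀ r h k → r * (h + k) ≡ r * h + k * r
    e₃ = solve-∀
    e₄ : ∀ r c k → r + suc c * k ≡ r + c * k + k
    e₄ = solve-∀
    r≤h : r ≤ h
    r≤h = +-cancelʳ-≤ k r h (≤-trans (+-monoˡ-≤ k (m≤m+n r (c * k)))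
        (≤-reflexive (trans (sym (e₄ r c k)) e)))
    r*n : r * n ≤ (r + k) * h
    r*n = begin
      r * (h + k)     ≡⟨ e₃ r h k ⟩
      r * h + k * r   ≤⟨ +-monoʳ-≤ (r * h) (*-monoʳ-≤ k r≤h) ⟩
      r * h + k * h   ≡⟨ *-distribʳ-+ h r k ⟨
      (r + k) * h     ∎

  bernoulli-pred : ∀ h r c → r + c ≡ suc h → r * suc h ^ c ≤ suc h * h ^ c
  bernoulli-pred h r c e = subst (λ n → r * n ^ c ≤ n * h ^ c) (+-comm h 1)
    (bernoulli-∸ h 1 r c (trans (cong (r +_) (*-identityʳ c)) (trans e (+-comm 1 h))))

  ^-distribʳ-* : ∀ n x y → (x * y) ^ n ≡ x ^ n * y ^ n
  ^-distribʳ-* zero    x y = refl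
  ^-distribʳ-* (suc n) x y = trans (cong (x * y *_) (^-distribʳ-* n x y)) (e x y (x ^ n) (y ^ n))
    where
    e : ∀ x y m n → x * y * (m * n) ≡ x * m * (y * n)
    e = solve-∀

  -- Binomial coefficients against powers

  P≡P′ : ∀ {n k} → k ≤ n → n Combinatorics.P k ≡ n P′ k
  P≡P′ {n} {k} k≤n with k ≤ᵇ n | ≤⇒≤ᵇ k≤n
  ... | true | _ = refl

  k!*nCk≡nP′k : ∀ {n k} → k ≤ n → k ! * (n C k) ≡ n P′ k
  k!*nCk≡nP′k {n} {k} k≤n = begin
    k ! * (n C k)           ≡⟨ *-comm (k !) _ ⟩
    (n C k) * k !           ≡⟨ cong (_* k !) (nCk≡nPk/k! k≤n) ⟩
    (n Combinatorics.P k) / k ! * k !     ≡⟨ cong (λ z → z / k ! * k !) (P≡P′ k≤n) ⟩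
    (n P′ k) / k ! * k !    ≡⟨ m/n*n≡m (k!∣nP′k k≤n) ⟩
    n P′ k                  ∎
    where
    open ≡-Reasoning
    instance _ = k !≢0

  -- Together with `k!*nCk≤n^k` this trades degrees normalised by binomial coefficients for
  -- densities of ordered tuples.
  [n∸k]^k≤k!*nCk : ∀ {n k} → k ≤ n → (n ∸ k) ^ k ≤ k ! * (n C k)
  [n∸k]^k≤k!*nCk {n} {k} k≤n = ≤-trans (go k) (≤-reflexive (sym (k!*nCk≡nP′k k≤n)))
    where
    go : ∀ k → (n ∸ k) ^ k ≤ n P′ k
    go zero    = ≤-refl
    go (suc k) = *-mono-≤ n∸k (≤-trans (^-monoˡ-≤ k n∸k) (go k))
      where n∸k = ∸-monoʳ-≤ n (n≤1+n k)

  k!*nCk≤n^k : ∀ n k → k ! * (n C k) ≤ n ^ k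
  k!*nCk≤n^k n k with k ≤? n
  ... | no k≰n  = ≤-trans (≤-reflexive (trans (cong (k ! *_) (k>n⇒nCk≡0 (≰⇒> k≰n)))
      (*-zeroʳ (k !)))) z≤n
  ... | yes k≤n = ≤-trans (≤-reflexive (k!*nCk≡nP′k k≤n)) (go k)
    where
    go : ∀ k → n P′ k ≤ n ^ k
    go zero    = ≤-refl
    go (suc k) = *-mono-≤ (m∸n≤m n k) (go k)

  nCk>0 : ∀ {n k} → k ≤ n → 0 < n C k
  nCk>0 {n} {k} k≤n with n C k in eq
  ... | suc _ = z<s
  ... | zero  = ⊥-elim (<-irrefl (sym (trans (sym (k!*nCk≡nP′k k≤n))
      (trans (cong (k ! *_) eq) (*-zeroʳ (k !))))) (pos k k≤n))
    where
    pos : ∀ k → k ≤ n → 0 < n P′ k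
    pos zero    _   = z<s
    pos (suc k) k<n = *-mono-< (m<n⇒0<n∸m k<n) (pos k (<⇒≤ k<n))

  -- Addition modulo s

  reduce : ℕ → ℕ → ℕ
  reduce s m with m <? s
  ... | yes _ = m
  ... | no  _ = m ∸ s

  reduce< : ∀ {s m} → m < s + s → reduce s m < s
  reduce< {s} {m} m<2s with m <? s
  ... | yes m<s = m<s
  ... | no  m≮s = +-cancelʳ-< s _ s (subst (_< s + s) (sym (m∸n+n≡m (≮⇒≥ m≮s))) m<2s)

  reduce-injective : ∀ {s i t t′} → t < s → t′ < s → reduce s (i + t) ≡ reduce s (i + t′) → t ≡ t′
  reduce-injective {s} {i} {t} {t′} t<s t′<s eq with i + t <? s | i + t′ <? s
  ... | yes _  | yes _  = +-cancelˡ-≡ i _ _ eq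
  ... | no ge  | no ge′ = +-cancelˡ-≡ i _ _ (∸-cancelʳ-≡ (≮⇒≥ ge) (≮⇒≥ ge′) eq)
  ... | yes _  | no ge′ = ⊥-elim (<-irrefl (wrap t t′ ge′ eq) (<-≤-trans t′<s (m≤n+m s t)))
    where
    wrap : ∀ t t′ → ¬ (i + t′ < s) → i + t ≡ i + t′ ∸ s → t′ ≡ t + s
    wrap t t′ ge′ eq = +-cancelˡ-≡ i _ _ (sym
        (trans (sym (+-assoc i t s)) (trans (cong (_+ s) eq) (m∸n+n≡m (≮⇒≥ ge′)))))
  ... | no ge  | yes _  = ⊥-elim (<-irrefl (wrap t′ t ge (sym eq)) (<-≤-trans t<s (m≤n+m s t′)))
    where
    wrap : ∀ t t′ → ¬ (i + t′ < s) → i + t ≡ i + t′ ∸ s → t′ ≡ t + s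
    wrap t t′ ge′ eq = +-cancelˡ-≡ i _ _ (sym
        (trans (sym (+-assoc i t s)) (trans (cong (_+ s) eq) (m∸n+n≡m (≮⇒≥ ge′)))))

  -- Addition in the cyclic group of order s. As a Latin square it cuts an s × s array into s
  -- transversals. Injectivity in the second argument keeps the map from offsets to vertices
  -- injective; injectivity in the first tells the transversals apart.
  shift : ∀ {s} → Fin s → Fin s → Fin s
  shift i t = fromℕ< (reduce< (+-mono-< (Fin.toℕ<n i) (Fin.toℕ<n t)))

  toℕ-shift : ∀ {s} (i t : Fin s) → toℕ (shift i t) ≡ reduce s (toℕ i + toℕ t)
  toℕ-shift i t = Fin.toℕ-fromℕ< _

  shift-comm : ∀ {s} (i t : Fin s) → shift i t ≡ shift t i
  shift-comm {s} i t = Fin.toℕ-injective (trans (toℕ-shift i t)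
    (trans (cong (reduce s) (+-comm (toℕ i) (toℕ t))) (sym (toℕ-shift t i))))

  shift-injectiveʳ : ∀ {s} {i t t′ : Fin s} → shift i t ≡ shift i t′ → t ≡ t′
  shift-injectiveʳ {s} {i} {t} {t′} eq = Fin.toℕ-injective
      (reduce-injective {i = toℕ i} (Fin.toℕ<n t) (Fin.toℕ<n t′)
    (trans (sym (toℕ-shift i t)) (trans (cong toℕ eq) (toℕ-shift i t′))))

  shift-injectiveˡ : ∀ {s} {i i′ t : Fin s} → shift i t ≡ shift i′ t → i ≡ i′
  shift-injectiveˡ {s} {i} {i′} {t} eq =
    shift-injectiveʳ {i = t} (trans (shift-comm t i) (trans eq (shift-comm i′ t)))

  n≤2^n : ∀ n → n ≤ 2 ^ n
  n≤2^n zero    = z≤n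
  n≤2^n (suc n) = ≤-trans (+-mono-≤ (m^n>0 2 n) (n≤2^n n))
      (≤-reflexive (cong (2 ^ n +_) (sym (+-identityʳ _))))

  -- Compares tuples of vertices with tuples of the s * q row entries. At most s vertices lie
  -- outside the rows, and (q + 1)^c ≤ 2 q^c by Bernoulli once 2c ≤ q + 1.
  n^c≤2*s^c*q^c : ∀ {n q s} c → n ≤ s * suc q → 2 * c ≤ suc q → n ^ c ≤ 2 * (s ^ c * q ^ c)
  n^c≤2*s^c*q^c {n} {q} {s} c n≤ 2c≤ = begin
    n ^ c                     ≤⟨ ^-monoˡ-≤ c n≤ ⟩
    (s * suc q) ^ c           ≡⟨ ^-distribʳ-* c s (suc q) ⟩
    s ^ c * suc q ^ c         ≤⟨ *-monoʳ-≤ (s ^ c) (*-cancelˡ-≤ (suc q) scaled) ⟩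
    s ^ c * (2 * q ^ c)       ≡⟨ e₁ (s ^ c) (q ^ c) ⟩
    2 * (s ^ c * q ^ c)       ∎
    where
    open ≤-Reasoning
    e₁ : ∀ x y → x * (2 * y) ≡ 2 * (x * y)
    e₁ = solve-∀
    e₂ : ∀ q x → 2 * (q * x) ≡ q * (2 * x)
    e₂ = solve-∀
    c≤sq : c ≤ suc q
    c≤sq = ≤-trans (m≤m+n c _) 2c≤
    r = suc q ∸ c
    r+c : r + c ≡ suc q
    r+c = m∸n+n≡m c≤sq
    sq≤2r : suc q ≤ 2 * r
    sq≤2r = +-cancelʳ-≤ (suc q) _ _ (begin
      suc q + suc q       ≡⟨ cong (suc q +_) (+-identityʳ (suc q)) ⟨
      2 * suc q           ≡⟨ cong (2 *_) r+c ⟨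
      2 * (r + c)         ≡⟨ *-distribˡ-+ 2 r c ⟩
      2 * r + 2 * c       ≤⟨ +-monoʳ-≤ (2 * r) 2c≤ ⟩
      2 * r + suc q       ∎)
    scaled : suc q * suc q ^ c ≤ suc q * (2 * q ^ c)
    scaled = begin
      suc q * suc q ^ c      ≤⟨ *-monoˡ-≤ (suc q ^ c) sq≤2r ⟩
      2 * r * suc q ^ c      ≡⟨ *-assoc 2 r _ ⟩
      2 * (r * suc q ^ c)    ≤⟨ *-monoʳ-≤ 2 (bernoulli-pred q r c r+c) ⟩
      2 * (suc q * q ^ c)    ≡⟨ e₂ (suc q) (q ^ c) ⟩
      suc q * (2 * q ^ c)    ∎

module Counting (em : ExcludedMiddle 0ℓ) where

  open Finite
  open import Data.Bool.Base using (_∧_)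
  open import Data.Bool.Properties using (T-∧)
  open import Data.Nat.Base
  open import Data.Nat.Properties
  open import Data.Nat.Combinatorics using (_C_)
  open import Data.Nat.Tactic.RingSolver using (solve-∀)
  import Data.Fin.Properties as Fin
  open import Data.Fin.Subset using (Subset; inside; outside; ⁅_⁆; _∪_; _⊆_; ⊥) renaming
      (∣_∣ to card; _∈_ to _∈ˢ_; _∉_ to _∉ˢ_)
  open import Data.Fin.Subset.Properties using
      (x∈⁅x⁆; x∈⁅y⁆⇒x≡y; p⊆p∪q; x∈p∪q⁻; x∈p∪q⁺; ∪-identityʳ; ∉⊥; drop-there; ⊆-antisym; ∣⊥∣≡0)
  open import Data.List.Properties using (length-++; length-tabulate)
  open import Data.List.Extrema.Nat using (min≤xs; argmin-sel)
  import Data.List.Relation.Unary.All as All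
  open import Data.List.Membership.Propositional using (_∈_; _∉_)
  open import Data.List.Membership.Propositional.Properties using
      (∈-++⁺ˡ; ∈-++⁺ʳ; ∈-map⁺; ∈-map⁻; ∈-filter⁺; ∈-filter⁻; ∈-tabulate⁺; ∈-allFin;
      ∈-cartesianProduct⁺)
  open import Data.List.Relation.Unary.Any using (here; there)
  open import Data.Vec.Base as Vec using (Vec; []; _∷_; lookup; toList; head; _[_]≔_; here; there)
  open import Data.Vec.Properties using (lookup∘update; lookup∘update′; lookup∘tabulate;
      lookup-zipWith; length-toList; []=⇒lookup; lookup⇒[]=)
  open import Data.Product.Properties using (,-injectiveˡ; ,-injectiveʳ)
  open import Data.Sum.Function.Propositional using (_⊎-↔_)
  open import Data.Unit.Base using (⊤; tt)
  open import Function.Bundles using (Equivalence; _⇔_; mk⇔; _↔_; Inverse)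
  open import Function.Construct.Identity using (↔-id)
  open import Function.Construct.Composition using (_↔-∘_)
  open import Function.Definitions using (Injective)
  open import Relation.Nullary.Decidable using (isYes; toWitness; fromWitness)
  open import Relation.Unary using (Decidable)

  private variable
    A : Set

  private variable
    P Q R : Set

  -- Indicators of propositions and double counting

  abstract
    -- Being abstract, `ι P` does not unfold into a case distinction on `em`, so a later
    -- `with em {P}` leaves it intact in the goal and only the laws below apply.
    ι : Set → ℕ
    ι P with em {P}
    ... | yes _ = 1
    ... | no  _ = 0

    ι-yes : P → ι P ≡ 1
    ι-yes {P} p with em {P}
    ... | yes _  = refl
    ... | no  ¬p = ⊥-elim (¬p p)

    ι-no : ¬ P → ι P ≡ 0
    ι-no {P} ¬p with em {P}
    ... | yes p = ⊥-elim (¬p p)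
    ... | no  _ = refl

    ι≤1 : ∀ P → ι P ≤ 1
    ι≤1 P with em {P}
    ... | yes _ = ≤-refl
    ... | no  _ = z≤n

    ι-pos : 0 < ι P → P
    ι-pos {P} h with em {P}
    ι-pos _  | yes p = p
    ι-pos () | no  _

    ι-mono : (P → Q) → ι P ≤ ι Q
    ι-mono {P} {Q} f with em {P}
    ... | yes p = ≤-reflexive (sym (ι-yes (f p)))
    ... | no  _ = z≤n

    ι-⇔ : (P → Q) → (Q → P) → ι P ≡ ι Q
    ι-⇔ f g = ≤-antisym (ι-mono f) (ι-mono g)

    ι-* : ∀ {m n} → (P → m ≤ n) → ι P * m ≤ ι P * n
    ι-* {P} h with em {P}
    ... | yes p = *-monoʳ-≤ 1 (h p)
    ... | no  _ = z≤n

    ι-× : ι (P × Q) ≡ ι P * ι Q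
    ι-× {P} {Q} with em {P}
    ... | yes p = trans (ι-⇔ proj₂ (p ,_)) (sym (*-identityˡ _))
    ... | no ¬p = ι-no (¬p ∘ proj₁)

    ι-⊎ : (P → Q ⊎ R) → ι P ≤ ι Q + ι R
    ι-⊎ {P} {Q} {R} f with em {P}
    ... | no  _ = z≤n
    ... | yes p with f p
    ...   | inj₁ q = ≤-trans (≤-reflexive (sym (ι-yes q))) (m≤m+n _ _)
    ...   | inj₂ r = ≤-trans (≤-reflexive (sym (ι-yes r))) (m≤n+m _ _)

    ι-¬ : ∀ P → ι P + ι (¬ P) ≡ 1
    ι-¬ P with em {P}
    ... | yes p = cong suc (ι-no λ ¬p → ¬p p)
    ... | no ¬p = ι-yes ¬p

  ∑-ι-× : ∀ (xs : List A) (f : A → Set) → ∑ xs (λ x → ι (P × f x)) ≡ ι P * ∑ xs (ι ∘ f)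
  ∑-ι-× {P = P} xs f = trans (∑-cong xs λ _ → ι-×) (∑-*ˡ xs (ι P) (ι ∘ f))

  average : ∀ (xs : List A) f c → 0 < length xs → length xs * c ≤ ∑ xs f → ∃ λ x → c ≤ f x
  average xs f c 0<l h with em {∃ λ x → c ≤ f x}
  ... | yes p = p
  ... | no ¬p = ⊥-elim (<-irrefl refl (begin-strict
    ∑ xs f               <⟨ m<n+m _ 0<l ⟩
    length xs + ∑ xs f   ≡⟨ ∑-suc xs f ⟨
    ∑ xs (λ x → suc (f x)) ≤⟨ ∑-mono xs (λ x → ≰⇒> (λ c≤ → ¬p (x , c≤))) ⟩
    ∑ xs (λ _ → c)       ≡⟨ ∑-const xs c ⟩
    length xs * c        ≤⟨ h ⟩
    ∑ xs f               ∎))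
    where open ≤-Reasoning

  ∑-pos : ∀ (xs : List A) f → 0 < ∑ xs f → ∃ λ x → 0 < f x
  ∑-pos (x ∷ xs) f h with f x in eq
  ... | suc m = x , subst (0 <_) (sym eq) z<s
  ... | zero  = ∑-pos xs f h

  ∑-point : ∀ n (v : Fin n) (f : Fin n → ℕ) → ∑ (allFin n) (λ i → ι (i ≡ v) * f i) ≡ f v
  ∑-point (suc n) zero f = begin
    ∑ (allFin (suc n)) (λ i → ι (i ≡ zero) * f i)
      ≡⟨ ∑-allFin-suc n _ ⟩
    ι (zero ≡ zero) * f zero + ∑ (allFin n) (λ i → ι (suc i ≡ zero) * f (suc i))
      ≡⟨ cong₂ _+_ (cong (_* f zero) (ι-yes refl))
           (∑-cong (allFin n) λ i → cong (_* f (suc i)) (ι-no λ ())) ⟩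
    1 * f zero + ∑ (allFin n) (λ i → 0)
      ≡⟨ cong₂ _+_ (*-identityˡ _) (∑-zero (allFin n)) ⟩
    f zero + 0  ≡⟨ +-identityʳ _ ⟩
    f zero ∎
    where open ≡-Reasoning
  ∑-point (suc n) (suc v) f = begin
    ∑ (allFin (suc n)) (λ i → ι (i ≡ suc v) * f i)
      ≡⟨ ∑-allFin-suc n _ ⟩
    ι (zero ≡ suc v) * f zero + ∑ (allFin n) (λ i → ι (suc i ≡ suc v) * f (suc i))
      ≡⟨ cong₂ _+_ (cong (_* f zero) (ι-no λ ()))
           (∑-cong (allFin n) λ i → cong (_* f (suc i))
               (ι-⇔ (λ { refl → refl }) (λ { refl → refl }))) ⟩
    ∑ (allFin n) (λ i → ι (i ≡ v) * f (suc i))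
      ≡⟨ ∑-point n v (f ∘ suc) ⟩
    f (suc v) ∎
    where open ≡-Reasoning

  ∑-point-1 : ∀ n (v : Fin n) → ∑ (allFin n) (λ i → ι (i ≡ v)) ≡ 1
  ∑-point-1 n v = trans (∑-cong (allFin n) λ i → sym (*-identityʳ _)) (∑-point n v (λ _ → 1))

  ∑-ι-unique : ∀ n (P : Fin n → Set) → (∀ {i j} → P i → P j → i ≡ j) →
    ∑ (allFin n) (ι ∘ P) ≤ ι (∃ P)
  ∑-ι-unique n P uniq with em {∃ P}
  ... | yes (i , p) = ≤-trans (∑-mono (allFin n) λ j → ι-mono λ q → uniq q p)
                        (≤-reflexive (trans (∑-point-1 n i) (sym (ι-yes (i , p)))))
  ... | no ¬p = ≤-trans (≤-reflexive (trans (∑-cong (allFin n) λ i → ι-no λ p → ¬p (i , p))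
      (∑-zero (allFin n)))) z≤n

  -- The fibre bound says at once that `xs` has no repetitions and that `g` is injective on it.
  ∑-pushforward : ∀ {n} (xs : List A) (g : A → Fin n) (h : Fin n → ℕ) →
    (∀ y → ∑ xs (λ a → ι (y ≡ g a)) ≤ 1) → ∑ xs (h ∘ g) ≤ ∑ (allFin n) h
  ∑-pushforward {n = n} xs g h fibre = begin
    ∑ xs (h ∘ g)
      ≡⟨ ∑-cong xs (λ a → ∑-point n (g a) h) ⟨
    ∑ xs (λ a → ∑ (allFin n) λ y → ι (y ≡ g a) * h y)
      ≡⟨ ∑-swap xs (allFin n) _ ⟩
    ∑ (allFin n) (λ y → ∑ xs λ a → ι (y ≡ g a) * h y)
      ≡⟨ ∑-cong (allFin n) (λ y → ∑-*ʳ xs (h y) _) ⟩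
    ∑ (allFin n) (λ y → ∑ xs (λ a → ι (y ≡ g a)) * h y)
      ≤⟨ ∑-mono (allFin n) (λ y → *-monoˡ-≤ (h y) (fibre y)) ⟩
    ∑ (allFin n) (λ y → 1 * h y)
      ≡⟨ ∑-cong (allFin n) (λ y → *-identityˡ _) ⟩
    ∑ (allFin n) h ∎
    where open ≤-Reasoning

  -- Large deviations

  hits : ∀ {b} → (A → Set) → Vec A b → ℕ
  hits P []       = 0
  hits P (u ∷ us) = ι (P u) + hits P us

  -- Linearity of expectation. The extra factor `length xs` on the left avoids the exponent b - 1.
  ∑-hits : ∀ (xs : List A) P b →
    length xs * ∑ (vecs xs b) (hits P) ≡ b * (length xs ^ b * ∑ xs (ι ∘ P))
  ∑-hits xs P zero    = *-zeroʳ (length xs)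
  ∑-hits xs P (suc b) = begin
    L * ∑ (vecs xs (suc b)) (hits P)
      ≡⟨ cong (L *_) (∑-vecs xs b (hits P)) ⟩
    L * ∑ xs (λ x → ∑ (vecs xs b) λ v → ι (P x) + hits P v)
      ≡⟨ cong (L *_) (∑-cong xs λ x → trans (∑-+ (vecs xs b) _ _)
        (cong (_+ H) (∑-vecs-const xs b _))) ⟩
    L * ∑ xs (λ x → L ^ b * ι (P x) + H)
      ≡⟨ cong (L *_) (trans (∑-+ xs _ _) (cong₂ _+_ (∑-*ˡ xs (L ^ b) _) (∑-const xs H))) ⟩
    L * (L ^ b * p + L * H)
      ≡⟨ cong (λ z → L * (L ^ b * p + z)) (∑-hits xs P b) ⟩
    L * (L ^ b * p + b * (L ^ b * p))
      ≡⟨ rearrange L (L ^ b) p b ⟩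
    suc b * (L * L ^ b * p) ∎
    where
    open ≡-Reasoning
    L = length xs
    p = ∑ xs (ι ∘ P)
    H = ∑ (vecs xs b) (hits P)
    rearrange : ∀ l m p b → l * (m * p + b * (m * p)) ≡ suc b * (l * m * p)
    rearrange = solve-∀

  -- If P has density at most a/w, a sample of size b has at most ab/w hits on average, so more than
  -- (2 + a)b/w hits occur with probability at most a/(2 + a). Of the remaining 2/(2 + a), one half
  -- will pay for samples with repetitions.
  markov : ∀ (xs : List A) P a w b → 0 < length xs → 0 < b → w * ∑ xs (ι ∘ P) ≤ a * length xs →
    2 * length xs ^ b ≤ (2 + a) * ∑ (vecs xs b) (λ τ → ι (w * hits P τ ≤ (2 + a) * b))
  markov xs P a w b 0<L 0<b sparse = +-cancelʳ-≤ (a * L ^ b) _ _ (begin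
    2 * L ^ b + a * L ^ b  ≡⟨ *-distribʳ-+ (L ^ b) 2 a ⟨
    (2 + a) * L ^ b        ≤⟨ *-cancelʳ-≤ _ _ (b * L) {{>-nonZero (*-mono-< 0<b 0<L)}} main ⟩
    (2 + a) * T + a * L ^ b ∎)
    where
    open ≤-Reasoning
    L = length xs
    p = ∑ xs (ι ∘ P)
    H = ∑ (vecs xs b) (hits P)
    Small = λ τ → w * hits P τ ≤ (2 + a) * b
    T = ∑ (vecs xs b) (ι ∘ Small)
    pointwise : ∀ τ → (2 + a) * b ≤ w * hits P τ + (2 + a) * b * ι (Small τ)
    pointwise τ with em {Small τ}
    ... | yes small = ≤-trans (≤-reflexive (sym
        (trans (cong ((2 + a) * b *_) (ι-yes small)) (*-identityʳ _)))) (m≤n+m _ _)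
    ... | no ¬small = ≤-trans (<⇒≤ (≰⇒> ¬small)) (m≤m+n _ _)
    e₁ : ∀ m a b l → (2 + a) * m * (b * l) ≡ l * (m * ((2 + a) * b))
    e₁ = solve-∀
    e₂ : ∀ l w h a b t → l * (w * h + (2 + a) * b * t) ≡ w * (l * h) + (2 + a) * t * (b * l)
    e₂ = solve-∀
    e₃ : ∀ w b m p → w * (b * (m * p)) ≡ b * m * (w * p)
    e₃ = solve-∀
    e₄ : ∀ b m a l t → b * m * (a * l) + (2 + a) * t * (b * l) ≡ ((2 + a) * t + a * m) * (b * l)
    e₄ = solve-∀
    main : (2 + a) * L ^ b * (b * L) ≤ ((2 + a) * T + a * L ^ b) * (b * L)
    main = begin
      (2 + a) * L ^ b * (b * L)
        ≡⟨ e₁ (L ^ b) a b L ⟩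
      L * (L ^ b * ((2 + a) * b))
        ≡⟨ cong (L *_) (∑-vecs-const xs b _) ⟨
      L * ∑ (vecs xs b) (λ _ → (2 + a) * b)
        ≤⟨ *-monoʳ-≤ L (∑-mono (vecs xs b) pointwise) ⟩
      L * ∑ (vecs xs b) (λ τ → w * hits P τ + (2 + a) * b * ι (Small τ))
        ≡⟨ cong (L *_) (trans (∑-+ (vecs xs b) _ _)
          (cong₂ _+_ (∑-*ˡ (vecs xs b) w _) (∑-*ˡ (vecs xs b) ((2 + a) * b) _))) ⟩
      L * (w * H + (2 + a) * b * T)
        ≡⟨ e₂ L w H a b T ⟩
      w * (L * H) + (2 + a) * T * (b * L)
        ≡⟨ cong (λ z → w * z + (2 + a) * T * (b * L)) (∑-hits xs P b) ⟩
      w * (b * (L ^ b * p)) + (2 + a) * T * (b * L)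
        ≡⟨ cong (_+ (2 + a) * T * (b * L)) (e₃ w b (L ^ b) p) ⟩
      b * L ^ b * (w * p) + (2 + a) * T * (b * L)
        ≤⟨ +-monoˡ-≤ _ (*-monoʳ-≤ (b * L ^ b) sparse) ⟩
      b * L ^ b * (a * L) + (2 + a) * T * (b * L)
        ≡⟨ e₄ b (L ^ b) a L T ⟩
      ((2 + a) * T + a * L ^ b) * (b * L) ∎

  ∏ : ∀ {b} → (A → ℕ) → Vec A b → ℕ
  ∏ f []       = 1
  ∏ f (u ∷ us) = f u * ∏ f us

  -- Independence: the total weight of samples factorises over their entries.
  ∑-∏ : ∀ (xs : List A) f b → ∑ (vecs xs b) (∏ f) ≡ ∑ xs f ^ b
  ∑-∏ xs f zero    = refl
  ∑-∏ xs f (suc b) = trans (∑-vecs xs b (∏ f))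
    (trans (∑-cong xs λ x → trans (∑-*ˡ (vecs xs b) (f x) _) (cong (f x *_) (∑-∏ xs f b)))
           (∑-*ʳ xs _ f))

  -- Exponential moments, with weight `h₁` for a hit and `h` = (c + 1)² for a miss. The mean number
  -- of hits is at least (2 + c)b, and the probability of at most cb hits is shown to be at most
  -- (h/(h + 1))^b.
  chernoff : ∀ (xs : List A) P c w b → let h = suc (c * (2 + c)) in
    0 < c → 0 < w → (2 + c) * length xs ≤ w * ∑ xs (ι ∘ P) →
    ∑ (vecs xs (w * b)) (λ us → ι (hits P us ≤ c * b)) * suc h ^ b ≤ length xs ^ (w * b) * h ^ b
  chernoff xs P c w@(suc w′) b 0<c _ dense =
    *-cancelʳ-≤ _ _ (h₁ ^ N * h ^ B) {{>-nonZero (*-mono-< (m^n>0 h₁ {{h₁≢0}} N) (m^n>0 h B))}}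
        (begin
      T * suc h ^ b * (h₁ ^ N * h ^ B)
        ≡⟨ e₁ T (suc h ^ b) (h₁ ^ N * h ^ B) ⟩
      T * (h₁ ^ N * h ^ B) * suc h ^ b
        ≤⟨ *-monoˡ-≤ (suc h ^ b) weighted ⟩
      h ^ N * F ^ B * suc h ^ b
        ≡⟨ power₁ ⟩
      (suc h * h ^ c * F ^ w) ^ b
        ≤⟨ ^-monoˡ-≤ b step ⟩
      (h * L ^ w * (h₁ ^ c * h ^ w)) ^ b
        ≡⟨ power₂ ⟩
      L ^ B * h ^ b * (h₁ ^ N * h ^ B) ∎)
    where
    open ≤-Reasoning
    h₁ = c * (2 + c)
    h = suc h₁
    N = c * b
    B = w * b
    L = length xs
    p = ∑ xs (ι ∘ P)
    h₁≢0 : NonZero h₁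
    h₁≢0 = >-nonZero (*-mono-< 0<c z<s)
    f : _ → ℕ
    f u = h₁ + ι (¬ P u)
    F = ∑ xs f
    T = ∑ (vecs xs B) (λ us → ι (hits P us ≤ N))
    e₁ : ∀ x y z → x * y * z ≡ x * z * y
    e₁ = solve-∀
    F+p : F + p ≡ L * h
    F+p = trans (sym (∑-+ xs f _)) (trans (∑-cong xs λ u → trans (+-assoc h₁ _ _)
      (trans (cong (h₁ +_) (trans (+-comm (ι (¬ P u)) _) (ι-¬ (P u)))) (+-comm h₁ 1)))
          (∑-const xs h))
    ∏-hits : ∀ {b} (us : Vec _ b) → ∏ f us * h ^ hits P us ≡ h₁ ^ hits P us * h ^ b
    ∏-hits []       = refl
    ∏-hits {suc b} (u ∷ us) with em {P u}
    ... | yes p = trans (cong₂ (λ x y → (h₁ + x) * ∏ f us * h ^ (y + hits P us)) (ι-no λ ¬p → ¬p p)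
        (ι-yes p))
                    (trans (trans (e h₁ (∏ f us) h (h ^ hits P us))
                        (trans (cong (h₁ * h *_) (∏-hits us)) (e′ h₁ h (h₁ ^ hits P us) (h ^ b))))
                      (cong (λ y → h₁ ^ (y + hits P us) * (h * h ^ b)) (sym (ι-yes p))))
      where
      e : ∀ g x h y → (g + 0) * x * (h * y) ≡ g * h * (x * y)
      e = solve-∀
      e′ : ∀ g h x y → g * h * (x * y) ≡ g * x * (h * y)
      e′ = solve-∀
    ... | no ¬p = trans (cong₂ (λ x y → (h₁ + x) * ∏ f us * h ^ (y + hits P us)) (ι-yes ¬p)
        (ι-no ¬p))
                    (trans (trans (e h₁ (∏ f us) (h ^ hits P us))
                        (trans (cong (h *_) (∏-hits us)) (e′ h (h₁ ^ hits P us) (h ^ b))))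
                      (cong (λ y → h₁ ^ (y + hits P us) * (h * h ^ b)) (sym (ι-no ¬p))))
      where
      e : ∀ g x y → (g + 1) * x * y ≡ suc g * (x * y)
      e = solve-∀
      e′ : ∀ h x y → h * (x * y) ≡ x * (h * y)
      e′ = solve-∀
    -- Exponential Markov inequality: a sample with at most N hits weighs at least (h₁/h)^N times as
    -- much as one without hits.
    weight : ∀ us → ι (hits P us ≤ N) * (h₁ ^ N * h ^ B) ≤ h ^ N * ∏ f us
    weight us with em {hits P us ≤ N}
    ... | no ¬small = ≤-trans (≤-reflexive (cong (_* (h₁ ^ N * h ^ B)) (ι-no ¬small))) z≤n
    ... | yes small = begin
      ι (hits P us ≤ N) * (h₁ ^ N * h ^ B)
        ≡⟨ trans (cong (_* (h₁ ^ N * h ^ B)) (ι-yes small)) (*-identityˡ _) ⟩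
      h₁ ^ N * h ^ B
        ≡⟨ cong (λ z → h₁ ^ z * h ^ B) (m∸n+n≡m small) ⟨
      h₁ ^ (d + x) * h ^ B
        ≡⟨ trans (cong (_* h ^ B) (^-distribˡ-+-* h₁ d x)) (*-assoc (h₁ ^ d) _ _) ⟩
      h₁ ^ d * (h₁ ^ x * h ^ B)
        ≡⟨ cong (h₁ ^ d *_) (∏-hits us) ⟨
      h₁ ^ d * (∏ f us * h ^ x)
        ≤⟨ *-monoˡ-≤ _ (^-monoˡ-≤ d (n≤1+n h₁)) ⟩
      h ^ d * (∏ f us * h ^ x)
        ≡⟨ e (h ^ d) (∏ f us) (h ^ x) ⟩
      h ^ d * h ^ x * ∏ f us
        ≡⟨ cong (_* ∏ f us) (trans (sym (^-distribˡ-+-* h d x)) (cong (h ^_) (m∸n+n≡m small))) ⟩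
      h ^ N * ∏ f us ∎
      where
      x = hits P us
      d = N ∸ x
      e : ∀ x y z → x * (y * z) ≡ x * z * y
      e = solve-∀
    weighted : T * (h₁ ^ N * h ^ B) ≤ h ^ N * F ^ B
    weighted = begin
      T * (h₁ ^ N * h ^ B)   ≡⟨ ∑-*ʳ (vecs xs B) _ _ ⟨
      ∑ (vecs xs B) (λ us → ι (hits P us ≤ N) * (h₁ ^ N * h ^ B)) ≤⟨ ∑-mono (vecs xs B) weight ⟩
      ∑ (vecs xs B) (λ us → h ^ N * ∏ f us) ≡⟨ trans (∑-*ˡ (vecs xs B) (h ^ N) _)
          (cong (h ^ N *_) (∑-∏ xs f B)) ⟩
      h ^ N * F ^ B ∎
    ^-* : ∀ x m n b → (x * m * n) ^ b ≡ x ^ b * m ^ b * n ^ b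
    ^-* x m n b = trans (^-distribʳ-* b (x * m) n) (cong (_* n ^ b) (^-distribʳ-* b x m))
    power₁ : h ^ N * F ^ B * suc h ^ b ≡ (suc h * h ^ c * F ^ w) ^ b
    power₁ = sym (trans (^-* (suc h) (h ^ c) (F ^ w) b)
      (trans (cong₂ (λ x y → suc h ^ b * x * y) (^-*-assoc h c b) (^-*-assoc F w b))
          (e (suc h ^ b) _ _)))
      where
      e : ∀ x y z → x * y * z ≡ y * z * x
      e = solve-∀
    power₂ : (h * L ^ w * (h₁ ^ c * h ^ w)) ^ b ≡ L ^ B * h ^ b * (h₁ ^ N * h ^ B)
    power₂ = trans (^-* h (L ^ w) (h₁ ^ c * h ^ w) b)
      (cong₂ _*_ (trans (*-comm (h ^ b) _) (cong (_* h ^ b) (^-*-assoc L w b)))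
                 (trans (^-distribʳ-* b (h₁ ^ c) (h ^ w))
                     (cong₂ _*_ (^-*-assoc h₁ c b) (^-*-assoc h w b))))
    -- This is h - c, so `drop-c` reads (1 - 1/h)^c ≥ 1 - c/h.
    r = c * suc c + 1
    drop-c : r * h ^ c ≤ h * h₁ ^ c
    drop-c = bernoulli-pred h₁ r c (e c)
      where
      e : ∀ c → c * suc c + 1 + c ≡ suc (c * (2 + c))
      e = solve-∀
    -- The mean weight relative to h is at most 1 - (2 + c)/(wh), and its w-th power is at most h/(h
    -- + 2 + c).
    drop-w : F ^ w * (h + (2 + c)) ≤ h * (L ^ w * h ^ w)
    drop-w = begin
      F ^ w * (h + (2 + c))
        ≡⟨ e₂ F (F ^ w′) h c ⟩
      h * F ^ w + F ^ w′ * ((2 + c) * F)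
        ≤⟨ +-monoʳ-≤ _ (*-monoʳ-≤ (F ^ w′) cF) ⟩
      h * F ^ w + F ^ w′ * (w * p * h)
        ≡⟨ e₃ h (F ^ w) (F ^ w′) (w * p) ⟩
      h * (F ^ w + w * p * F ^ w′)
        ≤⟨ *-monoʳ-≤ h (bernoulli F p w′) ⟩
      h * (F + p) ^ w
        ≡⟨ cong (h *_) (trans (cong (_^ w) F+p) (^-distribʳ-* w L h)) ⟩
      h * (L ^ w * h ^ w) ∎
      where
      e₂ : ∀ f g h c → f * g * (h + (2 + c)) ≡ h * (f * g) + g * ((2 + c) * f)
      e₂ = solve-∀
      e₃ : ∀ h x y z → h * x + y * (z * h) ≡ h * (x + z * y)
      e₃ = solve-∀
      cF : (2 + c) * F ≤ w * p * h
      cF = begin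
        (2 + c) * F        ≤⟨ *-monoʳ-≤ (2 + c) (≤-trans (m≤m+n F p) (≤-reflexive F+p)) ⟩
        (2 + c) * (L * h)  ≡⟨ *-assoc (2 + c) L h ⟨
        (2 + c) * L * h    ≤⟨ *-monoˡ-≤ h dense ⟩
        w * p * h          ∎
    -- What remains is h (h + 1) ≤ r (h + 2 + c). For h = (c + 1)² the two sides differ by exactly 1
    -- (`e₅`), so this `h` just suffices.
    step : suc h * h ^ c * F ^ w ≤ h * L ^ w * (h₁ ^ c * h ^ w)
    step = *-cancelˡ-≤ h (begin
      h * (suc h * h ^ c * F ^ w)
        ≡⟨ e₄ h (h ^ c) (F ^ w) ⟩
      h * suc h * (h ^ c * F ^ w)
        ≤⟨ *-monoˡ-≤ _ (≤-trans (m≤m+n _ 1) (≤-reflexive (sym (e₅ c)))) ⟩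
      r * (h + (2 + c)) * (h ^ c * F ^ w)
        ≡⟨ e₆ r (h + (2 + c)) (h ^ c) (F ^ w) ⟩
      r * h ^ c * (F ^ w * (h + (2 + c)))
        ≤⟨ *-mono-≤ drop-c drop-w ⟩
      h * h₁ ^ c * (h * (L ^ w * h ^ w))
        ≡⟨ e₇ h (h₁ ^ c) (L ^ w) (h ^ w) ⟩
      h * (h * L ^ w * (h₁ ^ c * h ^ w)) ∎)
      where
      e₄ : ∀ h x y → h * (suc h * x * y) ≡ h * suc h * (x * y)
      e₄ = solve-∀
      e₅ : ∀ c → (c * suc c + 1) * (suc (c * (2 + c)) + (2 + c)) ≡ suc (c * (2 + c)) * suc
          (suc (c * (2 + c))) + 1
      e₅ = solve-∀
      e₆ : ∀ r g x y → r * g * (x * y) ≡ r * x * (y * g)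
      e₆ = solve-∀
      e₇ : ∀ h x y z → h * x * (h * (y * z)) ≡ h * (h * y * (x * z))
      e₇ = solve-∀

  -- Sampling without replacement

  -- The list `F` grows along the vector, so one predicate expresses both distinct entries and
  -- avoidance of positions fixed in advance.
  Uniq : ∀ {N} → List A → Vec A N → Set
  Uniq F []      = ⊤
  Uniq F (v ∷ x) = v ∉ F × Uniq (v ∷ F) x

  Uniqs : ∀ {j b} → List A → Vec (Vec A j) b → Set
  Uniqs F []       = ⊤
  Uniqs F (t ∷ ts) = Uniq F t × Uniqs (toList t ++ F) ts

  ¬× : ∀ {P Q : Set} → ¬ (P × Q) → ¬ P ⊎ ¬ Q
  ¬× {P} h with em {P}
  ... | yes p = inj₂ λ q → h (p , q)
  ... | no ¬p = inj₁ ¬p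

  ¬¬-elim : ∀ {P : Set} → ¬ ¬ P → P
  ¬¬-elim {P} h with em {P}
  ... | yes p = p
  ... | no ¬p = ⊥-elim (h ¬p)

  ∑-∈-≤ : ∀ n (F : List (Fin n)) → ∑ (allFin n) (λ v → ι (v ∈ F)) ≤ length F
  ∑-∈-≤ n []      = ≤-reflexive (trans (∑-cong (allFin n) λ _ → ι-no λ ()) (∑-zero (allFin n)))
  ∑-∈-≤ n (x ∷ F) = begin
    ∑ (allFin n) (λ v → ι (v ∈ x ∷ F))
      ≤⟨ ∑-mono (allFin n) (λ v → ι-⊎ λ { (here e) → inj₁ e ; (there v∈F) → inj₂ v∈F }) ⟩
    ∑ (allFin n) (λ v → ι (v ≡ x) + ι (v ∈ F))
      ≡⟨ ∑-+ (allFin n) _ _ ⟩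
    ∑ (allFin n) (λ v → ι (v ≡ x)) + ∑ (allFin n) (λ v → ι (v ∈ F))
      ≤⟨ +-mono-≤ (≤-reflexive (∑-point-1 n x)) (∑-∈-≤ n F) ⟩
    suc (length F) ∎
    where open ≤-Reasoning

  -- Union bound: each of the N entries hits `F` or an earlier entry with probability at most
  -- (length F + N)/n.
  ∑-¬Uniq : ∀ n N (F : List (Fin n)) →
    n * ∑ (vecs (allFin n) N) (λ x → ι (¬ Uniq F x)) ≤ N * (length F + N) * n ^ N
  ∑-¬Uniq n zero    F = ≤-reflexive (trans (cong (λ z → n * (z + 0)) (ι-no λ ¬u → ¬u tt))
      (*-zeroʳ n))
  ∑-¬Uniq n (suc N) F = begin
    n * ∑ (vecs V (suc N)) (λ x → ι (¬ Uniq F x))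
      ≡⟨ cong (n *_) (∑-vecs V N _) ⟩
    n * ∑ V (λ v → ∑ (vecs V N) λ x → ι (¬ (v ∉ F × Uniq (v ∷ F) x)))
      ≤⟨ *-monoʳ-≤ n (∑-mono V λ v → ∑-mono (vecs V N) λ x → ι-⊎ (λ h → Sum.map₁ ¬¬-elim (¬× h))) ⟩
    n * ∑ V (λ v → ∑ (vecs V N) λ x → ι (v ∈ F) + ι (¬ Uniq (v ∷ F) x))
      ≡⟨ cong (n *_) (∑-cong V λ v → trans (∑-+ (vecs V N) _ _)
           (cong (_+ B v) (trans (∑-vecs-const V N _)
               (cong (λ z → z ^ N * ι (v ∈ F)) (length-allFin n))))) ⟩
    n * ∑ V (λ v → n ^ N * ι (v ∈ F) + B v)
      ≡⟨ trans (cong (n *_) (trans (∑-+ V _ _) (cong (_+ ∑ V B) (∑-*ˡ V (n ^ N) _))))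
        (e₁ n (n ^ N) _ _) ⟩
    n * n ^ N * ∑ V (λ v → ι (v ∈ F)) + n * ∑ V B
      ≤⟨ +-mono-≤ (*-monoʳ-≤ (n * n ^ N) (∑-∈-≤ n F)) (≤-reflexive (sym (∑-*ˡ V n B))) ⟩
    n * n ^ N * f + ∑ V (λ v → n * B v)
      ≤⟨ +-monoʳ-≤ (n * n ^ N * f) (∑-mono V λ v → ∑-¬Uniq n N (v ∷ F)) ⟩
    n * n ^ N * f + ∑ V (λ v → N * (suc f + N) * n ^ N)
      ≡⟨ cong (n * n ^ N * f +_) (∑-allFin-const n _) ⟩
    n * n ^ N * f + n * (N * (suc f + N) * n ^ N)
      ≤⟨ m≤m+n _ (n * n ^ N * suc N) ⟩
    n * n ^ N * f + n * (N * (suc f + N) * n ^ N) + n * n ^ N * suc N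
      ≡⟨ e₂ n (n ^ N) f N ⟩
    suc N * (f + suc N) * n ^ suc N ∎
    where
    open ≤-Reasoning
    V = allFin n
    f = length F
    B = λ v → ∑ (vecs V N) λ x → ι (¬ Uniq (v ∷ F) x)
    e₁ : ∀ n m x y → n * (m * x + y) ≡ n * m * x + n * y
    e₁ = solve-∀
    e₂ : ∀ n m f N → n * m * f + n * (N * (suc f + N) * m) + n * m * suc N ≡ suc N * (f + suc N) *
        (n * m)
    e₂ = solve-∀

  ∑-¬Uniqs : ∀ n j b (F : List (Fin n)) →
    n * ∑ (vecs (vecs (allFin n) j) b) (λ x → ι (¬ Uniqs F x)) ≤ b * (j * (length F + b * j)) *
        (n ^ j) ^ b
  ∑-¬Uniqs n j zero    F = ≤-reflexive (trans (cong (λ z → n * (z + 0)) (ι-no λ ¬u → ¬u tt))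
      (*-zeroʳ n))
  ∑-¬Uniqs n j (suc b) F = begin
    n * ∑ (vecs V (suc b)) (λ x → ι (¬ Uniqs F x))
      ≡⟨ cong (n *_) (∑-vecs V b _) ⟩
    n * ∑ V (λ v → ∑ (vecs V b) λ x → ι (¬ (Uniq F v × Uniqs (toList v ++ F) x)))
      ≤⟨ *-monoʳ-≤ n (∑-mono V λ v → ∑-mono (vecs V b) λ x → ι-⊎ ¬×) ⟩
    n * ∑ V (λ v → ∑ (vecs V b) λ x → ι (¬ Uniq F v) + ι (¬ Uniqs (toList v ++ F) x))
      ≡⟨ cong (n *_) (∑-cong V λ v → trans (∑-+ (vecs V b) _ _)
           (cong (_+ B v) (trans (∑-vecs-const V b _) (cong (λ z → z ^ b * ι (¬ Uniq F v)) lV)))) ⟩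
    n * ∑ V (λ v → m ^ b * ι (¬ Uniq F v) + B v)
      ≡⟨ trans (cong (n *_) (trans (∑-+ V _ _) (cong (_+ ∑ V B) (∑-*ˡ V (m ^ b) _))))
        (e₁ n (m ^ b) _ _) ⟩
    m ^ b * (n * ∑ V (λ v → ι (¬ Uniq F v))) + n * ∑ V B
      ≤⟨ +-mono-≤ (*-monoʳ-≤ (m ^ b) (∑-¬Uniq n j F)) (≤-reflexive (sym (∑-*ˡ V n B))) ⟩
    m ^ b * (j * (f + j) * m) + ∑ V (λ v → n * B v)
      ≤⟨ +-monoʳ-≤ (m ^ b * (j * (f + j) * m))
        (∑-mono V λ v → ≤-trans (∑-¬Uniqs n j b (toList v ++ F))
           (≤-reflexive (cong (λ z → b * (j * (z + b * j)) * m ^ b)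
               (trans (length-++ (toList v)) (cong (_+ f) (length-toList v)))))) ⟩
    m ^ b * (j * (f + j) * m) + ∑ V (λ v → b * (j * (j + f + b * j)) * m ^ b)
      ≡⟨ cong (m ^ b * (j * (f + j) * m) +_) (trans (∑-const V _)
        (cong (_* (b * (j * (j + f + b * j)) * m ^ b)) lV)) ⟩
    m ^ b * (j * (f + j) * m) + m * (b * (j * (j + f + b * j)) * m ^ b)
      ≤⟨ m≤m+n _ (m ^ b * m * j * (b * j)) ⟩
    m ^ b * (j * (f + j) * m) + m * (b * (j * (j + f + b * j)) * m ^ b) + m ^ b * m * j * (b * j)
      ≡⟨ e₂ m (m ^ b) f b j ⟩
    suc b * (j * (f + suc b * j)) * m ^ suc b ∎
    where
    open ≤-Reasoning
    V = vecs (allFin n) j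
    m = n ^ j
    lV : length V ≡ m
    lV = trans (length-vecs (allFin n) j) (cong (_^ j) (length-allFin n))
    f = length F
    B = λ v → ∑ (vecs V b) λ x → ι (¬ Uniqs (toList v ++ F) x)
    e₁ : ∀ n m x y → n * (m * x + y) ≡ m * (n * x) + n * y
    e₁ = solve-∀
    e₂ : ∀ m x f b j → x * (j * (f + j) * m) + m * (b * (j * (j + f + b * j)) * x) + x * m * j *
        (b * j)
         ≡ suc b * (j * (f + suc b * j)) * (m * x)
    e₂ = solve-∀

  upd : ∀ {s j} → Vec A s → Vec (Fin s) j → Vec A j → Vec A s
  upd x []      []       = x
  upd x (p ∷ τ) (u ∷ us) = upd x τ us [ p ]≔ u

  upds : ∀ {s j b} → Vec A s → Vec (Vec (Fin s) j) b → Vec (Vec A j) b → Vec A s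
  upds x []       []       = x
  upds x (τ ∷ τs) (u ∷ us) = upd (upds x τs us) τ u

  ∑-[]≔ : ∀ (xs : List A) {s} (p : Fin s) f →
    length xs * ∑ (vecs xs s) f ≡ ∑ (vecs xs s) λ x → ∑ xs λ u → f (x [ p ]≔ u)
  ∑-[]≔ xs {suc s} zero f = begin
    length xs * ∑ (vecs xs (suc s)) f
      ≡⟨ ∑-const xs _ ⟨
    ∑ xs (λ _ → ∑ (vecs xs (suc s)) f)
      ≡⟨ ∑-cong xs (λ _ → trans (∑-vecs xs s f) (∑-swap xs (vecs xs s) _)) ⟩
    ∑ xs (λ _ → ∑ (vecs xs s) λ x → ∑ xs λ u → f (u ∷ x))
      ≡⟨ ∑-vecs xs s _ ⟨
    ∑ (vecs xs (suc s)) (λ x → ∑ xs λ u → f (x [ zero ]≔ u)) ∎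
    where open ≡-Reasoning
  ∑-[]≔ xs {suc s} (suc p) f = begin
    length xs * ∑ (vecs xs (suc s)) f
      ≡⟨ cong (length xs *_) (∑-vecs xs s f) ⟩
    length xs * ∑ xs (λ x₀ → ∑ (vecs xs s) λ x → f (x₀ ∷ x))
      ≡⟨ ∑-*ˡ xs (length xs) _ ⟨
    ∑ xs (λ x₀ → length xs * ∑ (vecs xs s) λ x → f (x₀ ∷ x))
      ≡⟨ ∑-cong xs (λ x₀ → ∑-[]≔ xs p (λ x → f (x₀ ∷ x))) ⟩
    ∑ xs (λ x₀ → ∑ (vecs xs s) λ x → ∑ xs λ u → f (x₀ ∷ (x [ p ]≔ u)))
      ≡⟨ ∑-vecs xs s _ ⟨
    ∑ (vecs xs (suc s)) (λ x → ∑ xs λ u → f (x [ suc p ]≔ u)) ∎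
    where open ≡-Reasoning

  ∑-upd : ∀ (xs : List A) {s j} (τ : Vec (Fin s) j) f →
    length xs ^ j * ∑ (vecs xs s) f ≡ ∑ (vecs xs s) λ x → ∑ (vecs xs j) λ u → f (upd x τ u)
  ∑-upd xs {s} [] f = trans (*-identityˡ _) (∑-cong (vecs xs s) λ x → sym (+-identityʳ _))
  ∑-upd xs {s} {suc j} (p ∷ τ) f = begin
    length xs * length xs ^ j * ∑ (vecs xs s) f
      ≡⟨ trans (cong (_* ∑ (vecs xs s) f) (*-comm (length xs) _)) (*-assoc (length xs ^ j) _ _) ⟩
    length xs ^ j * (length xs * ∑ (vecs xs s) f)
      ≡⟨ cong (length xs ^ j *_) (∑-[]≔ xs p f) ⟩
    length xs ^ j * ∑ (vecs xs s) (λ x → ∑ xs λ u → f (x [ p ]≔ u))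
      ≡⟨ ∑-upd xs τ _ ⟩
    ∑ (vecs xs s) (λ x → ∑ (vecs xs j) λ us → ∑ xs λ u → f (upd x τ us [ p ]≔ u))
      ≡⟨ ∑-cong (vecs xs s) (λ x → trans (∑-swap (vecs xs j) xs _) (sym (∑-vecs xs j _))) ⟩
    ∑ (vecs xs s) (λ x → ∑ (vecs xs (suc j)) λ u → f (upd x (p ∷ τ) u)) ∎
    where open ≡-Reasoning

  -- Overwriting coordinates of a uniform tuple by fresh uniform values leaves it uniform. Repeated
  -- positions in `τs` do no harm, since the last write wins.
  ∑-upds : ∀ (xs : List A) {s j b} (τs : Vec (Vec (Fin s) j) b) f →
    (length xs ^ j) ^ b * ∑ (vecs xs s) f ≡ ∑ (vecs xs s) λ x → ∑ (vecs (vecs xs j) b) λ us → f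
        (upds x τs us)
  ∑-upds xs {s} [] f = trans (*-identityˡ _) (∑-cong (vecs xs s) λ x → sym (+-identityʳ _))
  ∑-upds xs {s} {j} {suc b} (τ ∷ τs) f = begin
    m * m ^ b * ∑ (vecs xs s) f
      ≡⟨ trans (cong (_* ∑ (vecs xs s) f) (*-comm m _)) (*-assoc (m ^ b) _ _) ⟩
    m ^ b * (m * ∑ (vecs xs s) f)
      ≡⟨ cong (m ^ b *_) (∑-upd xs τ f) ⟩
    m ^ b * ∑ (vecs xs s) (λ x → ∑ (vecs xs j) λ u → f (upd x τ u))
      ≡⟨ ∑-upds xs τs _ ⟩
    ∑ (vecs xs s) (λ x → ∑ (vecs (vecs xs j) b) λ us → ∑ (vecs xs j) λ u → f
        (upd (upds x τs us) τ u))
      ≡⟨ ∑-cong (vecs xs s) (λ x → trans (∑-swap (vecs (vecs xs j) b) (vecs xs j) _)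
        (sym (∑-vecs (vecs xs j) b _))) ⟩
    ∑ (vecs xs s) (λ x → ∑ (vecs (vecs xs j) (suc b)) λ u → f (upds x (τ ∷ τs) u)) ∎
    where
    open ≡-Reasoning
    m = length xs ^ j

  select : ∀ {s j} → Vec A s → Vec (Fin s) j → Vec A j
  select x = Vec.map (lookup x)

  module _ {s} (x y : Vec A s) where
    select-agree : ∀ {j G} (τ : Vec (Fin s) j) → (∀ {q} → q ∉ G → lookup x q ≡ lookup y q) →
      Uniq G τ → select x τ ≡ select y τ
    select-agree []      agree u         = refl
    select-agree (p ∷ τ) agree (p∉G , u) =
      cong₂ _∷_ (agree p∉G) (select-agree τ (λ q∉ → agree (q∉ ∘ there)) u)

    selects-agree : ∀ {j b G} (τs : Vec (Vec (Fin s) j) b) →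
        (∀ {q} → q ∉ G → lookup x q ≡ lookup y q) →
      Uniqs G τs → Vec.map (select x) τs ≡ Vec.map (select y) τs
    selects-agree []       agree u        = refl
    selects-agree (τ ∷ τs) agree (u , us) =
      cong₂ _∷_ (select-agree τ agree u) (selects-agree τs (λ q∉ → agree (q∉ ∘ ∈-++⁺ʳ (toList τ)))
          us)

  lookup-upd-∉ : ∀ {s j} (x : Vec A s) (τ : Vec (Fin s) j) u {q} → q ∉ toList τ → lookup
      (upd x τ u) q ≡ lookup x q
  lookup-upd-∉ x []      []       q∉ = refl
  lookup-upd-∉ x (p ∷ τ) (u ∷ us) q∉ =
    trans (lookup∘update′ (λ q≡p → q∉ (here q≡p)) (upd x τ us) u) (lookup-upd-∉ x τ us (q∉ ∘ there))

  ∈⇒∉toList : ∀ {j} {F : List A} (τ : Vec A j) → Uniq F τ → ∀ {q} → q ∈ F → q ∉ toList τ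
  ∈⇒∉toList (p ∷ τ) (p∉F , u) q∈F (here refl) = p∉F q∈F
  ∈⇒∉toList (p ∷ τ) (p∉F , u) q∈F (there q∈τ) = ∈⇒∉toList τ u (there q∈F) q∈τ

  lookup-upds-∈ : ∀ {s j b} {F : List (Fin s)} (x : Vec A s) (τs : Vec (Vec (Fin s) j) b) us {q} →
    Uniqs F τs → q ∈ F → lookup (upds x τs us) q ≡ lookup x q
  lookup-upds-∈ x []       []       u        q∈F = refl
  lookup-upds-∈ x (τ ∷ τs) (v ∷ us) (u , u′) q∈F =
    trans (lookup-upd-∉ (upds x τs us) τ v (∈⇒∉toList τ u q∈F))
        (lookup-upds-∈ x τs us u′ (∈-++⁺ʳ (toList τ) q∈F))

  select-upd : ∀ {s j} {F : List (Fin s)} (x : Vec A s) (τ : Vec (Fin s) j) u → Uniq F τ → select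
      (upd x τ u) τ ≡ u
  select-upd x []      []       _         = refl
  select-upd x (p ∷ τ) (u ∷ us) (p∉F , un) = cong₂ _∷_ (lookup∘update p (upd x τ us) u)
    (trans (select-agree (upd x τ us [ p ]≔ u) (upd x τ us) τ
        (λ q∉ → lookup∘update′ (λ q≡p → q∉ (here q≡p)) (upd x τ us) u) un)
           (select-upd x τ us un))

  -- Here repetitions do matter: at distinct positions nothing written is overwritten, so the blocks
  -- read off are the fresh ones.
  select-upds : ∀ {s j b} {F : List (Fin s)} (x : Vec A s) (τs : Vec (Vec (Fin s) j) b) us →
    Uniqs F τs → Vec.map (select (upds x τs us)) τs ≡ us
  select-upds x []       []       _        = refl
  select-upds x (τ ∷ τs) (u ∷ us) (un , uns) = cong₂ _∷_ (select-upd (upds x τs us) τ u un)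
    (trans (selects-agree (upd (upds x τs us) τ u) (upds x τs us) τs
        (λ q∉ → lookup-upd-∉ (upds x τs us) τ u (q∉ ∘ ∈-++⁺ˡ)) uns)
           (select-upds x τs us uns))

  hits-mono : ∀ {P Q : A → Set} {b} (us : Vec A b) → (∀ {u} → P u → Q u) → hits P us ≤ hits Q us
  hits-mono []       f = z≤n
  hits-mono (u ∷ us) f = +-mono-≤ (ι-mono f) (hits-mono us f)

  hits-map : ∀ {A B : Set} {b} (P : B → Set) (g : A → B) (us : Vec A b) → hits P (Vec.map g us) ≡
      hits (P ∘ g) us
  hits-map P g []       = refl
  hits-map P g (u ∷ us) = cong (ι (P (g u)) +_) (hits-map P g us)

  -- An atypical tuple x sees few hits in most of its own small random samples τ,
  -- while for an injective τ avoiding the fixed positions F the sample of a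
  -- random x is a sequence of independent uniform blocks.
  sampling : ∀ n s j a w b → 0 < n → 0 < s → 0 < w → 0 < b →
    let c = 2 + a ; h = suc (c * (2 + c)) in
    (F : List (Fin s)) (G : Vec (Fin n) s → Set) (P : Vec (Fin n) s → Vec (Fin n) j → Set) →
    (∀ {x y} → (∀ {q} → q ∈ F → lookup x q ≡ lookup y q) → G x → G y) →
    (∀ {x y u} → (∀ {q} → q ∈ F → lookup x q ≡ lookup y q) → P x u → P y u) →
    (∀ {x} → G x → (2 + c) * n ^ j ≤ w * ∑ (vecs (allFin n) j) (λ u → ι (P x u))) →
    c * (w * b * (j * (length F + w * b * j))) ≤ s →
    suc h ^ b * ∑ (vecs (allFin n) s) (λ x → ι
        (G x × w * ∑ (vecs (allFin s) j) (λ z → ι (P x (select x z))) ≤ a * s ^ j))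
      ≤ c * h ^ b * ∑ (vecs (allFin n) s) (ι ∘ G)
  sampling n s j a w b 0<n 0<s 0<w 0<b F G P G-local P-local dense few = *-cancelˡ-≤ (L ^ B)
      {{>-nonZero 0<LB}} (begin
    L ^ B * (suc h ^ b * ∑ X (ι ∘ Bad))
      ≡⟨ e₁ (L ^ B) (suc h ^ b) _ ⟩
    suc h ^ b * (∑ X (ι ∘ Bad) * L ^ B)
      ≡⟨ cong (suc h ^ b *_) (∑-*ʳ X (L ^ B) _) ⟨
    suc h ^ b * ∑ X (λ x → ι (Bad x) * L ^ B)
      ≤⟨ *-monoʳ-≤ (suc h ^ b) (∑-mono X bad-sampled) ⟩
    suc h ^ b * ∑ X (λ x → c * ∑ T (λ τ → ι (Sampled x τ)))
      ≡⟨ cong (suc h ^ b *_) (trans (∑-*ˡ X c _) (cong (c *_) (∑-swap X T _))) ⟩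
    suc h ^ b * (c * ∑ T (λ τ → ∑ X (λ x → ι (Sampled x τ))))
      ≡⟨ e₂ (suc h ^ b) c _ ⟩
    c * (suc h ^ b * ∑ T (λ τ → ∑ X (λ x → ι (Sampled x τ))))
      ≡⟨ cong (c *_) (∑-*ˡ T (suc h ^ b) _) ⟨
    c * ∑ T (λ τ → suc h ^ b * ∑ X (λ x → ι (Sampled x τ)))
      ≤⟨ *-monoʳ-≤ c (∑-mono T sampled-few) ⟩
    c * ∑ T (λ τ → h ^ b * ∑ X (ι ∘ G))
      ≡⟨ cong (c *_) (trans (∑-vecs-const Z B _) (cong (λ z → z ^ B * (h ^ b * ∑ X (ι ∘ G))) lZ)) ⟩
    c * (L ^ B * (h ^ b * ∑ X (ι ∘ G)))
      ≡⟨ e₃ c (L ^ B) (h ^ b) _ ⟩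
    L ^ B * (c * h ^ b * ∑ X (ι ∘ G)) ∎)
    where
    open ≤-Reasoning
    c = 2 + a
    h = suc (c * (2 + c))
    B = w * b
    L = s ^ j
    Z = vecs (allFin s) j
    T = vecs Z B
    X = vecs (allFin n) s
    U = vecs (vecs (allFin n) j) B
    lZ : length Z ≡ L
    lZ = trans (length-vecs (allFin s) j) (cong (_^ j) (length-allFin s))
    lV : length (vecs (allFin n) j) ≡ n ^ j
    lV = trans (length-vecs (allFin n) j) (cong (_^ j) (length-allFin n))
    0<L : 0 < L
    0<L = m^n>0 s {{>-nonZero 0<s}} j
    0<LB : 0 < L ^ B
    0<LB = m^n>0 L {{>-nonZero 0<L}} B
    Bad : Vec (Fin n) s → Set
    Bad x = G x × w * ∑ Z (λ z → ι (P x (select x z))) ≤ a * s ^ j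
    Sampled : Vec (Fin n) s → Vec (Vec (Fin s) j) B → Set
    Sampled x τ = Uniqs F τ × G x × hits (P x ∘ select x) τ ≤ c * b
    e₁ : ∀ l m x → l * (m * x) ≡ m * (x * l)
    e₁ = solve-∀
    e₂ : ∀ l m x → l * (m * x) ≡ m * (l * x)
    e₂ = solve-∀
    e₃ : ∀ c l h x → c * (l * (h * x)) ≡ l * (c * h * x)
    e₃ = solve-∀
    nonUniq : c * ∑ T (λ τ → ι (¬ Uniqs F τ)) ≤ L ^ B
    nonUniq = *-cancelˡ-≤ s {{>-nonZero 0<s}} (begin
      s * (c * ∑ T (λ τ → ι (¬ Uniqs F τ)))
        ≡⟨ e₂ s c _ ⟩
      c * (s * ∑ T (λ τ → ι (¬ Uniqs F τ)))
        ≤⟨ *-monoʳ-≤ c (∑-¬Uniqs s j B F) ⟩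
      c * (B * (j * (length F + B * j)) * L ^ B)
        ≡⟨ *-assoc c (B * (j * (length F + B * j))) (L ^ B) ⟨
      c * (B * (j * (length F + B * j))) * L ^ B
        ≤⟨ *-monoˡ-≤ (L ^ B) few ⟩
      s * L ^ B ∎)
    bad-sampled : ∀ x → ι (Bad x) * L ^ B ≤ c * ∑ T (λ τ → ι (Sampled x τ))
    bad-sampled x with em {Bad x}
    ... | no ¬bad = ≤-trans (≤-reflexive (cong (_* L ^ B) (ι-no ¬bad))) z≤n
    ... | yes bad@(g , sparse) = +-cancelʳ-≤ (L ^ B) _ _ (begin
      ι (Bad x) * L ^ B + L ^ B
        ≡⟨ cong (λ z → z * L ^ B + L ^ B) (ι-yes bad) ⟩
      1 * L ^ B + L ^ B
        ≡⟨ e (L ^ B) ⟩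
      2 * L ^ B
        ≡⟨ cong (λ z → 2 * z ^ B) lZ ⟨
      2 * length Z ^ B
        ≤⟨ markov Z (P x ∘ select x) a w B (subst (0 <_) (sym lZ) 0<L) (*-mono-< 0<w 0<b)
             (subst (λ l → w * ∑ Z (λ z → ι (P x (select x z))) ≤ a * l) (sym lZ) sparse) ⟩
      c * ∑ T (λ τ → ι (w * hits (P x ∘ select x) τ ≤ c * B))
        ≤⟨ *-monoʳ-≤ c (∑-mono T λ τ → ι-⊎ (λ small → split small)) ⟩
      c * ∑ T (λ τ → ι (Sampled x τ) + ι (¬ Uniqs F τ))
        ≡⟨ trans (cong (c *_) (∑-+ T (ι ∘ Sampled x) _)) (*-distribˡ-+ c (∑ T (ι ∘ Sampled x)) _) ⟩
      c * ∑ T (λ τ → ι (Sampled x τ)) + c * ∑ T (λ τ → ι (¬ Uniqs F τ))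
        ≤⟨ +-monoʳ-≤ _ nonUniq ⟩
      c * ∑ T (λ τ → ι (Sampled x τ)) + L ^ B ∎)
      where
      e : ∀ x → 1 * x + x ≡ 2 * x
      e = solve-∀
      e′ : ∀ c w b → c * (w * b) ≡ w * (c * b)
      e′ = solve-∀
      split : ∀ {τ} → w * hits (P x ∘ select x) τ ≤ c * B → Sampled x τ ⊎ ¬ Uniqs F τ
      split {τ} small with em {Uniqs F τ}
      ... | yes u = inj₁ (u , g , *-cancelˡ-≤ w {{>-nonZero 0<w}}
          (subst (w * hits (P x ∘ select x) τ ≤_) (e′ c w b) small))
      ... | no ¬u = inj₂ ¬u
    sampled-few : ∀ τ → suc h ^ b * ∑ X (λ x → ι (Sampled x τ)) ≤ h ^ b * ∑ X (ι ∘ G)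
    sampled-few τ with em {Uniqs F τ}
    ... | no ¬u = ≤-trans (≤-reflexive (trans
        (cong (suc h ^ b *_) (trans (∑-cong X λ x → ι-no (¬u ∘ proj₁)) (∑-zero X)))
        (*-zeroʳ (suc h ^ b)))) z≤n
    ... | yes u = *-cancelˡ-≤ ((n ^ j) ^ B) {{>-nonZero
        (m^n>0 (n ^ j) {{>-nonZero (m^n>0 n {{>-nonZero 0<n}} j)}} B)}} (begin
      (n ^ j) ^ B * (suc h ^ b * ∑ X (λ x → ι (Sampled x τ)))
        ≡⟨ e₂ ((n ^ j) ^ B) (suc h ^ b) (∑ X (λ x → ι (Sampled x τ))) ⟩
      suc h ^ b * ((n ^ j) ^ B * ∑ X (λ x → ι (Sampled x τ)))
        ≡⟨ cong (λ z → suc h ^ b * ((z ^ j) ^ B * ∑ X (λ x → ι (Sampled x τ)))) (length-allFin n) ⟨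
      suc h ^ b * ((length (allFin n) ^ j) ^ B * ∑ X (λ x → ι (Sampled x τ)))
        ≡⟨ cong (suc h ^ b *_) (∑-upds (allFin n) τ _) ⟩
      suc h ^ b * ∑ X (λ x → ∑ U λ us → ι (Sampled (upds x τ us) τ))
        ≤⟨ *-monoʳ-≤ (suc h ^ b) (∑-mono X λ x → ∑-mono U λ us → ι-mono (resampled x us)) ⟩
      suc h ^ b * ∑ X (λ x → ∑ U λ us → ι (G x × hits (P x) us ≤ c * b))
        ≡⟨ cong (suc h ^ b *_) (∑-cong X λ x → ∑-ι-× U _) ⟩
      suc h ^ b * ∑ X (λ x → ι (G x) * ∑ U (λ us → ι (hits (P x) us ≤ c * b)))
        ≡⟨ ∑-*ˡ X (suc h ^ b) _ ⟨
      ∑ X (λ x → suc h ^ b * (ι (G x) * ∑ U (λ us → ι (hits (P x) us ≤ c * b))))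
        ≤⟨ ∑-mono X (λ x → ≤-trans (≤-reflexive (e₄ (suc h ^ b) (ι (G x)) _))
          (ι-* λ g → tail x g)) ⟩
      ∑ X (λ x → ι (G x) * ((n ^ j) ^ B * h ^ b))
        ≡⟨ ∑-*ʳ X ((n ^ j) ^ B * h ^ b) _ ⟩
      ∑ X (ι ∘ G) * ((n ^ j) ^ B * h ^ b)
        ≡⟨ e₅ (∑ X (ι ∘ G)) ((n ^ j) ^ B) (h ^ b) ⟩
      (n ^ j) ^ B * (h ^ b * ∑ X (ι ∘ G)) ∎)
      where
      e₄ : ∀ l m x → l * (m * x) ≡ m * (x * l)
      e₄ = solve-∀
      e₅ : ∀ g n h → g * (n * h) ≡ n * (h * g)
      e₅ = solve-∀
      -- After resampling, the blocks read off at τ are exactly `us`, whereas `G x` and `P x` look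
      -- only at the positions of `F` and do not change. So the blocks are independent of the
      -- condition they are tested against.
      resampled : ∀ x us → Sampled (upds x τ us) τ → G x × hits (P x) us ≤ c * b
      resampled x us (_ , g , small) = G-local (lookup-upds-∈ x τ us u) g , (begin
        hits (P x) us
          ≤⟨ hits-mono us (P-local (λ q∈ → sym (lookup-upds-∈ x τ us u q∈))) ⟩
        hits (P x′) us
          ≡⟨ cong (hits (P x′)) (select-upds x τ us u) ⟨
        hits (P x′) (Vec.map (select x′) τ)
          ≡⟨ hits-map (P x′) (select x′) τ ⟩
        hits (P x′ ∘ select x′) τ
          ≤⟨ small ⟩
        c * b ∎)
        where x′ = upds x τ us
      tail : ∀ x → G x → ∑ U (λ us → ι (hits (P x) us ≤ c * b)) * suc h ^ b ≤ (n ^ j) ^ B * h ^ b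
      tail x g = subst (λ l → ∑ U (λ us → ι (hits (P x) us ≤ c * b)) * suc h ^ b ≤ l ^ B * h ^ b) lV
        (chernoff (vecs (allFin n) j) (P x) c w b z<s 0<w
            (subst (λ l → (2 + c) * l ≤ w * ∑ (vecs (allFin n) j) (λ u → ι (P x u))) (sym lV)
            (dense g)))

  -- Degrees as numbers of tuples

  length-filter-∑ : ∀ {P : A → Set} (P? : Decidable P) xs → length (filter P? xs) ≡ ∑ xs (ι ∘ P)
  length-filter-∑ P? []       = refl
  length-filter-∑ P? (x ∷ xs) with P? x
  ... | yes p = cong₂ _+_ (sym (ι-yes p)) (length-filter-∑ P? xs)
  ... | no ¬p = cong₂ _+_ (sym (ι-no ¬p)) (length-filter-∑ P? xs)

  ∈-subsets : ∀ {n} (S : Subset n) → S ∈ subsets n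
  ∈-subsets []            = here refl
  ∈-subsets (outside ∷ S) = ∈-++⁺ˡ (∈-map⁺ _ (∈-subsets S))
  ∈-subsets (inside ∷ S)  = ∈-++⁺ʳ (map (outside ∷_) (subsets _)) (∈-map⁺ _ (∈-subsets S))

  ∑-subsets-point : ∀ {n} (S : Subset n) → ∑ (subsets n) (λ e → ι (e ≡ S)) ≡ 1
  ∑-subsets-point []      = trans (+-identityʳ _) (ι-yes refl)
  ∑-subsets-point {suc n} (b ∷ S) = begin
    ∑ (subsets (suc n)) (λ e → ι (e ≡ b ∷ S))
      ≡⟨ ∑-++ (map (outside ∷_) (subsets n)) _ _ ⟩
    ∑ (map (outside ∷_) (subsets n)) (λ e → ι (e ≡ b ∷ S)) + ∑ (map (inside ∷_) (subsets n))
        (λ e → ι (e ≡ b ∷ S))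
      ≡⟨ cong₂ _+_ (∑-map _ (subsets n) _) (∑-map _ (subsets n) _) ⟩
    ∑ (subsets n) (λ e → ι (outside ∷ e ≡ b ∷ S)) + ∑ (subsets n) (λ e → ι (inside ∷ e ≡ b ∷ S))
      ≡⟨ half b ⟩
    1 ∎
    where
    open ≡-Reasoning
    same : ∀ b → ∑ (subsets n) (λ e → ι (b ∷ e ≡ b ∷ S)) ≡ 1
    same b = trans (∑-cong (subsets n) λ e → ι-⇔ (λ { refl → refl }) (λ { refl → refl }))
        (∑-subsets-point S)
    none : ∀ {P : Subset n → Set} → (∀ e → ¬ P e) → ∑ (subsets n) (ι ∘ P) ≡ 0
    none h = trans (∑-cong (subsets n) λ e → ι-no (h e)) (∑-zero (subsets n))
    half : ∀ b → ∑ (subsets n) (λ e → ι (outside ∷ e ≡ b ∷ S)) + ∑ (subsets n)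
        (λ e → ι (inside ∷ e ≡ b ∷ S)) ≡ 1
    half outside = cong₂ _+_ (same outside) (none λ _ ())
    half inside  = cong₂ _+_ (none λ _ ()) (same inside)

  card-∑ : ∀ {n} (S : Subset n) → card S ≡ ∑ (allFin n) (λ v → ι (v ∈ˢ S))
  card-∑ []            = refl
  card-∑ {suc n} (outside ∷ S) = trans (card-∑ S) (sym (trans (∑-allFin-suc n _)
    (cong₂ _+_ (ι-no λ ()) (∑-cong (allFin n) λ v → ι-⇔ drop-there there))))
  card-∑ {suc n} (inside ∷ S)  = trans (cong suc (card-∑ S)) (sym (trans (∑-allFin-suc n _)
    (cong₂ _+_ (ι-yes here) (∑-cong (allFin n) λ v → ι-⇔ drop-there there))))

  ⊆∧card⇒≡ : ∀ {n} {S e : Subset n} → S ⊆ e → card S ≡ card e → e ≡ S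
  ⊆∧card⇒≡ {n} {S} {e} S⊆e eq with em {∃ λ v → v ∈ˢ e × v ∉ˢ S}
  ... | no ¬v = ⊆-antisym (λ {v} v∈e → ¬¬-elim λ v∉S → ¬v (v , v∈e , v∉S)) S⊆e
  ... | yes (v , v∈e , v∉S) = ⊥-elim (<-irrefl refl (begin-strict
    card e ≡⟨ eq ⟨
    card S ≡⟨ card-∑ S ⟩
    ∑ (allFin n) (λ w → ι (w ∈ˢ S)) <⟨ n<1+n _ ⟩
    suc (∑ (allFin n) (λ w → ι (w ∈ˢ S))) ≡⟨ cong (_+ ∑ (allFin n) (λ w → ι (w ∈ˢ S)))
        (∑-point-1 n v) ⟨
    ∑ (allFin n) (λ w → ι (w ≡ v)) + ∑ (allFin n) (λ w → ι (w ∈ˢ S)) ≡⟨ ∑-+ (allFin n) _ _ ⟨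
    ∑ (allFin n) (λ w → ι (w ≡ v) + ι (w ∈ˢ S)) ≤⟨ ∑-mono (allFin n) pointwise ⟩
    ∑ (allFin n) (λ w → ι (w ∈ˢ e)) ≡⟨ card-∑ e ⟨
    card e ∎))
    where
    open ≤-Reasoning
    pointwise : ∀ w → ι (w ≡ v) + ι (w ∈ˢ S) ≤ ι (w ∈ˢ e)
    pointwise w with em {w ≡ v}
    ... | yes refl = ≤-reflexive (trans (cong₂ _+_ (ι-yes refl) (ι-no v∉S)) (sym (ι-yes v∈e)))
    ... | no w≢v   = subst (λ z → z + ι (w ∈ˢ S) ≤ ι (w ∈ˢ e)) (sym (ι-no w≢v)) (ι-mono S⊆e)

  card-insert : ∀ {n} (S : Subset n) {v} → v ∉ˢ S → card (S ∪ ⁅ v ⁆) ≡ suc (card S)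
  card-insert {n} S {v} v∉S = begin
    card (S ∪ ⁅ v ⁆)
      ≡⟨ card-∑ (S ∪ ⁅ v ⁆) ⟩
    ∑ (allFin n) (λ w → ι (w ∈ˢ S ∪ ⁅ v ⁆))
      ≡⟨ ∑-cong (allFin n) pointwise ⟩
    ∑ (allFin n) (λ w → ι (w ≡ v) + ι (w ∈ˢ S))
      ≡⟨ ∑-+ (allFin n) _ _ ⟩
    ∑ (allFin n) (λ w → ι (w ≡ v)) + ∑ (allFin n) (λ w → ι (w ∈ˢ S))
      ≡⟨ cong₂ _+_ (∑-point-1 n v) (sym (card-∑ S)) ⟩
    suc (card S) ∎
    where
    open ≡-Reasoning
    pointwise : ∀ w → ι (w ∈ˢ S ∪ ⁅ v ⁆) ≡ ι (w ≡ v) + ι (w ∈ˢ S)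
    pointwise w with em {w ≡ v}
    ... | yes refl = trans (ι-yes (x∈p∪q⁺ (inj₂ (x∈⁅x⁆ v))))
        (sym (cong₂ _+_ (ι-yes refl) (ι-no v∉S)))
    ... | no w≢v   = trans (ι-⇔ to (x∈p∪q⁺ ∘ inj₁)) (cong (_+ ι (w ∈ˢ S)) (sym (ι-no w≢v)))
      where
      to : w ∈ˢ S ∪ ⁅ v ⁆ → w ∈ˢ S
      to h with x∈p∪q⁻ S ⁅ v ⁆ h
      ... | inj₁ w∈S = w∈S
      ... | inj₂ w∈v = ⊥-elim (w≢v (x∈⁅y⁆⇒x≡y v w∈v))

  insert-∈ : ∀ {n} {S : Subset n} {v} → v ∈ˢ S → S ∪ ⁅ v ⁆ ≡ S
  insert-∈ {S = S} {v} v∈S = ⊆-antisym to (p⊆p∪q _)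
    where
    to : S ∪ ⁅ v ⁆ ⊆ S
    to h with x∈p∪q⁻ S ⁅ v ⁆ h
    ... | inj₁ w∈S = w∈S
    ... | inj₂ w∈v with x∈⁅y⁆⇒x≡y v w∈v
    ...   | refl = v∈S

  card-insert-≤ : ∀ {n} (S : Subset n) v → card (S ∪ ⁅ v ⁆) ≤ suc (card S)
  card-insert-≤ S v with em {v ∈ˢ S}
  ... | yes v∈S = ≤-trans (≤-reflexive (cong card (insert-∈ v∈S))) (n≤1+n _)
  ... | no v∉S  = ≤-reflexive (card-insert S v∉S)

  infixl 6 _⊕_
  _⊕_ : ∀ {n j} → Subset n → Vec (Fin n) j → Subset n
  S ⊕ []      = S
  S ⊕ (v ∷ z) = (S ∪ ⁅ v ⁆) ⊕ z

  card-⊕-≤ : ∀ {n j} (S : Subset n) (z : Vec (Fin n) j) → card (S ⊕ z) ≤ card S + j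
  card-⊕-≤ S []              = ≤-reflexive (sym (+-identityʳ _))
  card-⊕-≤ {j = suc j} S (v ∷ z) = ≤-trans (card-⊕-≤ (S ∪ ⁅ v ⁆) z)
    (≤-trans (+-monoˡ-≤ j (card-insert-≤ S v)) (≤-reflexive (sym (+-suc (card S) j))))

  -- A k-set containing S arises from the j! orderings of its remaining elements. A tuple with a
  -- repetition or an entry in S yields a set of fewer than k elements, which `Q` rejects by
  -- uniformity.
  ∑-⊕ : ∀ {n k} (Q : Subset n → Set) → (∀ {e} → Q e → card e ≡ k) → ∀ j S → card S + j ≡ k →
    ∑ (vecs (allFin n) j) (λ z → ι (Q (S ⊕ z))) ≡ j ! * ∑ (subsets n) (λ e → ι (S ⊆ e × Q e))
  ∑-⊕ {n} {k} Q uniform zero S |S| = begin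
    ι (Q S) + 0
      ≡⟨ trans (+-identityʳ _) (sym (*-identityʳ _)) ⟩
    ι (Q S) * 1
      ≡⟨ cong (ι (Q S) *_) (∑-subsets-point S) ⟨
    ι (Q S) * ∑ (subsets n) (λ e → ι (e ≡ S))
      ≡⟨ ∑-ι-× (subsets n) _ ⟨
    ∑ (subsets n) (λ e → ι (Q S × e ≡ S))
      ≡⟨ ∑-cong (subsets n) (λ e → ι-⇔ (λ { (q , refl) → id , q }) from) ⟩
    ∑ (subsets n) (λ e → ι (S ⊆ e × Q e))
      ≡⟨ *-identityˡ _ ⟨
    1 * ∑ (subsets n) (λ e → ι (S ⊆ e × Q e)) ∎
    where
    open ≡-Reasoning
    from : ∀ {e} → S ⊆ e × Q e → Q S × e ≡ S
    from (S⊆e , q) with ⊆∧card⇒≡ S⊆e (trans (sym (+-identityʳ _)) (trans |S| (sym (uniform q))))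
    ... | refl = q , refl
  ∑-⊕ {n} {k} Q uniform (suc j) S |S| = begin
    ∑ (vecs (allFin n) (suc j)) (λ z → ι (Q (S ⊕ z)))
      ≡⟨ ∑-vecs (allFin n) j _ ⟩
    ∑ (allFin n) (λ v → ∑ (vecs (allFin n) j) λ z → ι (Q ((S ∪ ⁅ v ⁆) ⊕ z)))
      ≡⟨ ∑-cong (allFin n) inner ⟩
    ∑ (allFin n) (λ v → j ! * ∑ (subsets n) λ e → ι (S ⊆ e × Q e) * ι (v ∉ˢ S × v ∈ˢ e))
      ≡⟨ trans (∑-*ˡ (allFin n) (j !) _) (cong (j ! *_) (∑-swap (allFin n) (subsets n) _)) ⟩
    j ! * ∑ (subsets n) (λ e → ∑ (allFin n) λ v → ι (S ⊆ e × Q e) * ι (v ∉ˢ S × v ∈ˢ e))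
      ≡⟨ cong (j ! *_) (∑-cong (subsets n) outer) ⟩
    j ! * ∑ (subsets n) (λ e → suc j * ι (S ⊆ e × Q e))
      ≡⟨ cong (j ! *_) (∑-*ˡ (subsets n) (suc j) _) ⟩
    j ! * (suc j * ∑ (subsets n) (λ e → ι (S ⊆ e × Q e)))
      ≡⟨ e₁ (j !) (suc j) _ ⟩
    suc j * j ! * ∑ (subsets n) (λ e → ι (S ⊆ e × Q e)) ∎
    where
    open ≡-Reasoning
    e₁ : ∀ x y z → x * (y * z) ≡ y * x * z
    e₁ = solve-∀
    inner : ∀ v → ∑ (vecs (allFin n) j) (λ z → ι (Q ((S ∪ ⁅ v ⁆) ⊕ z)))
      ≡ j ! * ∑ (subsets n) λ e → ι (S ⊆ e × Q e) * ι (v ∉ˢ S × v ∈ˢ e)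
    inner v with em {v ∈ˢ S}
    -- Both sides vanish: the entry v is wasted, and the j others are too few to reach size k.
    ... | yes v∈S = trans
      (trans (∑-cong (vecs (allFin n) j) λ z → ι-no λ q → <-irrefl refl (small z q))
          (∑-zero (vecs (allFin n) j)))
      (sym (trans (cong (j ! *_) (trans (∑-cong (subsets n) λ e → trans
          (cong (ι (S ⊆ e × Q e) *_) (ι-no (λ h → proj₁ h v∈S))) (*-zeroʳ (ι (S ⊆ e × Q e))))
          (∑-zero (subsets n)))) (*-zeroʳ (j !))))
      where
      small : ∀ z → Q ((S ∪ ⁅ v ⁆) ⊕ z) → k < k
      small z q = ≤-trans (s≤s (≤-trans (≤-reflexive
          (trans (sym (uniform q)) (cong (λ z′ → card (z′ ⊕ z)) (insert-∈ v∈S)))) (card-⊕-≤ S z)))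
        (≤-reflexive (trans (sym (+-suc _ j)) |S|))
    ... | no v∉S = trans (∑-⊕ Q uniform j (S ∪ ⁅ v ⁆)
        (trans (cong (_+ j) (card-insert S v∉S)) (trans (sym (+-suc _ j)) |S|)))
      (cong (j ! *_) (∑-cong (subsets n) λ e → trans (ι-⇔ into from) ι-×))
      where
      into : ∀ {e} → (S ∪ ⁅ v ⁆) ⊆ e × Q e → (S ⊆ e × Q e) × (v ∉ˢ S × v ∈ˢ e)
      into (h , q) = ((λ w∈S → h (p⊆p∪q _ w∈S)) , q) , v∉S , h (x∈p∪q⁺ (inj₂ (x∈⁅x⁆ v)))
      from : ∀ {e} → (S ⊆ e × Q e) × (v ∉ˢ S × v ∈ˢ e) → (S ∪ ⁅ v ⁆) ⊆ e × Q e
      from {e} ((S⊆e , q) , _ , v∈e) = to , q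
        where
        to : (S ∪ ⁅ v ⁆) ⊆ e
        to h with x∈p∪q⁻ S ⁅ v ⁆ h
        ... | inj₁ w∈S = S⊆e w∈S
        ... | inj₂ w∈v with x∈⁅y⁆⇒x≡y v w∈v
        ...   | refl = v∈e
    outer : ∀ e → ∑ (allFin n) (λ v → ι (S ⊆ e × Q e) * ι (v ∉ˢ S × v ∈ˢ e)) ≡ suc j * ι
        (S ⊆ e × Q e)
    outer e with em {S ⊆ e × Q e}
    ... | no ¬h = trans (trans (∑-*ˡ (allFin n) (ι (S ⊆ e × Q e)) _) (cong (_* M) (ι-no ¬h)))
                        (sym (trans (cong (suc j *_) (ι-no ¬h)) (*-zeroʳ j)))
      where M = ∑ (allFin n) (λ v → ι (v ∉ˢ S × v ∈ˢ e))
    ... | yes h@(S⊆e , q) = trans (∑-*ˡ (allFin n) (ι (S ⊆ e × Q e)) _)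
            (trans (*-comm (ι (S ⊆ e × Q e)) M) (cong (_* ι (S ⊆ e × Q e)) M≡))
      where
      M = ∑ (allFin n) (λ v → ι (v ∉ˢ S × v ∈ˢ e))
      split : ∀ v → ι (v ∈ˢ e) ≡ ι (v ∈ˢ S) + ι (v ∉ˢ S × v ∈ˢ e)
      split v with em {v ∈ˢ S}
      ... | yes v∈S = trans (ι-yes (S⊆e v∈S)) (sym (cong₂ _+_ (ι-yes v∈S) (ι-no λ h → proj₁ h v∈S)))
      ... | no v∉S  = trans (ι-⇔ (v∉S ,_) proj₂) (cong (_+ ι (v ∉ˢ S × v ∈ˢ e)) (sym (ι-no v∉S)))
      M≡ : M ≡ suc j
      M≡ = +-cancelˡ-≡ (card S) _ _ (begin
        card S + M                         ≡⟨ cong (_+ M) (card-∑ S) ⟩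
        ∑ (allFin n) (λ v → ι (v ∈ˢ S)) + M ≡⟨ ∑-+ (allFin n) _ _ ⟨
        ∑ (allFin n) (λ v → ι (v ∈ˢ S) + ι (v ∉ˢ S × v ∈ˢ e)) ≡⟨ ∑-cong (allFin n) split ⟨
        ∑ (allFin n) (λ v → ι (v ∈ˢ e))    ≡⟨ card-∑ e ⟨
        card e                             ≡⟨ uniform q ⟩
        k                                  ≡⟨ |S| ⟨
        card S + suc j                     ∎)

  degree-∑ : ∀ {k n} (H : KGraph k n) S → degree H S ≡ ∑ (subsets n)
      (λ e → ι (S ⊆ e × KGraph.Edge H e))
  degree-∑ {n = n} H S = length-filter-∑ _ (subsets n)

  j!*degree : ∀ {k n} (H : KGraph k n) j S → card S + j ≡ k →
    ∑ (vecs (allFin n) j) (λ z → ι (KGraph.Edge H (S ⊕ z))) ≡ j ! * degree H S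
  j!*degree H j S |S| = trans (∑-⊕ (KGraph.Edge H) (KGraph.uniform H) j S |S|)
      (cong (j ! *_) (sym (degree-∑ H S)))

  minDegree≤degree : ∀ {k n} d (H : KGraph k n) S → card S ≡ d → minDegree d H ≤ degree H S
  minDegree≤degree {k} {n} d H S |S| =
    All.lookup (min≤xs ((n ∸ d) C (k ∸ d)) _)
        (∈-map⁺ (degree H) (∈-filter⁺ (λ S → card S ≟ d) (∈-subsets S) |S|))

  -- The minimum is either attained at a d-set or equal to the value with which `min` starts, so
  -- that default needs a premise of its own.
  minDegree-elim : ∀ {k n} d (H : KGraph k n) (P : ℕ → Set) → P ((n ∸ d) C (k ∸ d)) →
    (∀ S → card S ≡ d → P (degree H S)) → P (minDegree d H)
  minDegree-elim {k} {n} d H P base step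
    with argmin-sel id ((n ∸ d) C (k ∸ d)) (map (degree H) (filter (λ S → card S ≟ d) (subsets n)))
  ... | inj₁ eq = subst P (sym eq) base
  ... | inj₂ m∈ with ∈-map⁻ (degree H) m∈
  ...   | S , S∈ , eq = subst P (sym eq) (step S
      (proj₂ (∈-filter⁻ (λ S → card S ≟ d) {xs = subsets n} S∈)))

  -- Images under tuples and pulled-back hypergraphs

  img : ∀ {n s} → Vec (Fin n) s → Subset s → Subset n
  img []      []            = ⊥
  img (v ∷ x) (outside ∷ e) = img x e
  img (v ∷ x) (inside ∷ e)  = img x e ∪ ⁅ v ⁆

  ∈-img⁺ : ∀ {n s} (x : Vec (Fin n) s) {e i} → i ∈ˢ e → lookup x i ∈ˢ img x e
  ∈-img⁺ (v ∷ x) {inside ∷ e}  here      = x∈p∪q⁺ (inj₂ (x∈⁅x⁆ v))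
  ∈-img⁺ (v ∷ x) {inside ∷ e}  (there i) = x∈p∪q⁺ (inj₁ (∈-img⁺ x i))
  ∈-img⁺ (v ∷ x) {outside ∷ e} (there i) = ∈-img⁺ x i

  ∈-img⁻ : ∀ {n s} (x : Vec (Fin n) s) e {v} → v ∈ˢ img x e → ∃ λ i → i ∈ˢ e × lookup x i ≡ v
  ∈-img⁻ []      []            h = ⊥-elim (∉⊥ h)
  ∈-img⁻ (v ∷ x) (outside ∷ e) h = let i , i∈e , eq = ∈-img⁻ x e h in suc i , there i∈e , eq
  ∈-img⁻ (v ∷ x) (inside ∷ e)  h with x∈p∪q⁻ (img x e) ⁅ v ⁆ h
  ... | inj₂ w∈v = zero , here , sym (x∈⁅y⁆⇒x≡y v w∈v)
  ... | inj₁ h′  = let i , i∈e , eq = ∈-img⁻ x e h′ in suc i , there i∈e , eq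

  img-⊥ : ∀ {n s} (x : Vec (Fin n) s) → img x ⊥ ≡ ⊥
  img-⊥ []      = refl
  img-⊥ (v ∷ x) = img-⊥ x

  img-insert : ∀ {n s} (x : Vec (Fin n) s) S i → img x (S ∪ ⁅ i ⁆) ≡ img x S ∪ ⁅ lookup x i ⁆
  img-insert x S i = ⊆-antisym to from
    where
    to : img x (S ∪ ⁅ i ⁆) ⊆ img x S ∪ ⁅ lookup x i ⁆
    to h with ∈-img⁻ x (S ∪ ⁅ i ⁆) h
    ... | q , q∈ , refl with x∈p∪q⁻ S ⁅ i ⁆ q∈
    ...   | inj₁ q∈S = x∈p∪q⁺ (inj₁ (∈-img⁺ x q∈S))
    ...   | inj₂ q∈i with x∈⁅y⁆⇒x≡y i q∈i
    ...     | refl = x∈p∪q⁺ (inj₂ (x∈⁅x⁆ _))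
    from : img x S ∪ ⁅ lookup x i ⁆ ⊆ img x (S ∪ ⁅ i ⁆)
    from h with x∈p∪q⁻ (img x S) _ h
    from h | inj₁ v∈ with ∈-img⁻ x S v∈
    ... | q , q∈ , refl = ∈-img⁺ x (x∈p∪q⁺ (inj₁ q∈))
    from h | inj₂ v∈ with x∈⁅y⁆⇒x≡y (lookup x i) v∈
    ... | refl = ∈-img⁺ x (x∈p∪q⁺ (inj₂ (x∈⁅x⁆ i)))

  img-⊕ : ∀ {n s j} (x : Vec (Fin n) s) S (z : Vec (Fin s) j) → img x (S ⊕ z) ≡ img x S ⊕ select x z
  img-⊕ x S []      = refl
  img-⊕ x S (i ∷ z) = trans (img-⊕ x (S ∪ ⁅ i ⁆) z) (cong (_⊕ select x z) (img-insert x S i))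

  card-img-≤ : ∀ {n s} (x : Vec (Fin n) s) e → card (img x e) ≤ card e
  card-img-≤ {n} []  []            = ≤-reflexive (∣⊥∣≡0 n)
  card-img-≤ (v ∷ x) (outside ∷ e) = card-img-≤ x e
  card-img-≤ (v ∷ x) (inside ∷ e)  = ≤-trans (card-insert-≤ (img x e) v) (s≤s (card-img-≤ x e))

  Uniq⇒∉img : ∀ {n s} {F : List (Fin n)} (x : Vec (Fin n) s) e {v} → Uniq F x → v ∈ F → v ∉ˢ img x e
  Uniq⇒∉img []      []            u         v∈F h = ∉⊥ h
  Uniq⇒∉img (w ∷ x) (outside ∷ e) (w∉F , u) v∈F h = Uniq⇒∉img x e u (there v∈F) h
  Uniq⇒∉img (w ∷ x) (inside ∷ e)  (w∉F , u) v∈F h with x∈p∪q⁻ (img x e) ⁅ w ⁆ h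
  ... | inj₁ h′ = Uniq⇒∉img x e u (there v∈F) h′
  ... | inj₂ h′ with x∈⁅y⁆⇒x≡y w h′
  ...   | refl = w∉F v∈F

  card-img : ∀ {n s} {F : List (Fin n)} (x : Vec (Fin n) s) e → Uniq F x → card (img x e) ≡ card e
  card-img {n} []  []            u       = ∣⊥∣≡0 n
  card-img (v ∷ x) (outside ∷ e) (_ , u) = card-img x e u
  card-img (v ∷ x) (inside ∷ e)  (_ , u) =
    trans (card-insert (img x e) (Uniq⇒∉img x e u (here refl))) (cong suc (card-img x e u))

  lookup≢ : ∀ {s} {F : List A} (x : Vec A s) {v} → Uniq F x → v ∈ F → ∀ j → lookup x j ≢ v
  lookup≢ (w ∷ x) (w∉F , u) v∈F zero    refl = w∉F v∈F
  lookup≢ (w ∷ x) (w∉F , u) v∈F (suc j) eq   = lookup≢ x u (there v∈F) j eq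

  lookup-injective : ∀ {s} {F : List A} (x : Vec A s) → Uniq F x → ∀ {i j} → lookup x i ≡ lookup x
      j → i ≡ j
  lookup-injective x       u       {zero}  {zero}  eq = refl
  lookup-injective (v ∷ x) (_ , u) {suc i} {suc j} eq = cong suc (lookup-injective x u eq)
  lookup-injective (v ∷ x) (_ , u) {zero}  {suc j} eq = ⊥-elim (lookup≢ x u (here refl) j (sym eq))
  lookup-injective (v ∷ x) (_ , u) {suc i} {zero}  eq = ⊥-elim (lookup≢ x u (here refl) i eq)

  ⊕-suc : ∀ {s j} b (S : Subset s) (z : Vec (Fin s) j) → (b ∷ S) ⊕ Vec.map suc z ≡ b ∷ (S ⊕ z)
  ⊕-suc b       S []      = refl
  ⊕-suc outside S (i ∷ z) = ⊕-suc outside (S ∪ ⁅ i ⁆) z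
  ⊕-suc inside  S (i ∷ z) = ⊕-suc inside (S ∪ ⁅ i ⁆) z

  elements : ∀ {s} (S : Subset s) → ∃ λ (D : Vec (Fin s) (card S)) → ⊥ ⊕ D ≡ S
  elements []            = [] , refl
  elements (outside ∷ S) = let D , eq = elements S in
    Vec.map suc D , trans (⊕-suc outside ⊥ D) (cong (outside ∷_) eq)
  elements (inside ∷ S)  = let D , eq = elements S in
    zero ∷ Vec.map suc D , trans (⊕-suc inside (⊥ ∪ ⊥) D)
      (cong (inside ∷_) (trans (cong (_⊕ D) (∪-identityʳ ⊥)) eq))

  -- The size test makes the pull-back k-uniform even when x repeats a vertex and so maps a larger
  -- set onto an edge.
  pull : ∀ {k n s} → KGraph k n → Vec (Fin n) s → KGraph k s
  pull {k} H x = record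
    { isEdge  = λ e → isYes (card e ≟ k) ∧ KGraph.isEdge H (img x e)
    ; uniform = λ {e} h → toWitness {a? = card e ≟ k}
        (proj₁ (Equivalence.to (T-∧ {isYes (card e ≟ k)}) h))
    }

  -- Taking images cannot enlarge a set, so a set of size at most k whose image is an edge passes
  -- the size test.
  pull-Edge⁺ : ∀ {k n s} (H : KGraph k n) (x : Vec (Fin n) s) e → card e ≤ k → KGraph.Edge H
      (img x e) → KGraph.Edge (pull H x) e
  pull-Edge⁺ {k} H x e |e|≤k h = Equivalence.from T-∧
    (fromWitness (≤-antisym |e|≤k (≤-trans (≤-reflexive (sym (KGraph.uniform H h)))
        (card-img-≤ x e))) , h)

  pull-Edge⁻ : ∀ {k n s} (H : KGraph k n) (x : Vec (Fin n) s) e → KGraph.Edge (pull H x) e →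
      KGraph.Edge H (img x e)
  pull-Edge⁻ {k} H x e h = proj₂ (Equivalence.to (T-∧ {isYes (card e ≟ k)}) h)

  -- Spanning loose cycles in random tuples

  order : ℕ → ℕ → ℕ
  order k ℓ = ℓ + ℓ * (k ∸ 2)

  vertices : ∀ k ℓ → Fin (order k ℓ) ↔ Hypergraph.V (looseCycle k ℓ)
  vertices k ℓ = (↔-id (Fin ℓ) ⊎-↔ Fin.*↔×) ↔-∘ Fin.+↔⊎

  module _ {k n : ℕ} (H : KGraph k n) (ℓ : ℕ) where

    -- Injectivity of the embedding is left out: in the tiling it follows from disjointness of the
    -- rows, and only the edges have to be tracked.
    IsLooseCycle : (Hypergraph.V (looseCycle k ℓ) → Fin n) → Set
    IsLooseCycle φ = ∀ e → ∃ λ s → KGraph.Edge H s ×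
        (∀ v → v ∈ˢ s ⇔ ∃ λ x → Hypergraph._∈ₑ_ (looseCycle k ℓ) x e × φ x ≡ v)

    Spans : ∀ {s} → Vec (Fin n) s → Set
    Spans {s} x = Uniq [] x × Σ (Hypergraph.V (looseCycle k ℓ) → Fin s) λ ψ →
      Injective _≡_ _≡_ ψ × IsLooseCycle (lookup x ∘ ψ)

  -- A loose cycle of length ℓ′ has ℓ′ (1 + (k ∸ 2)) vertices, so its length is determined by the
  -- number of vertices it spans. A Hamilton cycle on s vertices therefore has the intended length
  -- ℓ.
  hamiltonian⇒spans : ∀ {k n s ℓ} (H : KGraph k n) → s ≡ order k ℓ → (x : Vec (Fin n) s) → Uniq []
      x →
    LooseHamiltonian (pull H x) → Spans H ℓ x
  hamiltonian⇒spans {k} {n} {_} {ℓ} H refl x u (ℓ′ , _ , K , covers) with ℓ′≡ℓ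
    where
    open Copy K
    enum = vertices k ℓ′
    W = Hypergraph.V (looseCycle k ℓ′)
    order≤ : order k ℓ′ ≤ order k ℓ
    order≤ = Fin.injective⇒≤ {f = φ ∘ Inverse.to enum} λ eq →
      trans (sym (Inverse.strictlyInverseʳ enum _))
          (trans (cong (Inverse.from enum) (injective eq)) (Inverse.strictlyInverseʳ enum _))
    order≥ : order k ℓ ≤ order k ℓ′
    order≥ = Fin.injective⇒≤ {f = λ v → Inverse.from enum (proj₁ (covers v))} λ {v} {w} eq →
      trans (sym (proj₂ (covers v))) (trans (cong φ
        (trans (sym (Inverse.strictlyInverseˡ enum _))
            (trans (cong (Inverse.to enum) eq) (Inverse.strictlyInverseˡ enum _))))
        (proj₂ (covers w)))
    ℓ′≡ℓ : ℓ′ ≡ ℓ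
    ℓ′≡ℓ = *-cancelʳ-≡ ℓ′ ℓ (suc (k ∸ 2)) (trans (*-suc ℓ′ (k ∸ 2))
        (trans (≤-antisym order≤ order≥) (sym (*-suc ℓ (k ∸ 2)))))
  ... | refl = u , φ , injective , λ e → let s , h , h⇔ = edges e in
      img x s , pull-Edge⁻ H x s h , λ v → mk⇔
        (λ v∈ → let i , i∈s , xi≡v = ∈-img⁻ x s v∈
                    w , w∈e , φw≡i = Equivalence.to (h⇔ i) i∈s
                in w , w∈e , trans (cong (lookup x) φw≡i) xi≡v)
        (λ { (w , w∈e , refl) → ∈-img⁺ x (Equivalence.from (h⇔ (φ w)) (w , w∈e , refl)) })
    where open Copy K

  Forces : (k d s w a : ℕ) → Set
  Forces k d s w a = ∀ (G : KGraph k s) → a * ((s ∸ d) C (k ∸ d)) < w * minDegree d G →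
      LooseHamiltonian G

  module Inherit {k n : ℕ} (H : KGraph k n) (d w a : ℕ) (d≤k : d ≤ k) where

    private
      j = k ∸ d
      Joined : ∀ {i} → Vec (Fin n) i → Vec (Fin n) j → Set
      Joined y z = KGraph.Edge H ((⊥ ⊕ y) ⊕ z)

    Dense : Set
    Dense = ∀ (y : Vec (Fin n) d) → card (⊥ ⊕ y) ≡ d →
      (4 + a) * n ^ j ≤ w * ∑ (vecs (allFin n) j) (λ z → ι (Joined y z))

    Sparse : ∀ {s} → Vec (Fin s) d → Vec (Fin n) s → Set
    Sparse {s} D x = w * ∑ (vecs (allFin s) j) (λ z → ι (Joined (select x D) (select x z))) ≤ a * s
        ^ j

    -- If D is not sparse, more than a/w of all s^j index tuples complete it to an edge. This
    -- exceeds a/w of the binomial count because j! C(s - d, j) ≤ s^j.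
    unsparse⇒minDegree : ∀ {s} (x : Vec (Fin n) s) → Uniq [] x → a < w → k ≤ s →
      (∀ D → card (⊥ ⊕ select x D) ≡ d → ¬ Sparse D x) →
      a * ((s ∸ d) C (k ∸ d)) < w * minDegree d (pull H x)
    unsparse⇒minDegree {s} x u a<w k≤s unsparse = minDegree-elim d (pull H x)
        (λ m → a * ((s ∸ d) C j) < w * m)
      -- The default of `minDegree` is the binomial coefficient itself, which is positive by k ≤ s,
      -- so a < w settles this case.
      (*-monoˡ-< ((s ∸ d) C j) {{>-nonZero (nCk>0 (∸-monoˡ-≤ d k≤s))}} a<w) step
      where
      open ≤-Reasoning
      e₁ : ∀ a b c → a * (b * c) ≡ b * (a * c)
      e₁ = solve-∀
      step : ∀ S → card S ≡ d → a * ((s ∸ d) C j) < w * degree (pull H x) S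
      enumerate : ∀ S → card S ≡ d → ∃ λ (D : Vec (Fin s) d) → ⊥ ⊕ D ≡ S
      enumerate S refl = elements S
      step S |S| with enumerate S |S|
      ... | D , refl = *-cancelˡ-< (j !) _ _ (begin-strict
        j ! * (a * ((s ∸ d) C j))
          ≡⟨ e₁ (j !) a _ ⟩
        a * (j ! * ((s ∸ d) C j))
          ≤⟨ *-monoʳ-≤ a (≤-trans (k!*nCk≤n^k (s ∸ d) j) (^-monoˡ-≤ j (m∸n≤m s d))) ⟩
        a * s ^ j
          <⟨ ≰⇒> (unsparse D (trans (cong card (sym imgD)) (trans (card-img x (⊥ ⊕ D) u) |S|))) ⟩
        w * ∑ (vecs (allFin s) j) (λ z → ι (Joined (select x D) (select x z)))
          ≤⟨ *-monoʳ-≤ w (∑-mono (vecs (allFin s) j) λ z → ι-mono (pulled z)) ⟩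
        w * ∑ (vecs (allFin s) j) (λ z → ι (KGraph.Edge (pull H x) ((⊥ ⊕ D) ⊕ z)))
          ≡⟨ cong (w *_) (j!*degree (pull H x) j (⊥ ⊕ D) |D|+j) ⟩
        w * (j ! * degree (pull H x) (⊥ ⊕ D))
          ≡⟨ e₁ w (j !) _ ⟩
        j ! * (w * degree (pull H x) (⊥ ⊕ D)) ∎)
        where
        |D|+j : card (⊥ ⊕ D) + j ≡ k
        |D|+j = trans (cong (_+ j) |S|) (m+[n∸m]≡n d≤k)
        imgD : img x (⊥ ⊕ D) ≡ ⊥ ⊕ select x D
        imgD = trans (img-⊕ x ⊥ D) (cong (_⊕ select x D) (img-⊥ x))
        pulled : ∀ z → Joined (select x D) (select x z) → KGraph.Edge (pull H x) ((⊥ ⊕ D) ⊕ z)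
        pulled z h = pull-Edge⁺ H x _ (≤-trans (card-⊕-≤ (⊥ ⊕ D) z) (≤-reflexive |D|+j))
          (subst (KGraph.Edge H) (sym (trans (img-⊕ x (⊥ ⊕ D) z) (cong (_⊕ select x z) imgD))) h)

    ∑-head : ∀ {s} (v : Fin n) (R : Vec (Fin n) (suc s) → Set) →
      ∑ (vecs (allFin n) (suc s)) (λ x → ι (head x ≡ v × R x)) ≡ ∑ (vecs (allFin n) s)
          (λ y → ι (R (v ∷ y)))
    ∑-head {s} v R = trans (∑-vecs (allFin n) s _)
      (trans (∑-cong (allFin n) λ u → ∑-ι-× (vecs (allFin n) s) (λ y → R (u ∷ y)))
             (∑-point n v (λ u → ∑ (vecs (allFin n) s) (λ y → ι (R (u ∷ y))))))

    -- A tuple starting at v can fail only by repeating a vertex or by being sparse at some index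
    -- tuple D. Each of the two events gets a share 1/(8s); for the second, the bound from
    -- `sampling` is summed over the s^d choices of D.
    spans-typically : ∀ s′ b ℓ → let s = suc s′ ; c = 2 + a ; h = suc (c * (2 + c)) in
      order k ℓ ≡ s → 0 < n → a < w → 0 < b → k ≤ s → Dense → Forces k d s w a →
      c * (w * b * (j * (suc d + w * b * j))) ≤ s →
      8 * s * (s ^ d * (c * h ^ b)) ≤ suc h ^ b →
      8 * s * (s′ * suc s′) ≤ n →
      ∀ v → 4 * s * ∑ (vecs (allFin n) s′) (λ y → ι (¬ Spans H ℓ (v ∷ y))) ≤ n ^ s′
    spans-typically s′ b ℓ order≡s 0<n a<w 0<b k≤s dense forces few decay large v = *-cancelˡ-≤ 2
        (begin
      2 * (4 * s * ∑ Y (λ y → ι (¬ Spans H ℓ (v ∷ y))))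
        ≡⟨ e₁ s _ ⟩
      8 * s * ∑ Y (λ y → ι (¬ Spans H ℓ (v ∷ y)))
        ≤⟨ *-monoʳ-≤ (8 * s) (∑-mono Y λ y → ι-⊎ (failure y)) ⟩
      8 * s * ∑ Y (λ y → ι (¬ Uniq (v ∷ []) y) + ι (∃ (Atypical y)))
        ≡⟨ trans (cong (8 * s *_) (∑-+ Y (λ y → ι (¬ Uniq (v ∷ []) y)) _))
          (*-distribˡ-+ (8 * s) (∑ Y (λ y → ι (¬ Uniq (v ∷ []) y))) _) ⟩
      8 * s * ∑ Y (λ y → ι (¬ Uniq (v ∷ []) y)) + 8 * s * ∑ Y (λ y → ι (∃ (Atypical y)))
        ≤⟨ +-mono-≤ repeated atypical ⟩
      n ^ s′ + n ^ s′
        ≡⟨ e₂ (n ^ s′) ⟩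
      2 * n ^ s′ ∎)
      where
      open ≤-Reasoning
      s = suc s′
      c = 2 + a
      h = suc (c * (2 + c))
      Y = vecs (allFin n) s′
      e₁ : ∀ s x → 2 * (4 * s * x) ≡ 8 * s * x
      e₁ = solve-∀
      e₂ : ∀ x → x + x ≡ 2 * x
      e₂ = solve-∀
      e₃ : ∀ n s x → n * (8 * s * x) ≡ 8 * s * (n * x)
      e₃ = solve-∀
      Guard : Vec (Fin s) d → Vec (Fin n) s → Set
      Guard D x = head x ≡ v × card (⊥ ⊕ select x D) ≡ d
      Atypical : Vec (Fin n) s′ → Vec (Fin s) d → Set
      Atypical y D = card (⊥ ⊕ select (v ∷ y) D) ≡ d × Sparse D (v ∷ y)
      failure : ∀ y → ¬ Spans H ℓ (v ∷ y) → ¬ Uniq (v ∷ []) y ⊎ ∃ (Atypical y)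
      failure y ¬spans with em {Uniq (v ∷ []) y} | em {∃ (Atypical y)}
      ... | no ¬u | _     = inj₁ ¬u
      ... | _     | yes t = inj₂ t
      ... | yes u | no ¬t = ⊥-elim (¬spans (hamiltonian⇒spans {ℓ = ℓ} H (sym order≡s) (v ∷ y)
          ((λ ()) , u)
        (forces (pull H (v ∷ y)) (unsparse⇒minDegree (v ∷ y) ((λ ()) , u) a<w k≤s λ D |D| sparse →
            ¬t (D , |D| , sparse)))))
      repeated : 8 * s * ∑ Y (λ y → ι (¬ Uniq (v ∷ []) y)) ≤ n ^ s′
      repeated = *-cancelˡ-≤ n {{>-nonZero 0<n}} (begin
        n * (8 * s * ∑ Y (λ y → ι (¬ Uniq (v ∷ []) y)))
          ≡⟨ e₃ n s _ ⟩
        8 * s * (n * ∑ Y (λ y → ι (¬ Uniq (v ∷ []) y)))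
          ≤⟨ *-monoʳ-≤ (8 * s) (∑-¬Uniq n s′ (v ∷ [])) ⟩
        8 * s * (s′ * suc s′ * n ^ s′)
          ≡⟨ *-assoc (8 * s) (s′ * suc s′) (n ^ s′) ⟨
        8 * s * (s′ * suc s′) * n ^ s′
          ≤⟨ *-monoˡ-≤ (n ^ s′) large ⟩
        n * n ^ s′ ∎)
      each : ∀ D → suc h ^ b * ∑ (vecs (allFin n) s) (λ x → ι (Guard D x × Sparse D x)) ≤ c * h ^ b
          * n ^ s′
      each D = begin
        suc h ^ b * ∑ (vecs (allFin n) s) (λ x → ι (Guard D x × Sparse D x))
          -- The fixed positions are 0, which carries v, and those listed in D; this is the origin
          -- of `suc d` in the bound on the sample size.
          ≤⟨ sampling n s j a w b 0<n z<s (≤-<-trans z≤n a<w) 0<b (zero ∷ toList D) (Guard D)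
            (λ x → Joined (select x D))
               (λ {x} {y} agree (x₀ , |D|) → trans (trans (head-lookup y)
                   (trans (sym (agree (here refl))) (sym (head-lookup x)))) x₀
                 , subst (λ z → card (⊥ ⊕ z) ≡ d) (select-cong x y D (agree ∘ there)) |D|)
               (λ {x} {y} {u} agree → subst (λ z → Joined z u) (select-cong x y D (agree ∘ there)))
               (λ {x} (_ , |D|) → dense (select x D) |D|)
               (subst (λ f → c * (w * b * (j * (suc f + w * b * j))) ≤ s) (sym (length-toList D))
                   few) ⟩
        c * h ^ b * ∑ (vecs (allFin n) s) (λ x → ι (Guard D x))
          ≡⟨ cong (c * h ^ b *_) (∑-head v λ x → card (⊥ ⊕ select x D) ≡ d) ⟩
        c * h ^ b * ∑ Y (λ y → ι (card (⊥ ⊕ select (v ∷ y) D) ≡ d))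
          ≤⟨ *-monoʳ-≤ (c * h ^ b) (∑-mono Y λ y → ι≤1 _) ⟩
        c * h ^ b * ∑ Y (λ y → 1)
          ≡⟨ cong (c * h ^ b *_) (trans (∑-vecs-const (allFin n) s′ 1)
            (trans (*-identityʳ _) (cong (_^ s′) (length-allFin n)))) ⟩
        c * h ^ b * n ^ s′ ∎
        where
        head-lookup : ∀ {m} (x : Vec (Fin n) (suc m)) → head x ≡ lookup x zero
        head-lookup (_ ∷ _) = refl
        select-cong : ∀ {i} (x y : Vec (Fin n) s) (τ : Vec (Fin s) i) →
            (∀ {q} → q ∈ toList τ → lookup x q ≡ lookup y q) → select x τ ≡ select y τ
        select-cong x y []      agree = refl
        select-cong x y (q ∷ τ) agree = cong₂ _∷_ (agree (here refl))
            (select-cong x y τ (agree ∘ there))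
      DD = vecs (allFin s) d
      atypical : 8 * s * ∑ Y (λ y → ι (∃ (Atypical y))) ≤ n ^ s′
      atypical = *-cancelˡ-≤ (suc h ^ b) {{>-nonZero (m^n>0 (suc h) b)}} (begin
        suc h ^ b * (8 * s * ∑ Y (λ y → ι (∃ (Atypical y))))
          ≤⟨ *-monoʳ-≤ (suc h ^ b) (*-monoʳ-≤ (8 * s) (∑-mono Y λ y → ∃-≤-∑ (Atypical y))) ⟩
        suc h ^ b * (8 * s * ∑ Y (λ y → ∑ DD λ D → ι (Atypical y D)))
          ≡⟨ trans (cong (λ z → suc h ^ b * (8 * s * z)) (∑-swap Y DD _)) (e₄ (suc h ^ b) s _) ⟩
        8 * s * (suc h ^ b * ∑ DD (λ D → ∑ Y λ y → ι (Atypical y D)))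
          ≡⟨ cong (8 * s *_) (∑-*ˡ DD (suc h ^ b) _) ⟨
        8 * s * ∑ DD (λ D → suc h ^ b * ∑ Y λ y → ι (Atypical y D))
          ≤⟨ *-monoʳ-≤ (8 * s) (∑-mono DD λ D → ≤-trans (*-monoʳ-≤ (suc h ^ b) (≤-trans
               (≤-reflexive (sym (∑-head v λ x → card (⊥ ⊕ select x D) ≡ d × Sparse D x)))
               (∑-mono (vecs (allFin n) s) λ x → ι-mono λ (p , q , r) → (p , q) , r))) (each D)) ⟩
        8 * s * ∑ DD (λ D → c * h ^ b * n ^ s′)
          ≡⟨ cong (8 * s *_) (trans (∑-vecs-const (allFin s) d _)
            (cong (λ z → z ^ d * (c * h ^ b * n ^ s′)) (length-allFin s))) ⟩
        8 * s * (s ^ d * (c * h ^ b * n ^ s′))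
          ≡⟨ e₅ (8 * s) (s ^ d) (c * h ^ b) (n ^ s′) ⟩
        8 * s * (s ^ d * (c * h ^ b)) * n ^ s′
          ≤⟨ *-monoˡ-≤ (n ^ s′) decay ⟩
        suc h ^ b * n ^ s′ ∎)
        where
        e₄ : ∀ x s y → x * (8 * s * y) ≡ 8 * s * (x * y)
        e₄ = solve-∀
        e₅ : ∀ x y z u → x * (y * (z * u)) ≡ x * (y * z) * u
        e₅ = solve-∀
        ∃-≤-∑ : ∀ (R : Vec (Fin s) d → Set) → ι (∃ R) ≤ ∑ DD (ι ∘ R)
        ∃-≤-∑ R with em {∃ R}
        ... | no ¬r = ≤-trans (≤-reflexive (ι-no ¬r)) z≤n
        ... | yes (D , r) = ≤-trans (ι≤1 _) (≤-trans (≤-reflexive (sym (ι-yes r)))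
            (∑-∈ (ι ∘ R) (∈-vecs ∈-allFin D)))

  -- Complete partite subgraphs

  -- Each surviving y is related to at least 2q/D of the x, and excluding those already used leaves
  -- q/D. By averaging some fresh x is related to a 1/D share of the survivors; it is chosen and the
  -- other y are dropped.
  greedy : ∀ {q} {B : Set} (ys : List B) (R : Fin q → B → Set) D → 0 < q →
      ∀ M (F : List (Fin q)) (Y : B → Set) →
    (∀ y → Y y → 2 * q ≤ D * ∑ (allFin q) (λ x → ι (R x y))) → D * (length F + M) ≤ q → 0 < ∑ ys
        (ι ∘ Y) →
    ∃ λ (a : Fin M → Fin q) → Injective _≡_ _≡_ a × (∀ i → a i ∉ F) ×
      ∑ ys (ι ∘ Y) ≤ D ^ M * ∑ ys (λ y → ι (Y y × ∀ i → R (a i) y))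
  greedy ys R D 0<q zero    F Y rich room 0<Y = (λ ()) , (λ {}) , (λ ()) ,
    ≤-trans (∑-mono ys λ y → ι-mono λ h → h , λ ()) (≤-reflexive (sym (+-identityʳ _)))
  greedy {q} ys R D 0<q (suc M) F Y rich room 0<Y = a , a-inj , a∉F , (begin
    ∑ ys (ι ∘ Y)
      ≤⟨ Y≤ ⟩
    D * ∑ ys (ι ∘ Y′)
      ≤⟨ *-monoʳ-≤ D (proj₂ (proj₂ (proj₂ rest))) ⟩
    D * (D ^ M * ∑ ys (λ y → ι (Y′ y × ∀ i → R (a′ i) y)))
      ≡⟨ *-assoc D _ _ ⟨
    D ^ suc M * ∑ ys (λ y → ι (Y′ y × ∀ i → R (a′ i) y))
      ≤⟨ *-monoʳ-≤ (D ^ suc M) (∑-mono ys λ y → ι-mono λ ((h , r) , rs) → h ,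
        λ { zero → r ; (suc i) → rs i }) ⟩
    D ^ suc M * ∑ ys (λ y → ι (Y y × ∀ i → R (a i) y)) ∎)
    where
    open ≤-Reasoning
    Fresh : Fin q → _ → Set
    Fresh x y = x ∉ F × R x y
    e₁ : ∀ q → 2 * q ≡ q + q
    e₁ = solve-∀
    fresh : ∀ y → q * ι (Y y) ≤ D * ∑ (allFin q) (λ x → ι (Y y × Fresh x y))
    fresh y with em {Y y}
    ... | no ¬h = ≤-trans (≤-reflexive (trans (cong (q *_) (ι-no ¬h)) (*-zeroʳ q))) z≤n
    ... | yes h = +-cancelʳ-≤ q _ _ (begin
      q * ι (Y y) + q
        ≡⟨ cong (_+ q) (trans (cong (q *_) (ι-yes h)) (*-identityʳ q)) ⟩
      q + q
        ≡⟨ e₁ q ⟨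
      2 * q
        ≤⟨ rich y h ⟩
      D * ∑ (allFin q) (λ x → ι (R x y))
        ≤⟨ *-monoʳ-≤ D (∑-mono (allFin q) λ x → ι-⊎ (split x)) ⟩
      D * ∑ (allFin q) (λ x → ι (Y y × Fresh x y) + ι (x ∈ F))
        ≡⟨ trans (cong (D *_) (∑-+ (allFin q) _ _)) (*-distribˡ-+ D _ _) ⟩
      D * ∑ (allFin q) (λ x → ι (Y y × Fresh x y)) + D * ∑ (allFin q) (λ x → ι (x ∈ F))
        ≤⟨ +-monoʳ-≤ _ (≤-trans (*-monoʳ-≤ D (≤-trans (∑-∈-≤ q F) (m≤m+n _ (suc M)))) room) ⟩
      D * ∑ (allFin q) (λ x → ι (Y y × Fresh x y)) + q ∎)
      where
      split : ∀ x → R x y → (Y y × Fresh x y) ⊎ x ∈ F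
      split x r with em {x ∈ F}
      ... | yes x∈F = inj₂ x∈F
      ... | no x∉F  = inj₁ (h , x∉F , r)
    pick : ∃ λ x → ∑ ys (ι ∘ Y) ≤ D * ∑ ys (λ y → ι (Y y × Fresh x y))
    pick = average (allFin q) _ _ (subst (0 <_) (sym (length-allFin q)) 0<q) (begin
      length (allFin q) * ∑ ys (ι ∘ Y)
        ≡⟨ cong (_* ∑ ys (ι ∘ Y)) (length-allFin q) ⟩
      q * ∑ ys (ι ∘ Y)
        ≡⟨ ∑-*ˡ ys q _ ⟨
      ∑ ys (λ y → q * ι (Y y))
        ≤⟨ ∑-mono ys fresh ⟩
      ∑ ys (λ y → D * ∑ (allFin q) (λ x → ι (Y y × Fresh x y)))
        ≡⟨ ∑-*ˡ ys D _ ⟩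
      D * ∑ ys (λ y → ∑ (allFin q) (λ x → ι (Y y × Fresh x y)))
        ≡⟨ cong (D *_) (∑-swap ys (allFin q) _) ⟩
      D * ∑ (allFin q) (λ x → ∑ ys (λ y → ι (Y y × Fresh x y)))
        ≡⟨ ∑-*ˡ (allFin q) D _ ⟨
      ∑ (allFin q) (λ x → D * ∑ ys (λ y → ι (Y y × Fresh x y))) ∎)
    x₀ = proj₁ pick
    x₀∉F : x₀ ∉ F
    x₀∉F x∈F = <-irrefl refl (≤-trans 0<Y (≤-trans (proj₂ pick)
      (≤-reflexive (trans (cong (D *_) (trans (∑-cong ys λ y → ι-no λ (_ , x∉F , _) → x∉F x∈F)
          (∑-zero ys))) (*-zeroʳ D)))))
    Y′ = λ y → Y y × R x₀ y
    Y≤ : ∑ ys (ι ∘ Y) ≤ D * ∑ ys (ι ∘ Y′)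
    Y≤ = ≤-trans (proj₂ pick) (*-monoʳ-≤ D (∑-mono ys λ y → ι-mono λ (h , _ , r) → h , r))
    0<Y′ : 0 < ∑ ys (ι ∘ Y′)
    0<Y′ with ∑ ys (ι ∘ Y′) | Y≤
    ... | zero  | le = ⊥-elim (<-irrefl refl (≤-trans 0<Y (≤-trans le (≤-reflexive (*-zeroʳ D)))))
    ... | suc _ | _  = z<s
    rest = greedy ys R D 0<q M (x₀ ∷ F) Y′ (λ y h → rich y (proj₁ h))
             (≤-trans (≤-reflexive (cong (D *_) (sym (+-suc (length F) M)))) room) 0<Y′
    a′ = proj₁ rest
    a : Fin (suc M) → Fin q
    a zero    = x₀
    a (suc i) = a′ i
    a-inj : Injective _≡_ _≡_ a
    a-inj {zero}  {zero}  eq = refl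
    a-inj {zero}  {suc j} eq = ⊥-elim (proj₁ (proj₂ (proj₂ rest)) j (here (sym eq)))
    a-inj {suc i} {zero}  eq = ⊥-elim (proj₁ (proj₂ (proj₂ rest)) i (here eq))
    a-inj {suc i} {suc j} eq = cong suc (proj₁ (proj₂ rest) eq)
    a∉F : ∀ i → a i ∉ F
    a∉F zero    = x₀∉F
    a∉F (suc i) = proj₁ (proj₂ (proj₂ rest)) i ∘ there

  -- Erdős' theorem on complete r-partite r-graphs, at density 4 / 2 ^ e.
  box : ∀ {q} M r e (F : List (Fin q)) (R : Vec (Fin q) r → Set) → 0 < q → 0 < e →
    4 * q ^ r ≤ 2 ^ e * ∑ (vecs (allFin q) r) (ι ∘ R) →
    2 ^ (e * (2 + M) ^ r) * (length F + r * M) ≤ q →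
    ∃ λ (part : Fin r → Fin M → Fin q) → (∀ {l l′ p p′} → part l p ≡ part l′ p′ → l ≡ l′ × p ≡ p′) ×
      (∀ l p → part l p ∉ F) × (∀ (f : Fin r → Fin M) → R (Vec.tabulate λ l → part l (f l)))
  box M zero e F R 0<q 0<e dense room = (λ ()) , (λ { {()} }) , (λ ()) , λ _ → R[]
    where
    R[] : R []
    R[] with em {R []}
    ... | yes r = r
    ... | no ¬r = ⊥-elim (n≮0 (≤-trans dense
        (≤-reflexive (trans (cong (λ z → 2 ^ e * (z + 0)) (ι-no ¬r)) (*-zeroʳ (2 ^ e))))))
  box {q} M (suc r) e F R 0<q 0<e dense room = part , part-inj , part∉F , part-box
    where
    open ≤-Reasoning
    instance _ = >-nonZero 0<q
    D = 2 ^ e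
    ys = vecs (allFin q) r
    -- Tails with at least 2q/D heads. The other tails account for at most half of the density 4/D,
    -- so Y keeps density 2/D.
    Y : Vec (Fin q) r → Set
    Y y = 2 * q ≤ D * ∑ (allFin q) (λ x → ι (R (x ∷ y)))
    fibre : ∀ y → D * ∑ (allFin q) (λ x → ι (R (x ∷ y))) ≤ D * q * ι (Y y) + 2 * q
    fibre y with em {Y y}
    ... | yes h = ≤-trans (*-monoʳ-≤ D (∑-mono (allFin q) λ x → ι≤1 _)) (≤-trans (≤-reflexive
            (trans (cong (D *_) (trans (∑-allFin-const q 1) (*-identityʳ q)))
                (sym (trans (cong (D * q *_) (ι-yes h)) (*-identityʳ _))))) (m≤m+n _ _))
    ... | no ¬h = ≤-trans (<⇒≤ (≰⇒> ¬h)) (m≤n+m (2 * q) (D * q * ι (Y y)))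
    e₁ : ∀ q m → 4 * (q * m) ≡ q * (4 * m)
    e₁ = solve-∀
    e₂ : ∀ D q y m → D * q * y + m * (2 * q) ≡ q * (D * y + 2 * m)
    e₂ = solve-∀
    e₃ : ∀ m → 4 * m ≡ 2 * m + 2 * m
    e₃ = solve-∀
    manyY : 2 * q ^ r ≤ D * ∑ ys (ι ∘ Y)
    manyY = +-cancelʳ-≤ (2 * q ^ r) _ _ (*-cancelˡ-≤ q (begin
      q * (2 * q ^ r + 2 * q ^ r)
        ≡⟨ cong (q *_) (e₃ (q ^ r)) ⟨
      q * (4 * q ^ r)
        ≡⟨ e₁ q (q ^ r) ⟨
      4 * q ^ suc r
        ≤⟨ dense ⟩
      D * ∑ (vecs (allFin q) (suc r)) (ι ∘ R)
        ≡⟨ cong (D *_) (trans (∑-vecs (allFin q) r _) (∑-swap (allFin q) ys _)) ⟩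
      D * ∑ ys (λ y → ∑ (allFin q) λ x → ι (R (x ∷ y)))
        ≡⟨ ∑-*ˡ ys D _ ⟨
      ∑ ys (λ y → D * ∑ (allFin q) λ x → ι (R (x ∷ y)))
        ≤⟨ ∑-mono ys fibre ⟩
      ∑ ys (λ y → D * q * ι (Y y) + 2 * q)
        ≡⟨ trans (∑-+ ys _ _) (cong₂ _+_ (∑-*ˡ ys (D * q) _)
             (trans (∑-vecs-const (allFin q) r _) (cong (λ z → z ^ r * (2 * q))
                 (length-allFin q)))) ⟩
      D * q * ∑ ys (ι ∘ Y) + q ^ r * (2 * q)
        ≡⟨ e₂ D q (∑ ys (ι ∘ Y)) (q ^ r) ⟩
      q * (D * ∑ ys (ι ∘ Y) + 2 * q ^ r) ∎))
    0<Y : 0 < ∑ ys (ι ∘ Y)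
    0<Y with ∑ ys (ι ∘ Y) | manyY
    ... | zero  | le = ⊥-elim (n≮0 (≤-trans (*-mono-< {1} {2} (s≤s (s≤s z≤n)) (m^n>0 q r))
        (≤-trans le (≤-reflexive (*-zeroʳ D)))))
    ... | suc _ | _  = z<s
    roomY : D * (length F + M) ≤ q
    roomY = ≤-trans (*-mono-≤ (^-monoʳ-≤ 2 (m≤m*n e ((2 + M) ^ suc r) {{m^n≢0 (2 + M) (suc r)}}))
      (+-monoʳ-≤ (length F) (m≤m+n M (r * M)))) room
    first = greedy ys (λ x y → R (x ∷ y)) D 0<q M F Y (λ y h → h) roomY 0<Y
    a = proj₁ first
    R′ : Vec (Fin q) r → Set
    R′ y = Y y × ∀ i → R (a i ∷ y)
    F′ = List.tabulate a ++ F
    -- The density loses a factor D for passing to Y and one for each of the M choices; one more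
    -- factor D ≥ 2 restores the 4. So e becomes e (2 + M), and r rounds give the exponent e (2 + M)
    -- ^ r.
    dense′ : 4 * q ^ r ≤ 2 ^ (e * (2 + M)) * ∑ ys (ι ∘ R′)
    dense′ = begin
      4 * q ^ r            ≡⟨ *-assoc 2 2 (q ^ r) ⟩
      2 * (2 * q ^ r)      ≤⟨ *-mono-≤ (≤-trans (≤-reflexive (sym (*-identityʳ 2)))
          (^-monoʳ-≤ 2 0<e)) manyY ⟩
      D * (D * ∑ ys (ι ∘ Y)) ≤⟨ *-monoʳ-≤ D (*-monoʳ-≤ D (proj₂ (proj₂ (proj₂ first)))) ⟩
      D * (D * (D ^ M * ∑ ys (ι ∘ R′))) ≡⟨ e₄ D (D ^ M) _ ⟩
      D ^ (2 + M) * ∑ ys (ι ∘ R′) ≡⟨ cong (_* ∑ ys (ι ∘ R′)) (^-*-assoc 2 e (2 + M)) ⟩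
      2 ^ (e * (2 + M)) * ∑ ys (ι ∘ R′) ∎
      where
      e₄ : ∀ d m x → d * (d * (m * x)) ≡ d * (d * m) * x
      e₄ = solve-∀
    room′ : 2 ^ (e * (2 + M) * (2 + M) ^ r) * (length F′ + r * M) ≤ q
    room′ = subst₂ (λ x y → 2 ^ x * y ≤ q) (sym (*-assoc e (2 + M) _))
      (sym (trans (cong (_+ r * M) (trans (length-++ (List.tabulate a))
          (cong (_+ length F) (length-tabulate a)))) (e₅ M (length F) (r * M)))) room
      where
      e₅ : ∀ m f x → m + f + x ≡ f + (m + x)
      e₅ = solve-∀
    rest = box M r (e * (2 + M)) F′ R′ 0<q (*-mono-< 0<e z<s) dense′ room′
    part′ = proj₁ rest
    part′∉ : ∀ l p → part′ l p ∉ F′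
    part′∉ = proj₁ (proj₂ (proj₂ rest))
    part : Fin (suc r) → Fin M → Fin q
    part zero    = a
    part (suc l) = part′ l
    part-inj : ∀ {l l′ p p′} → part l p ≡ part l′ p′ → l ≡ l′ × p ≡ p′
    part-inj {zero}  {zero}   eq = refl , proj₁ (proj₂ first) eq
    part-inj {zero}  {suc l} {p} {p′} eq = ⊥-elim
        (part′∉ l p′ (subst (_∈ F′) eq (∈-++⁺ˡ (∈-tabulate⁺ p))))
    part-inj {suc l} {zero}  {p} {p′} eq = ⊥-elim
        (part′∉ l p (subst (_∈ F′) (sym eq) (∈-++⁺ˡ (∈-tabulate⁺ p′))))
    part-inj {suc l} {suc l′} eq = let l≡ , p≡ = proj₁ (proj₂ rest) eq in cong suc l≡ , p≡
    part∉F : ∀ l p → part l p ∉ F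
    part∉F zero    p = proj₁ (proj₂ (proj₂ first)) p
    part∉F (suc l) p = part′∉ l p ∘ ∈-++⁺ʳ (List.tabulate a)
    part-box : ∀ (f : Fin (suc r) → Fin M) → R (Vec.tabulate λ l → part l (f l))
    part-box f = proj₂ (proj₂ (proj₂ (proj₂ rest)) (f ∘ suc)) (f zero)

  -- Regrouping rows

  Injective₂ : ∀ {A B C : Set} → (A → B → C) → Set
  Injective₂ g = ∀ {a a′ b b′} → g a b ≡ g a′ b′ → a ≡ a′ × b ≡ b′

  ∑-image₂ : ∀ {q s n} (g : Fin q → Fin s → Fin n) → Injective₂ g → ∀ h →
    ∑ (allFin q) (λ j → ∑ (allFin s) λ t → h (g j t)) ≤ ∑ (allFin n) h
  ∑-image₂ {q} {s} {n} g inj h = ≤-trans (≤-reflexive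
      (sym (∑-cartesianProduct (allFin q) (allFin s) _)))
    (∑-pushforward (cartesianProduct (allFin q) (allFin s)) (uncurry g) h λ y →
      ≤-trans (≤-reflexive (∑-cartesianProduct (allFin q) (allFin s) _)) (begin
      ∑ (allFin q) (λ j → ∑ (allFin s) λ t → ι (y ≡ g j t))
        ≤⟨ ∑-mono (allFin q) (λ j → ∑-ι-unique s (λ t → y ≡ g j t) λ p p′ → proj₂
          (inj (trans (sym p) p′))) ⟩
      ∑ (allFin q) (λ j → ι (∃ λ t → y ≡ g j t))
        ≤⟨ ∑-ι-unique q (λ j → ∃ λ t → y ≡ g j t)
          (λ (_ , p) (_ , p′) → proj₁ (inj (trans (sym p) p′))) ⟩
      ι (∃ λ j → ∃ λ t → y ≡ g j t)
        ≤⟨ ι≤1 _ ⟩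
      1 ∎))
    where open ≤-Reasoning

  -- Choosing a row and a column at random amounts to choosing a vertex of the rows, so failures
  -- counted over arrays are bounded by failures counted over all vertex tuples.
  ∑-zipWith : ∀ {q s n} (g : Fin q → Fin s → Fin n) → Injective₂ g → ∀ N (f : Vec (Fin n) N → ℕ) →
    ∑ (vecs (allFin q) N) (λ J → ∑ (vecs (allFin s) N) λ t → f (Vec.zipWith g J t)) ≤ ∑
        (vecs (allFin n) N) f
  ∑-zipWith g inj zero    f = ≤-reflexive (+-identityʳ _)
  ∑-zipWith {q} {s} {n} g inj (suc N) f = begin
    ∑ (vecs (allFin q) (suc N)) (λ J → ∑ (vecs (allFin s) (suc N)) λ t → f (Vec.zipWith g J t))
      ≡⟨ ∑-vecs (allFin q) N _ ⟩
    ∑ (allFin q) (λ j → ∑ (vecs (allFin q) N) λ J → ∑ (vecs (allFin s) (suc N)) λ t → f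
        (Vec.zipWith g (j ∷ J) t))
      ≡⟨ ∑-cong (allFin q) (λ j → trans (∑-cong (vecs (allFin q) N) λ J → ∑-vecs (allFin s) N _)
           (∑-swap (vecs (allFin q) N) (allFin s) _)) ⟩
    ∑ (allFin q) (λ j → ∑ (allFin s) λ τ → ∑ (vecs (allFin q) N) λ J → ∑ (vecs (allFin s) N) λ t →
        f (g j τ ∷ Vec.zipWith g J t))
      ≤⟨ ∑-mono (allFin q) (λ j → ∑-mono (allFin s) λ τ → ∑-zipWith g inj N (λ y → f (g j τ ∷ y))) ⟩
    ∑ (allFin q) (λ j → ∑ (allFin s) λ τ → ∑ (vecs (allFin n) N) λ y → f (g j τ ∷ y))
      ≤⟨ ∑-image₂ g inj (λ v → ∑ (vecs (allFin n) N) λ y → f (v ∷ y)) ⟩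
    ∑ (allFin n) (λ v → ∑ (vecs (allFin n) N) λ y → f (v ∷ y))
      ≡⟨ ∑-vecs (allFin n) N f ⟨
    ∑ (vecs (allFin n) (suc N)) f ∎
    where open ≤-Reasoning

  module Tiling {n q s′ : ℕ} (Cyc : (Fin (suc s′) → Fin n) → Set)
    (Cyc-cong : ∀ {f g} → f ≗ g → Cyc f → Cyc g) where

    private
      s = suc s′

    -- The order of the coordinates is a vector rather than a function, so that all orders can be
    -- listed and serve as colours.
    Good : Vec (Fin n) s → Set
    Good x = ∃ λ (p : Vec (Fin s) s) → Injective _≡_ _≡_ (lookup p) × Cyc (lookup x ∘ lookup p)

    Complete : (Fin q → Fin s → Fin n) → (Fin q → ℕ) → Set
    Complete X label = ∀ i (f : Fin s → Fin q) → (∀ w → label (f w) ≡ suc i) → Cyc (λ w → X (f w) w)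

    virtual : (Fin q → ℕ) → ℕ
    virtual label = ∑ (allFin q) (λ j → ι (label j ≡ 0))

    -- The vertices are split into rows X j; the rows with label i + 1 form the
    -- i-th blow-up, its cluster of w being { X j w }, and label 0 means unused.
    record State (M : ℕ) : Set where
      field
        X        : Fin q → Fin s → Fin n
        X-inj    : Injective₂ X
        label    : Fin q → ℕ
        b        : ℕ
        complete : Complete X label
        label≤b  : ∀ j → label j ≤ b
        -- A step adds s groups and uses up at least M free rows, so the left side never grows; in
        -- the end it yields b * M ≤ s * q.
        budget   : b * M + s * virtual label ≤ s * q

    module Step (typical : ∀ v → 4 * s * ∑ (vecs (allFin n) s′) (λ y → ι (¬ Good (v ∷ y))) ≤ n ^ s′)
                (n≲sq : n ^ s′ ≤ 2 * (s ^ s′ * q ^ s′)) (0<q : 0 < q) where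

      module _ (X : Fin q → Fin s → Fin n) (X-inj : Injective₂ X) (Free : Fin q → Set) where

        -- The i-th cyclic transversal of the array with rows J: in the l-th row it takes column t_l
        -- + i. Random offsets t make every one of the s transversals a random tuple.
        row : Fin s → Vec (Fin q) s → Vec (Fin s) s → Vec (Fin n) s
        row i J t = Vec.zipWith (λ j τ → X j (shift i τ)) J t

        free : ℕ
        free = ∑ (allFin q) (ι ∘ Free)

        Rotatable : Vec (Fin q) s → Set
        Rotatable J = Free (Vec.head J) × ∃ λ t → ∀ i → Good (row i J t)

        -- For fixed i and a free first row, a transversal is bad with probability at most 1/(4s) by
        -- `typical`, doubled by `n≲sq`. The s transversals together cost 1/2, so at least half of
        -- the J with free head admit offsets that work for all i at once.
        many-rotatable : free * q ^ s′ ≤ 2 * ∑ (vecs (allFin q) s) (ι ∘ Rotatable)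
        many-rotatable = *-cancelˡ-≤ (2 * s * s ^ s)
            {{>-nonZero (*-mono-< {0} {2 * s} z<s (m^n>0 s s))}}
            (+-cancelʳ-≤ (2 * s * s ^ s * (free * q ^ s′)) _ _ (begin
          2 * s * s ^ s * (free * q ^ s′) + 2 * s * s ^ s * (free * q ^ s′)
            ≡⟨ e₁ s (s ^ s) (free * q ^ s′) ⟩
          4 * s * (free * q ^ s′ * s ^ s)
            ≡⟨ cong (λ z → 4 * s * (z * s ^ s)) freeJ ⟨
          4 * s * (∑ QQ (λ J → ι (Free (Vec.head J))) * s ^ s)
            ≡⟨ cong (4 * s *_) (∑-*ʳ QQ (s ^ s) _) ⟨
          4 * s * ∑ QQ (λ J → ι (Free (Vec.head J)) * s ^ s)
            ≤⟨ *-monoʳ-≤ (4 * s) (∑-mono QQ pointwise) ⟩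
          4 * s * ∑ QQ (λ J → s ^ s * ι (Rotatable J) + ∑ SS λ t → ∑ (allFin s) λ i → ι
              (Fails J t i))
            ≡⟨ cong (4 * s *_) (trans (∑-+ QQ _ _) (cong₂ _+_ (∑-*ˡ QQ (s ^ s) _) swap)) ⟩
          4 * s * (s ^ s * rot + ∑ (allFin s) λ i → ∑ QQ λ J → ∑ SS λ t → ι (Fails J t i))
            ≡⟨ e₂ s (s ^ s) rot _ ⟩
          2 * s * s ^ s * (2 * rot) + 4 * s * ∑ (allFin s)
              (λ i → ∑ QQ λ J → ∑ SS λ t → ι (Fails J t i))
            ≤⟨ +-monoʳ-≤ (2 * s * s ^ s * (2 * rot)) fails ⟩
          2 * s * s ^ s * (2 * rot) + 2 * s * s ^ s * (free * q ^ s′) ∎))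
          where
          open ≤-Reasoning
          QQ = vecs (allFin q) s
          SS = vecs (allFin s) s
          rot = ∑ QQ (ι ∘ Rotatable)
          Fails : Vec (Fin q) s → Vec (Fin s) s → Fin s → Set
          Fails J t i = Free (Vec.head J) × ¬ Good (row i J t)
          e₁ : ∀ s m x → 2 * s * m * x + 2 * s * m * x ≡ 4 * s * (x * m)
          e₁ = solve-∀
          e₂ : ∀ s m x y → 4 * s * (m * x + y) ≡ 2 * s * m * (2 * x) + 4 * s * y
          e₂ = solve-∀
          freeJ : ∑ QQ (λ J → ι (Free (Vec.head J))) ≡ free * q ^ s′
          freeJ = trans (∑-vecs (allFin q) s′ _) (trans
              (∑-cong (allFin q) λ j → trans (∑-vecs-const (allFin q) s′ _)
            (trans (cong (λ z → z ^ s′ * ι (Free j)) (length-allFin q)) (*-comm (q ^ s′) _)))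
                (∑-*ʳ (allFin q) (q ^ s′) _))
          swap : ∑ QQ (λ J → ∑ SS λ t → ∑ (allFin s) λ i → ι (Fails J t i)) ≡ ∑ (allFin s) λ i → ∑
              QQ λ J → ∑ SS λ t → ι (Fails J t i)
          swap = trans (∑-cong QQ λ J → ∑-swap SS (allFin s) _) (∑-swap QQ (allFin s) _)
          lSS : ∀ c → s ^ s * c ≡ ∑ SS (λ _ → c)
          lSS c = sym (trans (∑-vecs-const (allFin s) s c)
              (cong (λ z → z ^ s * c) (length-allFin s)))
          pointwise : ∀ J → ι (Free (Vec.head J)) * s ^ s ≤ s ^ s * ι (Rotatable J) + ∑ SS λ t → ∑
              (allFin s) λ i → ι (Fails J t i)
          pointwise J with em {Free (Vec.head J)} | em {Rotatable J}
          ... | no ¬f | _     = ≤-trans (≤-reflexive (cong (_* s ^ s) (ι-no ¬f))) z≤n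
          ... | yes f | yes r = ≤-trans (≤-reflexive
              (trans (*-comm (ι (Free (Vec.head J))) _)
              (cong (s ^ s *_) (trans (ι-yes f) (sym (ι-yes r)))))) (m≤m+n _ _)
          ... | yes f | no ¬r = ≤-trans (≤-reflexive
              (trans (*-comm (ι (Free (Vec.head J))) _)
              (trans (cong (s ^ s *_) (ι-yes f)) (lSS 1))))
                  (≤-trans (∑-mono SS fail) (m≤n+m _ (s ^ s * ι (Rotatable J))))
            where
            fail : ∀ t → 1 ≤ ∑ (allFin s) λ i → ι (Fails J t i)
            fail t with em {∃ λ i → ¬ Good (row i J t)}
            ... | yes (i , bad) = ≤-trans (≤-reflexive (sym (ι-yes (f , bad))))
                (∑-∈ (λ i → ι (Fails J t i)) (∈-allFin i))
            ... | no good = ⊥-elim (¬r (f , t , λ i → ¬¬-elim λ bad → good (i , bad)))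
          bad : Fin n → ℕ
          bad v = ∑ (vecs (allFin n) s′) (λ y → ι (¬ Good (v ∷ y)))
          -- The first entry is held fixed while the others are summed, because `typical` holds for
          -- each vertex separately.
          fails-at : ∀ i → 4 * s * ∑ QQ (λ J → ∑ SS λ t → ι (Fails J t i)) ≤ free * (s * n ^ s′)
          fails-at i = begin
            4 * s * ∑ QQ (λ J → ∑ SS λ t → ι (Fails J t i))
              ≡⟨ cong (4 * s *_) (trans (∑-vecs (allFin q) s′ _) (∑-cong (allFin q) λ j →
                   trans (∑-cong (vecs (allFin q) s′) λ J → ∑-vecs (allFin s) s′ _)
                   (trans (∑-swap (vecs (allFin q) s′) (allFin s) _)
                   (∑-cong (allFin s) λ τ → trans (∑-cong (vecs (allFin q) s′) λ J → ∑-ι-×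
                       (vecs (allFin s) s′) _) (∑-*ˡ (vecs (allFin q) s′) (ι (Free j)) _))))) ⟩
            4 * s * ∑ (allFin q) (λ j → ∑ (allFin s) λ τ → ι (Free j) * ∑ (vecs (allFin q) s′)
                λ J → ∑ (vecs (allFin s) s′) λ t →
                      ι (¬ Good (X j (shift i τ) ∷ Vec.zipWith (λ j τ → X j (shift i τ)) J t)))
              ≤⟨ *-monoʳ-≤ (4 * s) (∑-mono (allFin q) λ j → ∑-mono (allFin s) λ τ → *-monoʳ-≤
                (ι (Free j))
                   (∑-zipWith (λ j τ → X j (shift i τ)) (λ eq → let p , r = X-inj eq in p , shift-injectiveʳ {i = i} r) s′
                      (λ y → ι (¬ Good (X j (shift i τ) ∷ y))))) ⟩
            4 * s * ∑ (allFin q) (λ j → ∑ (allFin s) λ τ → ι (Free j) * bad (X j (shift i τ)))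
              ≡⟨ trans (sym (∑-*ˡ (allFin q) (4 * s) _)) (∑-cong (allFin q) λ j →
                   trans (sym (∑-*ˡ (allFin s) (4 * s) _)) (∑-cong (allFin s) λ τ → e₃ s
                       (ι (Free j)) _)) ⟩
            ∑ (allFin q) (λ j → ∑ (allFin s) λ τ → ι (Free j) * (4 * s * bad (X j (shift i τ))))
              ≤⟨ ∑-mono (allFin q) (λ j → ∑-mono (allFin s) λ τ → *-monoʳ-≤ (ι (Free j))
                (typical _)) ⟩
            ∑ (allFin q) (λ j → ∑ (allFin s) λ τ → ι (Free j) * n ^ s′)
              ≡⟨ trans (∑-cong (allFin q) λ j → trans (∑-allFin-const s _)
                (e₄ s (ι (Free j)) (n ^ s′))) (∑-*ʳ (allFin q) (s * n ^ s′) _) ⟩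
            free * (s * n ^ s′) ∎
            where
            e₃ : ∀ s x y → 4 * s * (x * y) ≡ x * (4 * s * y)
            e₃ = solve-∀
            e₄ : ∀ s x y → s * (x * y) ≡ x * (s * y)
            e₄ = solve-∀
          fails : 4 * s * ∑ (allFin s) (λ i → ∑ QQ λ J → ∑ SS λ t → ι (Fails J t i)) ≤ 2 * s * s ^
              s * (free * q ^ s′)
          fails = begin
            4 * s * ∑ (allFin s) (λ i → ∑ QQ λ J → ∑ SS λ t → ι (Fails J t i))
              ≡⟨ ∑-*ˡ (allFin s) (4 * s) _ ⟨
            ∑ (allFin s) (λ i → 4 * s * ∑ QQ λ J → ∑ SS λ t → ι (Fails J t i))
              ≤⟨ ∑-mono (allFin s) fails-at ⟩
            ∑ (allFin s) (λ i → free * (s * n ^ s′))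
              ≡⟨ ∑-allFin-const s _ ⟩
            s * (free * (s * n ^ s′))
              ≤⟨ *-monoʳ-≤ s (*-monoʳ-≤ free (*-monoʳ-≤ s n≲sq)) ⟩
            s * (free * (s * (2 * (s ^ s′ * q ^ s′))))
              ≡⟨ e₅ s free (s ^ s′) (q ^ s′) ⟩
            2 * s * s ^ s * (free * q ^ s′) ∎
            where
            e₅ : ∀ s f x y → s * (f * (s * (2 * (x * y)))) ≡ 2 * s * (s * x) * (f * y)
            e₅ = solve-∀

        -- Offsets together with the s coordinate orders. Their number depends on s alone, so one
        -- colour serves a constant share of all suitable J; a common colour is what aligns the
        -- transversals of a box into clusters.
        Colour : Set
        Colour = Vec (Fin s) s × Vec (Vec (Fin s) s) s

        colours : List Colour
        colours = cartesianProduct (vecs (allFin s) s) (vecs (vecs (allFin s) s) s)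

        colourCount : ℕ
        colourCount = s ^ s * (s ^ s) ^ s

        length-colours : length colours ≡ colourCount
        length-colours = trans (length-cartesianProduct (vecs (allFin s) s) _) (cong₂ _*_ lS
          (trans (length-vecs (vecs (allFin s) s) s) (cong (_^ s) lS)))
          where
          lS : length (vecs (allFin s) s) ≡ s ^ s
          lS = trans (length-vecs (allFin s) s) (cong (_^ s) (length-allFin s))

        Coloured : Colour → Vec (Fin q) s → Set
        Coloured (t , Ψ) J = Free (Vec.head J) × ∀ i → Injective _≡_ _≡_ (lookup (lookup Ψ i)) ×
          Cyc (λ w → let l = lookup (lookup Ψ i) w in X (lookup J l) (shift i (lookup t l)))

        rotatable⇒coloured : ∀ {J} → Rotatable J → ∃ λ c → Coloured c J
        rotatable⇒coloured {J} (f , t , good) = (t , Ψ) , f , λ i →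
          subst (λ p → Injective _≡_ _≡_ (lookup p) × Cyc
              (λ w → X (lookup J (lookup p w)) (shift i (lookup t (lookup p w)))))
            (sym (lookup∘tabulate (proj₁ ∘ good) i))
            (proj₁ (proj₂ (good i)) , Cyc-cong (λ w → lookup-zipWith _ (lookup (proj₁ (good i)) w)
                J t) (proj₂ (proj₂ (good i))))
          where
          Ψ = Vec.tabulate (proj₁ ∘ good)

        -- With density 1/E of free rows, the exponent of the box theorem.
        exponent : ℕ → ℕ
        exponent E = 8 * E * colourCount

        -- Pigeonhole over the colours. The bound `n≤2^n` crudely turns the resulting constant into
        -- a power of 2, the form in which `box` takes a density.
        monochromatic : ∀ E → q ≤ E * free → ∃ λ c → 4 * q ^ s ≤ 2 ^ exponent E * ∑
            (vecs (allFin q) s) (ι ∘ Coloured c)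
        monochromatic E q≤ = proj₁ pick , (begin
          4 * q ^ s
            ≤⟨ *-monoʳ-≤ 4 (proj₂ pick) ⟩
          4 * (2 * E * colourCount * N (proj₁ pick))
            ≡⟨ e₁ E colourCount _ ⟩
          exponent E * N (proj₁ pick)
            ≤⟨ *-monoˡ-≤ _ (n≤2^n (exponent E)) ⟩
          2 ^ exponent E * N (proj₁ pick) ∎)
          where
          open ≤-Reasoning
          QQ = vecs (allFin q) s
          N : Colour → ℕ
          N c = ∑ QQ (ι ∘ Coloured c)
          e₁ : ∀ e c x → 4 * (2 * e * c * x) ≡ 8 * e * c * x
          e₁ = solve-∀
          e₂ : ∀ c e x → c * (e * (2 * x)) ≡ 2 * e * c * x
          e₂ = solve-∀
          pick : ∃ λ c → q ^ s ≤ 2 * E * colourCount * N c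
          pick = average colours _ _ (subst (0 <_) (sym length-colours)
              (*-mono-< (m^n>0 s s) (m^n>0 (s ^ s) {{m^n≢0 s s}} s))) (begin
            length colours * q ^ s
              ≡⟨ cong (_* q ^ s) length-colours ⟩
            colourCount * (q * q ^ s′)
              ≤⟨ *-monoʳ-≤ colourCount (≤-trans (*-monoˡ-≤ (q ^ s′) q≤)
                (≤-trans (≤-reflexive (*-assoc E free _)) (*-monoʳ-≤ E many-rotatable))) ⟩
            colourCount * (E * (2 * ∑ QQ (ι ∘ Rotatable)))
              ≡⟨ e₂ colourCount E _ ⟩
            2 * E * colourCount * ∑ QQ (ι ∘ Rotatable)
              ≤⟨ *-monoʳ-≤ (2 * E * colourCount) (∑-mono QQ some-colour) ⟩
            2 * E * colourCount * ∑ QQ (λ J → ∑ colours λ c → ι (Coloured c J))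
              ≡⟨ trans (cong (2 * E * colourCount *_) (∑-swap QQ colours _))
                (sym (∑-*ˡ colours (2 * E * colourCount) _)) ⟩
            ∑ colours (λ c → 2 * E * colourCount * N c) ∎)
            where
            some-colour : ∀ J → ι (Rotatable J) ≤ ∑ colours λ c → ι (Coloured c J)
            some-colour J with em {Rotatable J}
            ... | no ¬r = ≤-trans (≤-reflexive (ι-no ¬r)) z≤n
            ... | yes r = let c , col = rotatable⇒coloured {J} r in
              ≤-trans (ι≤1 _) (≤-trans (≤-reflexive (sym (ι-yes col)))
                  (∑-∈ (λ c → ι (Coloured c J)) (∈-colours c)))
              where
              ∈-colours : ∀ c → c ∈ colours
              ∈-colours (t , Ψ) = ∈-cartesianProduct⁺ (∈-vecs ∈-allFin t)
                  (∈-vecs (∈-vecs ∈-allFin) Ψ)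

      module _ {M : ℕ} (σ : State M) where
        open State σ

        private
          Free : Fin q → Set
          Free j = label j ≡ 0

        module Replace (c : Colour X X-inj Free) (A : Fin s → Fin M → Fin q) (A-inj : Injective₂ A)
          (A-box : ∀ (f : Fin s → Fin M) → Coloured X X-inj Free c (Vec.tabulate λ l → A l (f l))) where

          ψ : Fin s → Fin s → Fin s
          ψ i w = lookup (lookup (proj₂ c) i) w

          turn : Fin s → Fin s → Fin s
          turn i l = shift i (lookup (proj₁ c) l)

          Located : Fin q → Set
          Located j = ∃₂ λ l p → A l p ≡ j

          -- The i-th new blow-up takes its w-cluster from coordinate turn i l of
          -- the l-th old family of rows, l = ψ i w; it is stored in the rows A i.
          source : ∀ j → Dec (Located j) → Fin s → Fin q × Fin s
          source j (yes (i , p , _)) w = A (ψ i w) p , turn i (ψ i w)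
          source j (no _)            w = j , w

          relabel : ∀ j → Dec (Located j) → ℕ
          relabel j (yes (i , p , _)) = suc (b + toℕ i)
          relabel j (no _)            = label j

          X′ : Fin q → Fin s → Fin n
          X′ j w = uncurry X (source j em w)

          label′ : Fin q → ℕ
          label′ j = relabel j em

          -- The box condition speaks about maps `Fin s → Fin M`; an element of `Fin M` supplies
          -- one.
          M-nonempty⇒ : Fin M → ∀ i → Injective _≡_ _≡_ (ψ i)
          M-nonempty⇒ p i = proj₁ (proj₂ (A-box λ _ → p) i)

          -- A source cell reveals where it went: its row gives l = ψ i w and p, its column t_l + i
          -- then gives i, and w follows since ψ i is injective. Rows outside the s families are not
          -- moved.
          source-inj : ∀ {j j′ w w′} d d′ → source j d w ≡ source j′ d′ w′ → j ≡ j′ × w ≡ w′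
          source-inj (no _) (no _) eq = ,-injectiveˡ eq , ,-injectiveʳ eq
          source-inj (yes (i , p , _)) (no ¬l) eq = ⊥-elim (¬l (_ , _ , ,-injectiveˡ eq))
          source-inj (no ¬l) (yes (i , p , _)) eq = ⊥-elim (¬l (_ , _ , sym (,-injectiveˡ eq)))
          source-inj {w = w} {w′} (yes (i , p , refl)) (yes (i′ , p′ , refl)) eq =
            cong₂ A i≡i′ p≡p′ , M-nonempty⇒ p i (trans ψ≡ (cong (λ i → ψ i w′) (sym i≡i′)))
            where
            ψ≡ = proj₁ (A-inj (,-injectiveˡ eq))
            p≡p′ = proj₂ (A-inj (,-injectiveˡ eq))
            i≡i′ : i ≡ i′
            i≡i′ = shift-injectiveˡ {t = lookup (proj₁ c) (ψ i w)}
              (trans (,-injectiveʳ eq) (cong (turn i′) (sym ψ≡)))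

          -- A group numbered below b has only lost rows, and what remains of a blow-up is still
          -- one. A group numbered b + i₀ draws its w-th vertex from family ψ i₀ w, so every mixed
          -- choice of its rows is a transversal of the box.
          complete′ : Complete X′ label′
          complete′ i f labelled = by-age (em {i < b})
            where
            old : i < b → ∀ j (d : Dec (Located j)) → relabel j d ≡ suc i → label j ≡ suc i × ∀ w →
                uncurry X (source j d w) ≡ X j w
            old i<b j (no _)             eq = eq , λ _ → refl
            old i<b j (yes (i₀ , p , _)) eq = ⊥-elim
                (<⇒≱ i<b (≤-trans (m≤m+n b _) (≤-reflexive (suc-injective eq))))
            new : ¬ i < b → ∀ j (d : Dec (Located j)) → relabel j d ≡ suc i →
              ∃₂ λ i₀ p → b + toℕ i₀ ≡ i × ∀ w → uncurry X (source j d w) ≡ X (A (ψ i₀ w) p)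
                  (turn i₀ (ψ i₀ w))
            new i≮b j (no _)             eq = ⊥-elim (i≮b (subst (_≤ b) eq (label≤b j)))
            new i≮b j (yes (i₀ , p , _)) eq = i₀ , p , suc-injective eq , λ _ → refl
            by-age : Dec (i < b) → Cyc (λ w → X′ (f w) w)
            by-age (yes i<b) = Cyc-cong (λ w → sym (proj₂ (old i<b (f w) em (labelled w)) w))
              (complete i f λ w → proj₁ (old i<b (f w) em (labelled w)))
            by-age (no i≮b) = Cyc-cong (λ w → sym (trans (proj₂ (proj₂ (proj₂ (found w))) w)
                (source≡ w))) (proj₂ (proj₂ (A-box g) i₀))
              where
              found : ∀ w → _
              found w = new i≮b (f w) em (labelled w)
              i₀ : Fin s
              i₀ = proj₁ (found zero)
              π : Fin s → Fin M
              π w = proj₁ (proj₂ (found w))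
              -- Inverts ψ i₀: family l contributes the row demanded by the cluster w with ψ i₀ w =
              -- l. The default is never reached at an argument of the form ψ i₀ w.
              pick : ∀ l → Dec (∃ λ w → ψ i₀ w ≡ l) → Fin M
              pick l (yes (w , _)) = π w
              pick l (no _)        = π zero
              g : Fin s → Fin M
              g l = pick l em
              pick-ψ : ∀ w d → pick (ψ i₀ w) d ≡ π w
              pick-ψ w (yes (w′ , eq)) = cong π (M-nonempty⇒ (π w) i₀ eq)
              pick-ψ w (no ¬h)         = ⊥-elim (¬h (w , refl))
              same : ∀ w → proj₁ (found w) ≡ i₀
              same w = Fin.toℕ-injective (+-cancelˡ-≡ b _ _
                  (trans (proj₁ (proj₂ (proj₂ (found w))))
                  (sym (proj₁ (proj₂ (proj₂ (found zero)))))))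
              source≡ : ∀ w → X (A (ψ (proj₁ (found w)) w) (π w))
                  (turn (proj₁ (found w)) (ψ (proj₁ (found w)) w))
                ≡ X (lookup (Vec.tabulate λ l → A l (g l)) (ψ i₀ w)) (turn i₀ (ψ i₀ w))
              source≡ w = trans (cong (λ i → X (A (ψ i w) (π w)) (turn i (ψ i w))) (same w))
                (cong (λ j → X j (turn i₀ (ψ i₀ w))) (sym
                    (trans (lookup∘tabulate (λ l → A l (g l)) (ψ i₀ w))
                    (cong (A (ψ i₀ w)) (pick-ψ w em)))))

          label′≤ : ∀ j (d : Dec (Located j)) → relabel j d ≤ b + s
          label′≤ j (no _)            = ≤-trans (label≤b j) (m≤m+n b s)
          label′≤ j (yes (i , _ , _)) = ≤-trans (≤-reflexive (sym (+-suc b (toℕ i))))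
              (+-monoʳ-≤ b (Fin.toℕ<n i))

          -- All rows of the families receive positive labels, and those of family 0 were free
          -- because a colour requires a free head. No row becomes free.
          fewer-virtual : virtual label′ + M ≤ virtual label
          fewer-virtual = begin
            virtual label′ + M
              ≡⟨ cong (virtual label′ +_) (trans (sym (*-identityʳ M))
                (trans (sym (∑-allFin-const M 1))
                   (trans (∑-cong (allFin M) λ p → sym (∑-point-1 q (A zero p)))
                       (∑-swap (allFin M) (allFin q) _)))) ⟩
            virtual label′ + ∑ (allFin q) (λ j → ∑ (allFin M) λ p → ι (j ≡ A zero p))
              ≡⟨ ∑-+ (allFin q) _ _ ⟨
            ∑ (allFin q) (λ j → ι (label′ j ≡ 0) + ∑ (allFin M) λ p → ι (j ≡ A zero p))
              ≤⟨ ∑-mono (allFin q) (λ j → ≤-trans (+-monoʳ-≤ _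
                (∑-ι-unique M (λ p → j ≡ A zero p) λ e e′ → proj₂ (A-inj (trans (sym e) e′))))
                (pointwise j em)) ⟩
            virtual label ∎
            where
            open ≤-Reasoning
            unlocated : ∀ j (d : Dec (Located j)) → relabel j d ≡ 0 → ¬ Located j × label j ≡ 0
            unlocated j (no ¬l) eq = ¬l , eq
            pointwise : ∀ j → Dec (∃ λ p → j ≡ A zero p) → ι (label′ j ≡ 0) + ι
                (∃ λ p → j ≡ A zero p) ≤ ι (label j ≡ 0)
            pointwise j (yes (p , refl)) = ≤-reflexive
                (trans (cong₂ _+_ (ι-no λ eq → proj₁ (unlocated j em eq) (zero , p , refl))
                (ι-yes (p , refl)))
              (sym (ι-yes (proj₁ (A-box λ _ → p)))))
            pointwise j (no ¬p) = ≤-trans (≤-reflexive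
                (trans (cong (ι (label′ j ≡ 0) +_) (ι-no ¬p)) (+-identityʳ _)))
                (ι-mono (proj₂ ∘ unlocated j em))

          replaced : State M
          replaced = record
            { X        = X′
            ; X-inj    = λ {j} {j′} eq → let p , r = X-inj eq in source-inj em em (cong₂ _,_ p r)
            ; label    = label′
            ; b        = b + s
            ; complete = complete′
            ; label≤b  = λ j → label′≤ j em
            ; budget   = begin
                (b + s) * M + s * virtual label′     ≡⟨ e₁ b s M (virtual label′) ⟩
                b * M + s * (virtual label′ + M)     ≤⟨ +-monoʳ-≤ (b * M)
                    (*-monoʳ-≤ s fewer-virtual) ⟩
                b * M + s * virtual label            ≤⟨ budget ⟩
                s * q                                ∎
            }
            where
            open ≤-Reasoning
            e₁ : ∀ b s m v → (b + s) * m + s * v ≡ b * m + s * (v + m)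
            e₁ = solve-∀

        augment : ∀ E → 0 < E → q ≤ E * virtual label →
          2 ^ (exponent X X-inj Free E * (2 + M) ^ s) * (s * M) ≤ q →
          ∃ λ (σ′ : State M) → virtual (State.label σ′) + M ≤ virtual label
        augment E 0<E q≤ room = let c , dense = monochromatic X X-inj Free E q≤
                                    A , A-inj , _ , A-box = box M s (exponent X X-inj Free E) []
                                        (Coloured X X-inj Free c) 0<q 0<exp dense room
                                in Replace.replaced c A A-inj A-box , Replace.fewer-virtual c A
                                    A-inj A-box
          where
          0<exp : 0 < exponent X X-inj Free E
          0<exp = *-mono-< (*-mono-< {0} {8} z<s 0<E)
              (*-mono-< (m^n>0 s s) (m^n>0 (s ^ s) {{m^n≢0 s s}} s))

      -- As long as at least q/E rows are free, `augment` uses up at least M > 0 of them; N is the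
      -- termination measure.
      saturate : ∀ {M} E → 0 < E → 0 < M → 2 ^ (8 * E * (s ^ s * (s ^ s) ^ s) * (2 + M) ^ s) *
          (s * M) ≤ q →
        ∀ N (σ : State M) → virtual (State.label σ) ≤ N → ∃ λ (σ′ : State M) → E * virtual
            (State.label σ′) ≤ q
      saturate {M} E 0<E 0<M room N σ v≤N = go N σ v≤N (≤-total q (E * virtual (State.label σ)))
        where
        Saturated : Set
        Saturated = ∃ λ (σ′ : State M) → E * virtual (State.label σ′) ≤ q
        go : ∀ N (σ : State M) → virtual (State.label σ) ≤ N →
          q ≤ E * virtual (State.label σ) ⊎ E * virtual (State.label σ) ≤ q → Saturated
        retry : ∀ N (σ : State M) → virtual (State.label σ) ≤ N →
          (∃ λ (σ′ : State M) → virtual (State.label σ′) + M ≤ virtual (State.label σ)) → Saturated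
        go N σ v≤N (inj₂ ≤q) = σ , ≤q
        go N σ v≤N (inj₁ q≤) = retry N σ v≤N (augment σ E 0<E q≤ room)
        retry zero    σ v≤N (σ′ , fewer) = ⊥-elim
            (n≮0 (≤-trans 0<M (≤-trans (m≤n+m _ _) (≤-trans fewer v≤N))))
        retry (suc N) σ v≤N (σ′ , fewer) = go N σ′
          (s≤s⁻¹ (≤-trans (≤-trans (≤-reflexive (+-comm 1 _)) (+-monoʳ-≤ _ 0<M))
              (≤-trans fewer v≤N)))
          (≤-total q (E * virtual (State.label σ′)))

  -- Cutting groups into blow-ups of equal size

  choose : ∀ {q} m (P : Fin q → Set) → m ≤ ∑ (allFin q) (ι ∘ P) →
    ∃ λ (a : Fin m → Fin q) → Injective _≡_ _≡_ a × ∀ p → P (a p)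
  choose zero    P _ = (λ ()) , (λ {}) , λ ()
  choose {q} (suc m) P m< = a , a-inj , a-P
    where
    open ≤-Reasoning
    found = ∑-pos (allFin q) (ι ∘ P) (≤-trans z<s m<)
    x = proj₁ found
    rest = choose m (λ j → P j × j ≢ x) (s≤s⁻¹ (begin
      suc m
        ≤⟨ m< ⟩
      ∑ (allFin q) (ι ∘ P)
        ≤⟨ ∑-mono (allFin q) (λ j → ι-⊎ (split j)) ⟩
      ∑ (allFin q) (λ j → ι (j ≡ x) + ι (P j × j ≢ x))
        ≡⟨ trans (∑-+ (allFin q) _ _) (cong (_+ ∑ (allFin q) (λ j → ι (P j × j ≢ x)))
          (∑-point-1 q x)) ⟩
      suc (∑ (allFin q) (λ j → ι (P j × j ≢ x))) ∎))
      where
      split : ∀ j → P j → j ≡ x ⊎ (P j × j ≢ x)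
      split j p with j Fin.≟ x
      ... | yes e = inj₁ e
      ... | no ne = inj₂ (p , ne)
    a : Fin (suc m) → Fin q
    a zero    = x
    a (suc i) = proj₁ rest i
    a-inj : Injective _≡_ _≡_ a
    a-inj {zero}  {zero}  eq = refl
    a-inj {zero}  {suc j} eq = ⊥-elim (proj₂ (proj₂ (proj₂ rest) j) (sym eq))
    a-inj {suc i} {zero}  eq = ⊥-elim (proj₂ (proj₂ (proj₂ rest) i) eq)
    a-inj {suc i} {suc j} eq = cong suc (proj₁ (proj₂ rest) eq)
    a-P : ∀ p → P (a p)
    a-P zero    = ι-pos (proj₂ found)
    a-P (suc i) = proj₁ (proj₂ (proj₂ rest) i)

  record Pieces {q} (label : Fin q → ℕ) (m b : ℕ) : Set where
    field
      t       : ℕ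
      piece   : Fin t → Fin m → Fin q
      inj     : Injective₂ piece
      uniform : ∀ i → ∃ λ c → ∀ p → label (piece i p) ≡ suc c

    Used : Fin q → Set
    Used j = ∃₂ λ i p → piece i p ≡ j

    field
      unused≤ : ∑ (allFin q) (λ j → ι (label j ≢ 0 × ¬ Used j)) ≤ b * m

  -- Sets of m rows are cut off while some class still has m. Afterwards each of the at most b
  -- classes keeps fewer than m rows. N bounds the depth of the recursion.
  cut : ∀ {q} m b → 0 < m → ∀ N (label : Fin q → ℕ) → (∀ j → label j ≤ b) →
    ∑ (allFin q) (λ j → ι (label j ≢ 0)) ≤ N → Pieces label m b
  cut {q} m b 0<m N label label≤b ≤N = by-size N ≤N em
    where
    open ≤-Reasoning
    class : ℕ → ℕ
    class c = ∑ (allFin q) (λ j → ι (label j ≡ suc c))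
    Big : Set
    Big = ∃ λ c → m ≤ class c
    by-size : ∀ N → ∑ (allFin q) (λ j → ι (label j ≢ 0)) ≤ N → Dec Big → Pieces label m b
    by-size N _ (no ¬big) = record
      { t = 0 ; piece = λ () ; inj = λ { {()} } ; uniform = λ ()
      ; unused≤ = begin
          ∑ (allFin q) (λ j → ι (label j ≢ 0 × ¬ _))
            ≤⟨ ∑-mono (allFin q) (λ j → labelled j (label j) refl) ⟩
          ∑ (allFin q) (λ j → ∑ (allFin b) λ c → ι (label j ≡ suc (toℕ c)))
            ≡⟨ ∑-swap (allFin q) (allFin b) _ ⟩
          ∑ (allFin b) (λ c → class (toℕ c))
            ≤⟨ ∑-mono (allFin b) (λ c → <⇒≤ (≰⇒> λ m≤ → ¬big (toℕ c , m≤))) ⟩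
          ∑ (allFin b) (λ _ → m)
            ≡⟨ ∑-allFin-const b m ⟩
          b * m ∎
      }
      where
      labelled : ∀ {A : Set} j l → label j ≡ l → ι (label j ≢ 0 × A) ≤ ∑ (allFin b) λ c → ι
          (label j ≡ suc (toℕ c))
      labelled j zero    eq = ≤-trans (≤-reflexive (ι-no λ h → proj₁ h eq)) z≤n
      labelled j (suc c) eq = ≤-trans (ι≤1 _) (≤-trans
          (≤-reflexive (sym (ι-yes {label j ≡ suc (toℕ c′)}
          (trans eq (cong suc (sym (Fin.toℕ-fromℕ< c<b)))))))
        (∑-∈ (λ c → ι (label j ≡ suc (toℕ c))) (∈-allFin c′)))
        where
        c<b = subst (_≤ b) eq (label≤b j)
        c′ = fromℕ< c<b
    by-size zero    ≤N (yes (c , m≤)) = ⊥-elim (n≮0 (≤-trans 0<m (≤-trans m≤ (≤-trans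
      (∑-mono (allFin q) λ j → ι-mono λ eq eq₀ → 0≢1+n (trans (sym eq₀) eq)) ≤N))))
    by-size (suc N) ≤N (yes (c , m≤)) = record
      { t       = suc (Pieces.t rest)
      ; piece   = piece′
      ; inj     = inj′
      ; uniform = λ { zero → c , proj₂ (proj₂ chosen) ; (suc i) → let c′ , h = Pieces.uniform rest i in
                      c′ , λ p → proj₂ (kept em (h p)) }
      ; unused≤ = ≤-trans (∑-mono (allFin q) λ j → ι-mono (unused j)) (Pieces.unused≤ rest)
      }
      where
      chosen = choose m (λ j → label j ≡ suc c) m≤
      a = proj₁ chosen
      Taken : Fin q → Set
      Taken j = ∃ λ p → a p ≡ j
      -- Rows cut off get label 0, so the recursive call neither uses them again nor counts them as
      -- waste.
      erase : ∀ j → Dec (Taken j) → ℕ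
      erase j (yes _) = 0
      erase j (no _)  = label j
      label′ : Fin q → ℕ
      label′ j = erase j em
      erase≤ : ∀ j d → erase j d ≤ b
      erase≤ j (yes _) = z≤n
      erase≤ j (no _)  = label≤b j
      kept : ∀ {j l} d → erase j d ≡ suc l → ¬ Taken j × label j ≡ suc l
      kept (no ¬t) eq = ¬t , eq
      smaller : ∑ (allFin q) (λ j → ι (label′ j ≢ 0)) ≤ N
      smaller = s≤s⁻¹ (begin
        suc (∑ (allFin q) (λ j → ι (label′ j ≢ 0)))
          ≡⟨ cong (_+ ∑ (allFin q) (λ j → ι (label′ j ≢ 0))) (∑-point-1 q (a p₀)) ⟨
        ∑ (allFin q) (λ j → ι (j ≡ a p₀)) + ∑ (allFin q) (λ j → ι (label′ j ≢ 0))
          ≡⟨ ∑-+ (allFin q) _ _ ⟨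
        ∑ (allFin q) (λ j → ι (j ≡ a p₀) + ι (label′ j ≢ 0))
          ≤⟨ ∑-mono (allFin q) (λ j → pointwise j (j Fin.≟ a p₀)) ⟩
        ∑ (allFin q) (λ j → ι (label j ≢ 0))
          ≤⟨ ≤N ⟩
        suc N ∎)
        where
        p₀ = fromℕ< 0<m
        erased : ∀ j d → Taken j → erase j d ≡ 0
        erased j (yes _) t = refl
        erased j (no ¬t) t = ⊥-elim (¬t t)
        nonzero : ∀ j d → erase j d ≢ 0 → label j ≢ 0
        nonzero j (yes _) h = ⊥-elim (h refl)
        nonzero j (no _)  h = h
        pointwise : ∀ j → Dec (j ≡ a p₀) → ι (j ≡ a p₀) + ι (label′ j ≢ 0) ≤ ι (label j ≢ 0)
        pointwise j (yes refl) = ≤-reflexive (trans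
            (cong₂ _+_ (ι-yes refl) (ι-no λ h → h (erased j em (p₀ , refl))))
          (sym (ι-yes λ eq → 0≢1+n (trans (sym eq) (proj₂ (proj₂ chosen) p₀)))))
        pointwise j (no ne) = subst (λ z → z + ι (label′ j ≢ 0) ≤ ι (label j ≢ 0)) (sym (ι-no ne))
            (ι-mono (nonzero j em))
      rest : Pieces label′ m b
      rest = cut m b 0<m N label′ (λ j → erase≤ j em) smaller
      piece′ : Fin (suc (Pieces.t rest)) → Fin m → Fin q
      piece′ zero    = a
      piece′ (suc i) = Pieces.piece rest i
      fresh : ∀ i p → ¬ Taken (Pieces.piece rest i p)
      fresh i p = proj₁ (kept em (proj₂ (Pieces.uniform rest i) p))
      inj′ : Injective₂ piece′
      inj′ {zero}  {zero}  eq = refl , proj₁ (proj₂ chosen) eq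
      inj′ {zero}  {suc i} {p} {p′} eq = ⊥-elim (fresh i p′ (p , eq))
      inj′ {suc i} {zero}  {p} {p′} eq = ⊥-elim (fresh i p (p′ , sym eq))
      inj′ {suc i} {suc i′} eq = let i≡ , p≡ = Pieces.inj rest eq in cong suc i≡ , p≡
      unused : ∀ j → label j ≢ 0 × ¬ (∃₂ λ i p → piece′ i p ≡ j) → label′ j ≢ 0 × ¬ Pieces.Used
          rest j
      unused j (l≢0 , ¬used) = nonzero em , λ (i , p , eq) → ¬used (suc i , p , eq)
        where
        nonzero : ∀ d → erase j d ≢ 0
        nonzero (yes (p , eq)) = ⊥-elim (¬used (zero , p , eq))
        nonzero (no _)         = l≢0

  -- From groups of rows to blow-ups of loose cycles

  module _ {k n ℓ s′ : ℕ} (H : KGraph k n) (order≡s : order k ℓ ≡ suc s′) where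

    private
      s = suc s′
      W = Hypergraph.V (looseCycle k ℓ)

    enum : Fin s ↔ W
    enum = subst (λ o → Fin o ↔ W) order≡s (vertices k ℓ)

    position : W → Fin s
    position = Inverse.from enum

    -- One bijection between coordinates and cycle vertices is fixed once and for all, so the tiling
    -- can treat loose cycles as an abstract predicate on s-tuples.
    Cyc : (Fin s → Fin n) → Set
    Cyc f = IsLooseCycle H ℓ (f ∘ position)

    IsLooseCycle-cong : ∀ {φ ψ : W → Fin n} → φ ≗ ψ → IsLooseCycle H ℓ φ → IsLooseCycle H ℓ ψ
    IsLooseCycle-cong φ≗ψ cyc e = let s , h , s⇔ = cyc e in s , h , λ v → mk⇔
      (λ v∈s → let x , x∈e , eq = Equivalence.to (s⇔ v) v∈s in x , x∈e , trans (sym (φ≗ψ x)) eq)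
      (λ (x , x∈e , eq) → Equivalence.from (s⇔ v) (x , x∈e , trans (φ≗ψ x) eq))

    Cyc-cong : ∀ {f g} → f ≗ g → Cyc f → Cyc g
    Cyc-cong f≗g = IsLooseCycle-cong (f≗g ∘ position)

    open Tiling {n} {n} {s′} Cyc Cyc-cong using (Good)

    spans⇒good : ∀ {x} → Spans H ℓ x → Good x
    spans⇒good {x} (_ , ψ , ψ-inj , cyc) = p ,
      (λ {i} {j} eq → trans (sym (Inverse.strictlyInverseʳ enum i)) (trans (cong position
        (ψ-inj (trans (sym (lookup∘tabulate (ψ ∘ Inverse.to enum) i))
            (trans eq (lookup∘tabulate (ψ ∘ Inverse.to enum) j)))))
        (Inverse.strictlyInverseʳ enum j))) ,
      IsLooseCycle-cong (λ w → cong (lookup x)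
          (sym (trans (lookup∘tabulate (ψ ∘ Inverse.to enum) (position w))
        (cong ψ (Inverse.strictlyInverseˡ enum w))))) cyc
      where
      p = Vec.tabulate (ψ ∘ Inverse.to enum)

    Covering : ℕ → ℕ → Set
    Covering m u = ∃ λ (t : ℕ) →
      Σ (Fin t → Copy (blowUp m (looseCycle k ℓ)) H) λ B →
      (∀ i j → i ≢ j → ∀ v → Copy.Covers (B i) v → ¬ Copy.Covers (B j) v) ×
      Σ (Subset n) λ U →
      (∀ v → v ∈ˢ U ⊎ ∃ λ i → Copy.Covers (B i) v) × card U ≤ u

    module _ {q M m : ℕ} (σ : Tiling.State {n} {q} {s′} Cyc Cyc-cong M)
      (pieces : Pieces (Tiling.State.label σ) m (Tiling.State.b σ)) where
      open Tiling {n} {q} {s′} Cyc Cyc-cong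
      open State σ
      open Pieces pieces

      blow-up : Fin t → Copy (blowUp m (looseCycle k ℓ)) H
      blow-up i = record
        { φ         = λ (w , p) → X (piece i p) (position w)
        ; injective = λ {(w , p)} {(w′ , p′)} eq → let e₁ , e₂ = X-inj eq in cong₂ _,_
            (trans (sym (Inverse.strictlyInverseˡ enum w))
                (trans (cong (Inverse.to enum) e₂) (Inverse.strictlyInverseˡ enum w′)))
            (proj₂ (inj e₁))
        ; edges     = λ (e , f) → let s , h , s⇔ = cyc f e in s , h , λ v → mk⇔
            (λ v∈s → let w , w∈e , eq = Equivalence.to (s⇔ v) v∈s in (w , f w) , (w∈e , refl) , eq)
            (λ { ((w , _) , (w∈e , refl) , eq) → Equivalence.from (s⇔ v) (w , w∈e , eq) })
        }
        where
        -- An edge of the blow-up comes with a choice f over all clusters, hence with one row for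
        -- each cycle vertex. These rows give a whole loose cycle, from which the edge is read off.
        cyc : (f : W → Fin m) → IsLooseCycle H ℓ (λ w → X (piece i (f w)) (position w))
        cyc f = IsLooseCycle-cong (λ w → cong (λ w′ → X (piece i (f w′)) (position w))
            (Inverse.strictlyInverseˡ enum w))
          (complete (proj₁ (uniform i)) (λ u → piece i (f (Inverse.to enum u)))
              (λ u → proj₂ (uniform i) _))

      Covered : Fin n → Set
      Covered v = ∃ λ i → Copy.Covers (blow-up i) v

      leftover : Subset n
      leftover = Vec.tabulate (λ v → isYes (em {¬ Covered v}))

      leftover⁻ : ∀ {v} → v ∈ˢ leftover → ¬ Covered v
      leftover⁻ {v} v∈ = decided em (trans (sym
          (lookup∘tabulate (λ v → isYes (em {¬ Covered v})) v)) ([]=⇒lookup v∈))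
        where
        decided : ∀ {P : Set} (d : Dec P) → isYes d ≡ inside → P
        decided (yes p) _ = p

      leftover⁺ : ∀ {v} → ¬ Covered v → v ∈ˢ leftover
      leftover⁺ {v} ¬c = lookup⇒[]= v leftover
          (trans (lookup∘tabulate (λ v → isYes (em {¬ Covered v})) v) (decided em ¬c))
        where
        decided : ∀ {P : Set} (d : Dec P) → P → isYes d ≡ inside
        decided (yes _) _ = refl
        decided (no ¬p) p = ⊥-elim (¬p p)

      -- Each row is used, free, or labelled but cut away, and used rows are covered entirely. The
      -- additive form avoids truncated subtraction.
      leftover≤ : card leftover + s * q ≤ n + s * (virtual label + b * m)
      leftover≤ = begin
        card leftover + s * q
          ≡⟨ cong (_+ s * q) (card-∑ leftover) ⟩
        ∑ (allFin n) (λ v → ι (v ∈ˢ leftover)) + s * q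
          ≤⟨ +-mono-≤ (∑-mono (allFin n) λ v → ι-mono leftover⁻) (*-monoʳ-≤ s rows) ⟩
        ∑ (allFin n) (λ v → ι (¬ Covered v)) + s * (used + (virtual label + b * m))
          ≡⟨ e₁ _ s used _ ⟩
        s * used + ∑ (allFin n) (λ v → ι (¬ Covered v)) + s * (virtual label + b * m)
          ≤⟨ +-monoˡ-≤ (s * (virtual label + b * m)) (+-monoˡ-≤ _ covered) ⟩
        ∑ (allFin n) (λ v → ι (Covered v)) + ∑ (allFin n) (λ v → ι (¬ Covered v)) + s *
            (virtual label + b * m)
          ≡⟨ cong (_+ s * (virtual label + b * m)) (trans (sym (∑-+ (allFin n) _ _))
               (trans (∑-cong (allFin n) λ v → ι-¬ (Covered v))
                   (trans (∑-allFin-const n 1) (*-identityʳ n)))) ⟩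
        n + s * (virtual label + b * m) ∎
        where
        open ≤-Reasoning
        used = ∑ (allFin q) (ι ∘ Used)
        e₁ : ∀ x s u y → x + s * (u + y) ≡ s * u + x + s * y
        e₁ = solve-∀
        row : ∀ j → 1 ≤ ι (Used j) + (ι (label j ≡ 0) + ι (label j ≢ 0 × ¬ Used j))
        row j with em {Used j} | em {label j ≡ 0}
        ... | yes u | _     = ≤-trans (≤-reflexive (sym (ι-yes u))) (m≤m+n _ _)
        ... | no _  | yes z = ≤-trans (≤-reflexive (sym (ι-yes z)))
            (≤-trans (m≤m+n _ (ι (label j ≢ 0 × ¬ Used j))) (m≤n+m _ (ι (Used j))))
        ... | no ¬u | no nz = ≤-trans (≤-reflexive (sym (ι-yes (nz , ¬u))))
            (≤-trans (m≤n+m _ (ι (label j ≡ 0))) (m≤n+m _ (ι (Used j))))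
        rows : q ≤ used + (virtual label + b * m)
        rows = begin
          q                                   ≡⟨ trans (sym (*-identityʳ q))
              (sym (∑-allFin-const q 1)) ⟩
          ∑ (allFin q) (λ _ → 1)              ≤⟨ ∑-mono (allFin q) row ⟩
          ∑ (allFin q) (λ j → ι (Used j) + (ι (label j ≡ 0) + ι (label j ≢ 0 × ¬ Used j)))
            ≡⟨ trans (∑-+ (allFin q) _ _) (cong (used +_) (∑-+ (allFin q) _ _)) ⟩
          used + (virtual label + ∑ (allFin q) (λ j → ι (label j ≢ 0 × ¬ Used j)))
            ≤⟨ +-monoʳ-≤ used (+-monoʳ-≤ (virtual label) unused≤) ⟩
          used + (virtual label + b * m)      ∎
        covered : s * used ≤ ∑ (allFin n) (λ v → ι (Covered v))
        covered = begin
          s * used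
            ≡⟨ ∑-*ˡ (allFin q) s _ ⟨
          ∑ (allFin q) (λ j → s * ι (Used j))
            ≡⟨ ∑-cong (allFin q) (λ j → ∑-allFin-const s (ι (Used j))) ⟨
          ∑ (allFin q) (λ j → ∑ (allFin s) λ u → ι (Used j))
            ≤⟨ ∑-mono (allFin q) (λ j → ∑-mono (allFin s) λ u → ι-mono λ (i , p , eq) →
                 i , (Inverse.to enum u , p) , cong₂ X eq (Inverse.strictlyInverseʳ enum u)) ⟩
          ∑ (allFin q) (λ j → ∑ (allFin s) λ u → ι (Covered (X j u)))
            ≤⟨ ∑-image₂ X X-inj (ι ∘ Covered) ⟩
          ∑ (allFin n) (λ v → ι (Covered v)) ∎

      covering : ∀ {u} → n + s * (virtual label + b * m) ≤ u + s * q → Covering m u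
      covering {u} ≤u = t , blow-up ,
        (λ { i i′ i≢i′ v ((w , p) , eq) ((w′ , p′) , eq′) → i≢i′
            (proj₁ (inj (proj₁ (X-inj (trans eq (sym eq′)))))) }) ,
        leftover , (λ v → classify v em) , +-cancelʳ-≤ (s * q) _ _ (≤-trans leftover≤ ≤u)
        where
        classify : ∀ v → Dec (Covered v) → v ∈ˢ leftover ⊎ Covered v
        classify v (yes c) = inj₂ c
        classify v (no ¬c) = inj₁ (leftover⁺ ¬c)

  -- The covering under explicit integer inequalities

  minDegree⇒dense : ∀ {k n} (H : KGraph k n) d w a (d≤k : d ≤ k) → 0 < n → k ≤ n → let j = k ∸ d in
    (5 + a) * (j * k) ≤ n → (5 + a) * ((n ∸ d) C j) ≤ w * minDegree d H → Inherit.Dense H d w a d≤k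
  minDegree⇒dense {k} {n} H d w a d≤k 0<n k≤n large deg y |y| = begin
    (4 + a) * n ^ j
      ≤⟨ *-cancelˡ-≤ n {{>-nonZero 0<n}} scaled ⟩
    (5 + a) * (n ∸ k) ^ j
      ≡⟨ cong (λ z → (5 + a) * z ^ j) (trans (cong (n ∸_) (sym (m+[n∸m]≡n d≤k)))
        (sym (∸-+-assoc n d j))) ⟩
    (5 + a) * (n ∸ d ∸ j) ^ j
      ≤⟨ *-monoʳ-≤ (5 + a) ([n∸k]^k≤k!*nCk (∸-monoˡ-≤ d k≤n)) ⟩
    (5 + a) * (j ! * ((n ∸ d) C j))
      ≡⟨ e₁ (5 + a) (j !) _ ⟩
    j ! * ((5 + a) * ((n ∸ d) C j))
      ≤⟨ *-monoʳ-≤ (j !) deg ⟩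
    j ! * (w * minDegree d H)
      ≤⟨ *-monoʳ-≤ (j !) (*-monoʳ-≤ w (minDegree≤degree d H (⊥ ⊕ y) |y|)) ⟩
    j ! * (w * degree H (⊥ ⊕ y))
      ≡⟨ e₁ (j !) w _ ⟩
    w * (j ! * degree H (⊥ ⊕ y))
      ≡⟨ cong (w *_) (j!*degree H j (⊥ ⊕ y) (trans (cong (_+ j) |y|) (m+[n∸m]≡n d≤k))) ⟨
    w * ∑ (vecs (allFin n) j) (λ z → ι (KGraph.Edge H ((⊥ ⊕ y) ⊕ z))) ∎
    where
    open ≤-Reasoning
    j = k ∸ d
    e₁ : ∀ x y z → x * (y * z) ≡ y * (x * z)
    e₁ = solve-∀
    jk≤n : j * k ≤ n
    jk≤n = ≤-trans (m≤m+n _ _) large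
    r = n ∸ j * k
    r+jk : r + j * k ≡ n
    r+jk = m∸n+n≡m jk≤n
    e₂ : ∀ a r x → (4 + a) * (r + x) + r ≡ (5 + a) * r + (4 + a) * x
    e₂ = solve-∀
    e₃ : ∀ a x → (5 + a) * x ≡ (4 + a) * x + x
    e₃ = solve-∀
    -- As r = n - jk, this says 1 - jk/n ≥ (4 + a)/(5 + a). By Bernoulli (n - k)^j / n^j is at least
    -- 1 - jk/n, so passing from binomials to powers costs one unit.
    most : (4 + a) * n ≤ (5 + a) * r
    most = +-cancelʳ-≤ r _ _ (begin
      (4 + a) * n + r                  ≡⟨ cong (λ z → (4 + a) * z + r) r+jk ⟨
      (4 + a) * (r + j * k) + r        ≡⟨ e₂ a r (j * k) ⟩
      (5 + a) * r + (4 + a) * (j * k)  ≤⟨ +-monoʳ-≤ ((5 + a) * r) jk≤r ⟩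
      (5 + a) * r + r                  ∎)
      where
      jk≤r : (4 + a) * (j * k) ≤ r
      jk≤r = +-cancelʳ-≤ (j * k) _ _ (≤-trans (≤-reflexive (sym (e₃ a (j * k))))
          (≤-trans large (≤-reflexive (sym r+jk))))
    scaled : n * ((4 + a) * n ^ j) ≤ n * ((5 + a) * (n ∸ k) ^ j)
    scaled = begin
      n * ((4 + a) * n ^ j)        ≡⟨ trans (e₁ n (4 + a) _) (sym (*-assoc (4 + a) n (n ^ j))) ⟩
      (4 + a) * n * n ^ j          ≤⟨ *-monoˡ-≤ (n ^ j) most ⟩
      (5 + a) * r * n ^ j          ≡⟨ *-assoc (5 + a) r (n ^ j) ⟩
      (5 + a) * (r * n ^ j)        ≤⟨ *-monoʳ-≤ (5 + a)
          (subst (λ z → r * z ^ j ≤ z * (n ∸ k) ^ j) (m∸n+n≡m k≤n)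
                                        (bernoulli-∸ (n ∸ k) k r j (trans r+jk (sym
                                            (m∸n+n≡m k≤n))))) ⟩
      (5 + a) * (n * (n ∸ k) ^ j)  ≡⟨ e₁ (5 + a) n _ ⟩
      n * ((5 + a) * (n ∸ k) ^ j)  ∎

  -- The waste consists of three parts of size at most n/(3E): at most s vertices outside the rows,
  -- the free rows left by `saturate`, and the sβm vertices lost by cutting β groups. The last part
  -- equals βM/(3E) for M = 3Esm, and βM ≤ sq by the budget.
  finite-covering : ∀ {k d ℓ s′ n} w a b E m q (H : KGraph k n) (d≤k : d ≤ k) (order≡s : order k ℓ ≡ suc s′) →
    let s = suc s′ ; j = k ∸ d ; c = 2 + a ; h = suc (c * (2 + c)) ; M = 3 * E * s * m in
    a < w → 0 < b → k ≤ s → Forces k d s w a →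
    c * (w * b * (j * (suc d + w * b * j))) ≤ s →
    8 * s * (s ^ d * (c * h ^ b)) ≤ suc h ^ b →
    0 < E → 0 < m → s * q ≤ n → n < s + s * q →
    0 < n → k ≤ n → (5 + a) * (j * k) ≤ n → 8 * s * (s′ * s) ≤ n → 3 * E * s ≤ n →
    0 < q → 2 * s′ ≤ suc q →
    2 ^ (8 * (3 * E) * (s ^ s * (s ^ s) ^ s) * (2 + M) ^ s) * (s * M) ≤ q →
    (5 + a) * ((n ∸ d) C j) ≤ w * minDegree d H →
    ∃ λ u → E * u ≤ n × Covering {ℓ = ℓ} H order≡s m u
  finite-covering {k} {d} {ℓ} {s′} {n} w a b E m q H d≤k order≡s
    a<w 0<b k≤s forces few decay 0<E 0<m sq≤n n<s+sq 0<n k≤n large₁ large₂ large₃ 0<q 2s′≤ room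
        deg =
    u , bound , covering {ℓ = ℓ} H order≡s σ
        (cut m β 0<m _ λ′ (State.label≤b σ) ≤-refl) (≤-reflexive (sym u+sq))
    where
    open ≤-Reasoning
    s = suc s′
    M = 3 * E * s * m
    CycH = Cyc {ℓ = ℓ} H order≡s
    open Tiling {n} {q} {s′} CycH (Cyc-cong {ℓ = ℓ} H order≡s)
    typical : ∀ v → 4 * s * ∑ (vecs (allFin n) s′) (λ y → ι (¬ Good (v ∷ y))) ≤ n ^ s′
    typical v = ≤-trans (*-monoʳ-≤ (4 * s) (∑-mono (vecs (allFin n) s′) λ y → ι-mono λ ¬g sp → ¬g
        (spans⇒good {ℓ = ℓ} H order≡s sp)))
      (Inherit.spans-typically H d w a d≤k s′ b ℓ order≡s 0<n a<w 0<b k≤s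
        (minDegree⇒dense H d w a d≤k 0<n k≤n large₁ deg) forces few decay large₂ v)
    n≤ : n ≤ s * suc q
    n≤ = ≤-trans (<⇒≤ n<s+sq) (≤-reflexive (sym (*-suc s q)))
    open Step typical (n^c≤2*s^c*q^c s′ n≤ 2s′≤) 0<q
    initial : State M
    initial = record
      { X        = λ j w → inject≤ (combine j w) (subst (_≤ n) (*-comm s q) sq≤n)
      ; X-inj    = λ {j} {j′} {w} {w′} eq → Fin.combine-injective j w j′ w′
          (Fin.inject≤-injective _ _ _ _ eq)
      ; label    = λ _ → 0
      ; b        = 0
      ; complete = λ { i f eq → ⊥-elim (0≢1+n (eq zero)) }
      ; label≤b  = λ _ → z≤n
      ; budget   = *-monoʳ-≤ s (≤-trans (∑-mono (allFin q) λ _ → ι≤1 _)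
          (≤-reflexive (trans (∑-allFin-const q 1) (*-identityʳ q))))
      }
    0<M : 0 < M
    0<M = *-mono-< (*-mono-< (*-mono-< {0} {3} z<s 0<E) z<s) 0<m
    final = saturate (3 * E) (*-mono-< {0} {3} z<s 0<E) 0<M room (virtual (State.label initial))
        initial ≤-refl
    σ = proj₁ final
    λ′ = State.label σ
    β = State.b σ
    V = virtual λ′
    W = s * (V + β * m)
    u = n + W ∸ s * q
    u+sq : u + s * q ≡ n + W
    u+sq = m∸n+n≡m (≤-trans sq≤n (m≤m+n n W))
    e₁ : ∀ e s v x → 3 * e * (s * (v + x)) ≡ s * (3 * e * v) + 3 * e * s * x
    e₁ = solve-∀
    e₂ : ∀ b e s m → 3 * e * s * (b * m) ≡ b * (3 * e * s * m)
    e₂ = solve-∀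
    e₃ : ∀ e u → 3 * (e * u) ≡ 3 * e * u
    e₃ = solve-∀
    e₄ : ∀ n → n + (n + n) ≡ 3 * n
    e₄ = solve-∀
    waste : 3 * E * W ≤ n + n
    waste = begin
      3 * E * W                                ≡⟨ e₁ E s V (β * m) ⟩
      s * (3 * E * V) + 3 * E * s * (β * m)    ≡⟨ cong (s * (3 * E * V) +_) (e₂ β E s m) ⟩
      s * (3 * E * V) + β * M                  ≤⟨ +-mono-≤ (*-monoʳ-≤ s (proj₂ final))
          (≤-trans (m≤m+n _ _) (State.budget σ)) ⟩
      s * q + s * q                            ≤⟨ +-mono-≤ sq≤n sq≤n ⟩
      n + n                                    ∎
    bound : E * u ≤ n
    bound = *-cancelˡ-≤ 3 (begin
      3 * (E * u)          ≡⟨ e₃ E u ⟩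
      3 * E * u            ≤⟨ *-monoʳ-≤ (3 * E) u≤ ⟩
      3 * E * (s + W)      ≡⟨ *-distribˡ-+ (3 * E) s W ⟩
      3 * E * s + 3 * E * W ≤⟨ +-mono-≤ large₃ waste ⟩
      n + (n + n)          ≡⟨ e₄ n ⟩
      3 * n                ∎)
      where
      e₅ : ∀ s x y → s + x + y ≡ s + y + x
      e₅ = solve-∀
      u≤ : u ≤ s + W
      u≤ = +-cancelʳ-≤ (s * q) u (s + W) (begin
        u + s * q        ≡⟨ u+sq ⟩
        n + W            ≤⟨ +-monoˡ-≤ W (<⇒≤ n<s+sq) ⟩
        s + s * q + W    ≡⟨ e₅ s (s * q) W ⟩
        s + W + s * q    ∎)

module Reals where

  open import Data.Nat.Base as ℕ using (ℕ; zero; suc; _!; z≤n; s≤s)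
  import Data.Nat.Properties as ℕ
  open import Data.Integer.Base as ℤ using (ℤ; +_; -[1+_]; ∣_∣)
  import Data.Integer.Properties as ℤ
  open import Data.Rational.Base as ℚ using
      (ℚ; mkℚ; 0ℚ; 1ℚ; ½; _/_; _+_; _*_; _-_; -_; _<_; _≤_; ↥_; ↧ₙ_; nonNegative; positive)
  import Data.Rational.Properties as ℚ
  import Data.Rational.Unnormalised.Base as ℚᵘ
  import Data.Rational.Unnormalised.Properties as ℚᵘ
  open import Algebra.Definitions.RawSemiring ℚ.+-*-rawSemiring using (_^_)
  open import Algebra.Bundles using (CommutativeRing)
  open import Algebra.Properties.Semiring.Exp (CommutativeRing.semiring ℚ.+-*-commutativeRing)
      using (^-assocʳ)
  open import Relation.Binary.Definitions using (tri<; tri≈; tri>)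
  open ℝ using (_∋_)
  open Finite using (^-distribʳ-*)

  -- Naturals as rationals, powers and cuts

  ν : ℕ → ℚ
  ν n = + n / 1

  private
    toℚᵘ-/ : ∀ i d → ℚ.toℚᵘ (i / suc d) ℚᵘ.≃ ℚᵘ.mkℚᵘ i d
    toℚᵘ-/ i d = ℚ.toℚᵘ-fromℚᵘ (ℚᵘ.mkℚᵘ i d)

  ν-+ : ∀ m n → ν (m ℕ.+ n) ≡ ν m + ν n
  ν-+ m n = ℚ.toℚᵘ-injective (ℚᵘ.≃-trans (toℚᵘ-/ (+ (m ℕ.+ n)) 0)
      (ℚᵘ.≃-sym (ℚᵘ.≃-trans (ℚ.toℚᵘ-homo-+ (ν m) (ν n))
    (ℚᵘ.≃-trans (ℚᵘ.+-cong (toℚᵘ-/ (+ m) 0) (toℚᵘ-/ (+ n) 0))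
      (ℚᵘ.*≡* (cong (ℤ._* + 1) (cong₂ ℤ._+_ (ℤ.*-identityʳ (+ m)) (ℤ.*-identityʳ (+ n)))))))))

  ν-* : ∀ m n → ν (m ℕ.* n) ≡ ν m * ν n
  ν-* m n = ℚ.toℚᵘ-injective (ℚᵘ.≃-trans (toℚᵘ-/ (+ (m ℕ.* n)) 0)
      (ℚᵘ.≃-sym (ℚᵘ.≃-trans (ℚ.toℚᵘ-homo-* (ν m) (ν n))
    (ℚᵘ.≃-trans (ℚᵘ.*-cong (toℚᵘ-/ (+ m) 0) (toℚᵘ-/ (+ n) 0))
      (ℚᵘ.*≡* (cong (ℤ._* + 1) (sym (ℤ.pos-* m n))))))))

  /*ν : ∀ a b → (+ a / suc b) * ν (suc b) ≡ ν a
  /*ν a b = ℚ.toℚᵘ-injective (ℚᵘ.≃-trans (ℚ.toℚᵘ-homo-* (+ a / suc b) (ν (suc b)))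
    (ℚᵘ.≃-trans (ℚᵘ.*-cong (toℚᵘ-/ (+ a) b) (toℚᵘ-/ (+ suc b) 0)) (ℚᵘ.≃-trans
      (ℚᵘ.*≡* (trans (ℤ.*-identityʳ _) (cong (+ a ℤ.*_) (sym (ℤ.*-identityʳ (+ suc b))))))
          (ℚᵘ.≃-sym (toℚᵘ-/ (+ a) 0)))))

  ν-mono-≤ : ∀ {m n} → m ℕ.≤ n → ν m ≤ ν n
  ν-mono-≤ {m} {n} m≤n = ℚ.toℚᵘ-cancel-≤ (ℚᵘ.≤-respˡ-≃ (ℚᵘ.≃-sym (toℚᵘ-/ (+ m) 0))
      (ℚᵘ.≤-respʳ-≃ (ℚᵘ.≃-sym (toℚᵘ-/ (+ n) 0))
    (ℚᵘ.*≤* (ℤ.*-monoʳ-≤-nonNeg (+ 1) (ℤ.+≤+ m≤n)))))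

  ν-mono-< : ∀ {m n} → m ℕ.< n → ν m < ν n
  ν-mono-< {m} {n} m<n = ℚ.toℚᵘ-cancel-< (ℚᵘ.<-respˡ-≃ (ℚᵘ.≃-sym (toℚᵘ-/ (+ m) 0))
      (ℚᵘ.<-respʳ-≃ (ℚᵘ.≃-sym (toℚᵘ-/ (+ n) 0))
    (ℚᵘ.*<* (ℤ.*-monoʳ-<-pos (+ 1) (ℤ.+<+ m<n)))))

  ν-cancel-≤ : ∀ {m n} → ν m ≤ ν n → m ℕ.≤ n
  ν-cancel-≤ {m} {n} h = ℕ.≮⇒≥ λ n<m → ℚ.<-irrefl refl (ℚ.≤-<-trans h (ν-mono-< n<m))

  0≤ν : ∀ n → 0ℚ ≤ ν n
  0≤ν n = ν-mono-≤ {0} {n} z≤n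

  ν-^ : ∀ m n → ν (m ℕ.^ n) ≡ ν m ^ n
  ν-^ m zero    = refl
  ν-^ m (suc n) = trans (ν-* m (m ℕ.^ n)) (cong (ν m *_) (ν-^ m n))

  *-monoˡ-≤ : ∀ {p q} r → 0ℚ ≤ r → p ≤ q → p * r ≤ q * r
  *-monoˡ-≤ r 0≤r = ℚ.*-monoʳ-≤-nonNeg r {{nonNegative 0≤r}}

  *-monoʳ-≤ : ∀ {p q} r → 0ℚ ≤ r → p ≤ q → r * p ≤ r * q
  *-monoʳ-≤ r 0≤r = ℚ.*-monoˡ-≤-nonNeg r {{nonNegative 0≤r}}

  *-cancelʳ-≤ : ∀ {p q} r → 0ℚ < r → p * r ≤ q * r → p ≤ q
  *-cancelʳ-≤ r 0<r = ℚ.*-cancelʳ-≤-pos r {{positive 0<r}}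

  *-cancelʳ-< : ∀ {p q} r → 0ℚ ≤ r → p * r < q * r → p < q
  *-cancelʳ-< r 0≤r = ℚ.*-cancelʳ-<-nonNeg r {{nonNegative 0≤r}}

  *-nonNeg : ∀ {p q} → 0ℚ ≤ p → 0ℚ ≤ q → 0ℚ ≤ p * q
  *-nonNeg {p} {q} 0≤p 0≤q = subst (_≤ p * q) (ℚ.*-zeroˡ q) (*-monoˡ-≤ q 0≤q 0≤p)

  ^-nonNegative : ∀ {x} → 0ℚ ≤ x → ∀ n → 0ℚ ≤ x ^ n
  ^-nonNegative 0≤x zero    = 0≤ν 1
  ^-nonNegative 0≤x (suc n) = *-nonNeg 0≤x (^-nonNegative 0≤x n)

  ^-mono-≤ : ∀ {x y} → 0ℚ ≤ x → x ≤ y → ∀ n → x ^ n ≤ y ^ n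
  ^-mono-≤         0≤x x≤y zero    = ℚ.≤-refl
  ^-mono-≤ {x} {y} 0≤x x≤y (suc n) = ℚ.≤-trans (*-monoˡ-≤ (x ^ n) (^-nonNegative 0≤x n) x≤y)
    (*-monoʳ-≤ y (ℚ.≤-trans 0≤x x≤y) (^-mono-≤ 0≤x x≤y n))

  ^-cancel-≤ : ∀ {x y} → 0ℚ ≤ y → ∀ n → x ^ suc n ≤ y ^ suc n → x ≤ y
  ^-cancel-≤ {x} {y} 0≤y n h = ℚ.≮⇒≥ λ y<x → ℚ.<-irrefl refl (ℚ.<-≤-trans (strict y<x n) h)
    where
    strict : y < x → ∀ n → y ^ suc n < x ^ suc n
    strict y<x zero    = subst₂ _<_ (sym (ℚ.*-identityʳ y)) (sym (ℚ.*-identityʳ x)) y<x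
    strict y<x (suc n) = ℚ.≤-<-trans (*-monoʳ-≤ y 0≤y (ℚ.<⇒≤ (strict y<x n)))
      (ℚ.*-monoˡ-<-pos (x ^ suc n) {{positive (ℚ.≤-<-trans (^-nonNegative 0≤y (suc n))
          (strict y<x n))}} y<x)

  1≤^ : ∀ {x} → 1ℚ ≤ x → ∀ n → 1ℚ ≤ x ^ n
  1≤^     1≤x zero    = ℚ.≤-refl
  1≤^ {x} 1≤x (suc n) = ℚ.≤-trans 1≤x (subst (_≤ x * x ^ n) (ℚ.*-identityʳ x)
      (*-monoʳ-≤ x (ℚ.≤-trans (0≤ν 1) 1≤x) (1≤^ 1≤x n)))

  ^-monoʳ-≤ : ∀ {x} → 1ℚ ≤ x → ∀ {m n} → m ℕ.≤ n → x ^ m ≤ x ^ n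
  ^-monoʳ-≤     1≤x {n = n} z≤n       = 1≤^ 1≤x n
  ^-monoʳ-≤ {x} 1≤x         (s≤s m≤n) = *-monoʳ-≤ x (ℚ.≤-trans (0≤ν 1) 1≤x) (^-monoʳ-≤ 1≤x m≤n)

  ≤-numerator : ∀ q → q ≤ ν ∣ ↥ q ∣
  ≤-numerator q@(mkℚ (+ a) d _)      = ℚ.toℚᵘ-cancel-≤ (ℚᵘ.≤-respʳ-≃ (ℚᵘ.≃-sym (toℚᵘ-/ (+ a) 0))
    (ℚᵘ.*≤* (ℤ.*-monoˡ-≤-nonNeg (+ a) (ℤ.+≤+ (s≤s z≤n)))))
  ≤-numerator q@(mkℚ (-[1+ a ]) d _) = ℚ.≤-trans (ℚ.<⇒≤ (ℚ.negative⁻¹ q)) (0≤ν (suc a))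

  *-denominator : ∀ q → 0ℚ ≤ q → q * ν (↧ₙ q) ≡ ν ∣ ↥ q ∣
  *-denominator q@(mkℚ (+ a) d _)      0≤q = trans (cong (_* ν (suc d)) (sym (ℚ.↥p/↧p≡p q)))
      (/*ν a d)
  *-denominator q@(mkℚ (-[1+ a ]) d _) 0≤q = ⊥-elim
      (ℚ.<-irrefl refl (ℚ.≤-<-trans 0≤q (ℚ.negative⁻¹ q)))

  1≤*-denominator : ∀ {q} → 0ℚ < q → 1ℚ ≤ q * ν (↧ₙ q)
  1≤*-denominator {q@(mkℚ (+ zero) d _)}    0<q = ⊥-elim (ℚ.<-irrefl (sym (ℚ.↥p≡0⇒p≡0 q refl)) 0<q)
  1≤*-denominator {q@(mkℚ (+ suc a) d _)}   0<q = subst (1ℚ ≤_) (sym (*-denominator q (ℚ.<⇒≤ 0<q)))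
      (ν-mono-≤ {1} {suc a} (s≤s z≤n))
  1≤*-denominator {q@(mkℚ (-[1+ a ]) d _)}  0<q = ⊥-elim (ℚ.<-asym 0<q (ℚ.negative⁻¹ q))

  <ℝ⇒∋pos : ∀ {x} → fromℕ 0 <ℝ x → ∃ λ r → 0ℚ < r × x ∋ r
  <ℝ⇒∋pos {x} (q , q≮0 , x∋q) = let r , q<r , x∋r = ℝ.open-up x x∋q in r , ℚ.≤-<-trans (ℚ.≮⇒≥ q≮0) q<r , x∋r

  ∋-≤ : ∀ (x : ℝ) {p q} → p ≤ q → x ∋ q → x ∋ p
  ∋-≤ x {p} {q} p≤q x∋q with ℚ.<-cmp p q
  ... | tri< p<q _ _  = ℝ.downward x p<q x∋q
  ... | tri≈ _ refl _ = x∋q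
  ... | tri> _ _ q<p  = ⊥-elim (ℚ.<-irrefl refl (ℚ.<-≤-trans q<p p≤q))

  -- Multiples of a cut are iterated sums, so density of the rationals is used to split a number
  -- below (n + 1)ρ into ρ and a remainder below nρ.
  ·∋ : ∀ n (x : ℝ) {ρ} → x ∋ ρ → ∀ {z} → z < ν n * ρ → (n · x) ∋ z
  ·∋ zero    x {ρ} x∋ρ {z} z< = subst (z <_) (ℚ.*-zeroˡ ρ) z<
  ·∋ (suc n) x {ρ} x∋ρ {z} z< = ρ , s , x∋ρ , ·∋ n x x∋ρ s<nρ , subst (_< ρ + s) (cancel ρ z)
      (ℚ.+-monoʳ-< ρ z-ρ<s)
    where
    cancel : ∀ ρ z → ρ + (- ρ + z) ≡ z
    cancel ρ z = trans (sym (ℚ.+-assoc ρ (- ρ) z))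
        (trans (cong (_+ z) (ℚ.+-inverseʳ ρ)) (ℚ.+-identityˡ z))
    cancel′ : ∀ ρ z → - ρ + (ρ + z) ≡ z
    cancel′ ρ z = trans (sym (ℚ.+-assoc (- ρ) ρ z))
        (trans (cong (_+ z) (ℚ.+-inverseˡ ρ)) (ℚ.+-identityˡ z))
    expand : ν (suc n) * ρ ≡ ρ + ν n * ρ
    expand = trans (cong (_* ρ) (ν-+ 1 n)) (trans (ℚ.*-distribʳ-+ ρ 1ℚ (ν n))
        (cong (_+ ν n * ρ) (ℚ.*-identityˡ ρ)))
    between = ℚ.<-dense (subst (- ρ + z <_) (cancel′ ρ (ν n * ρ))
        (ℚ.+-monoʳ-< (- ρ) (subst (z <_) expand z<)))
    s = proj₁ between
    z-ρ<s = proj₁ (proj₂ between)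
    s<nρ = proj₂ (proj₂ between)

  -- The exponential series and the size of n in terms of m

  inverse! : ℕ → ℚ
  inverse! n = _/_ (+ 1) (n !) {{ℕ._!≢0 n}}

  inverse!*! : ∀ n → inverse! n * ν (n !) ≡ 1ℚ
  inverse!*! n with n ! | ℕ._!≢0 n
  ... | suc d | _ = /*ν 1 d

  0≤inverse! : ∀ n → 0ℚ ≤ inverse! n
  0≤inverse! n = *-cancelʳ-≤ (ν (n !)) (ν-mono-< (ℕ.1≤n! n))
    (subst₂ _≤_ (sym (ℚ.*-zeroˡ (ν (n !)))) (sym (inverse!*! n)) (0≤ν 1))

  inverse!≤1 : ∀ n → inverse! n ≤ 1ℚ
  inverse!≤1 n = subst₂ _≤_ (ℚ.*-identityʳ (inverse! n)) (inverse!*! n)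
    (*-monoʳ-≤ (inverse! n) (0≤inverse! n) (ν-mono-≤ (ℕ.1≤n! n)))

  0≤expSum : ∀ N {y} → 0ℚ ≤ y → 0ℚ ≤ expSum N y
  0≤expSum zero    0≤y = 0≤ν 1
  0≤expSum (suc N) {y} 0≤y = ℚ.+-mono-≤ (0≤expSum N 0≤y)
      (*-nonNeg (^-nonNegative 0≤y (suc N)) (0≤inverse! (suc N)))

  n!≤m^n : ∀ {n m} → n ℕ.≤ m → n ! ℕ.≤ m ℕ.^ n
  n!≤m^n {zero}  _   = ℕ.≤-refl
  n!≤m^n {suc n} n<m = ℕ.*-mono-≤ n<m (n!≤m^n (ℕ.<⇒≤ n<m))

  -- e^A ≥ A^x / x! ≥ 2^x for x ≤ A / 2.
  log∋⇒2^≤ : ∀ n {q A} x → 1 ℕ.≤ n → log n ∋ q → ν A ≤ q → 2 ℕ.* x ℕ.≤ A → 2 ℕ.^ x ℕ.≤ n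
  log∋⇒2^≤ n zero 1≤n _ _ _ = 1≤n
  log∋⇒2^≤ n {A = A} (suc x′) 1≤n (inj₁ q<0) A≤q _ = ⊥-elim
      (ℚ.<-irrefl refl (ℚ.≤-<-trans (ℚ.≤-trans (0≤ν A) A≤q) q<0))
  log∋⇒2^≤ n {A = A} x@(suc x′) 1≤n (inj₂ (y , (0≤y , exp≤) , q<y)) A≤q 2x≤A =
    ℕ.*-cancelʳ-≤ (2 ℕ.^ x) n (x ℕ.^ x) {{ℕ.m^n≢0 x x}} (begin
      2 ℕ.^ x ℕ.* x ℕ.^ x   ≡⟨ ^-distribʳ-* x 2 x ⟨
      (2 ℕ.* x) ℕ.^ x       ≤⟨ ℕ.^-monoˡ-≤ x 2x≤A ⟩
      A ℕ.^ x               ≤⟨ ν-cancel-≤ rational ⟩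
      n ℕ.* x !             ≤⟨ ℕ.*-monoʳ-≤ n (n!≤m^n {x} {x} ℕ.≤-refl) ⟩
      n ℕ.* x ℕ.^ x         ∎)
    where
    open ℕ.≤-Reasoning
    term≤ : y ^ x * inverse! x ≤ ν n
    term≤ = ℚ.≤-trans (subst (_≤ expSum x y) (ℚ.+-identityˡ _)
        (ℚ.+-monoˡ-≤ (y ^ x * inverse! x) (0≤expSum x′ 0≤y))) (exp≤ x)
    rational : ν (A ℕ.^ x) ≤ ν (n ℕ.* x !)
    rational = subst₂ _≤_ (sym (ν-^ A x)) (sym (ν-* n (x !)))
        (ℚ.≤-trans (^-mono-≤ (0≤ν A) (ℚ.≤-trans A≤q (ℚ.<⇒≤ q<y)) x)
      (subst (_≤ ν n * ν (x !)) (trans (ℚ.*-assoc (y ^ x) (inverse! x) (ν (x !)))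
          (trans (cong (y ^ x *_) (inverse!*! x)) (ℚ.*-identityʳ (y ^ x))))
        (*-monoˡ-≤ (ν (x !)) (0≤ν (x !)) term≤)))

  -- Rounding gives u < (log n)^c, so some y > u satisfies y ≤ s^t with s < log n and t < 1/K.
  -- Writing t = p/q, Kp ≤ q turns y^q ≤ s^p into y^K ≤ s, hence u^K < log n.
  rounds⇒2^≤ : ∀ n c K′ u x → 1 ℕ.≤ n → c ≤ℝ fromℚ (+ 1 / suc K′) → (log n ^ℝ c) RoundsTo suc u → 1
      ℕ.≤ u →
    2 ℕ.* x ℕ.≤ u ℕ.^ suc K′ → 2 ℕ.^ x ℕ.≤ n
  rounds⇒2^≤ n c K′ u x 1≤n c≤ (_ , q , q≮ , r , r′ , L∋r , r′<1 , q<) 1≤u 2x≤ = conclude L∋r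
    where
    K = suc K′
    u<r : ν u < r
    u<r = subst₂ _<_ (cancel u) (ℚ.+-identityʳ r)
        (ℚ.<-≤-trans (ℚ.+-monoˡ-< (- 1ℚ) (ℚ.≤-<-trans (ℚ.≮⇒≥ q≮)
        (ℚ.<-trans q< (ℚ.+-monoʳ-< r r′<1))))
      (ℚ.≤-reflexive (trans (ℚ.+-assoc r 1ℚ (- 1ℚ)) refl)))
      where
      cancel : ∀ u → ν (suc u) + - 1ℚ ≡ ν u
      cancel u = trans (cong (_+ - 1ℚ) (trans (ν-+ 1 u) (ℚ.+-comm 1ℚ (ν u))))
          (trans (ℚ.+-assoc (ν u) 1ℚ (- 1ℚ)) (ℚ.+-identityʳ (ν u)))
    conclude : (log n ^ℝ c) ∋ r → 2 ℕ.^ x ℕ.≤ n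
    conclude (inj₁ r<0) = ⊥-elim (ℚ.<-irrefl refl (ℚ.≤-<-trans (0≤ν u) (ℚ.<-trans u<r r<0)))
    conclude (inj₂ (y , (0≤y , s , t , 0<s , log∋s , 0≤t , c∋t , y^≤s^) , r<y)) = by-numerator ∣ ↥
        t ∣ refl
      where
      u<y : ν u < y
      u<y = ℚ.<-trans u<r r<y
      1<y : 1ℚ < y
      1<y = ℚ.≤-<-trans (ν-mono-≤ 1≤u) u<y
      by-numerator : ∀ p → ∣ ↥ t ∣ ≡ p → 2 ℕ.^ x ℕ.≤ n
      -- For t = 0 the bound would read y^q ≤ 1, although y > u ≥ 1.
      by-numerator zero    eq = ⊥-elim (ℚ.<-irrefl refl (ℚ.<-≤-trans 1<y (ℚ.≤-trans
        (subst (_≤ y ^ ↧ₙ t) (ℚ.*-identityʳ y) (^-monoʳ-≤ (ℚ.<⇒≤ 1<y) {1} {↧ₙ t} (s≤s z≤n)))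
        (subst (λ p → y ^ ↧ₙ t ≤ s ^ p) eq y^≤s^))))
      by-numerator p@(suc p′) eq = log∋⇒2^≤ n x 1≤n log∋s u^K≤s 2x≤
        where
        Kp≤ : K ℕ.* p ℕ.≤ ↧ₙ t
        Kp≤ = ν-cancel-≤ (subst₂ _≤_
          (trans (cong (ν K *_) (trans (*-denominator t 0≤t) (cong ν eq))) (sym (ν-* K p)))
          (trans (sym (ℚ.*-assoc (ν K) (+ 1 / K) (ν (↧ₙ t))))
              (trans (cong (_* ν (↧ₙ t)) (trans (ℚ.*-comm (ν K) (+ 1 / K)) (/*ν 1 K′)))
              (ℚ.*-identityˡ (ν (↧ₙ t)))))
          (*-monoʳ-≤ (ν K) (0≤ν K) (*-monoˡ-≤ (ν (↧ₙ t)) (0≤ν (↧ₙ t)) (ℚ.<⇒≤ (c≤ c∋t)))))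
        y^K≤s : y ^ K ≤ s
        y^K≤s = ^-cancel-≤ (ℚ.<⇒≤ 0<s) p′ (subst (_≤ s ^ p) (sym (^-assocʳ y K p))
          (ℚ.≤-trans (^-monoʳ-≤ (ℚ.<⇒≤ 1<y) Kp≤) (subst (λ p → y ^ ↧ₙ t ≤ s ^ p) eq y^≤s^)))
        u^K≤s : ν (u ℕ.^ K) ≤ s
        u^K≤s = ℚ.≤-trans (ℚ.≤-reflexive (ν-^ u K))
            (ℚ.≤-trans (^-mono-≤ (0≤ν u) (ℚ.<⇒≤ u<y) K) y^K≤s)

  -- Comparison with the geometric series, whose remainder ½^N is carried along so that the
  -- induction closes. It shows that log 2 is at least ½.
  expSum-½ : ∀ N → expSum N ½ + ½ ^ N ≤ ν 2
  expSum-½ zero    = ℚ.≤-refl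
  expSum-½ (suc N) = begin
    expSum N ½ + h * inverse! (suc N) + h
      ≤⟨ ℚ.+-monoˡ-≤ h (ℚ.+-monoʳ-≤ (expSum N ½)
        (ℚ.≤-trans (*-monoʳ-≤ h 0≤h (inverse!≤1 (suc N))) (ℚ.≤-reflexive (ℚ.*-identityʳ h)))) ⟩
    expSum N ½ + h + h
      ≡⟨ ℚ.+-assoc (expSum N ½) h h ⟩
    expSum N ½ + (h + h)
      ≡⟨ cong (λ z → expSum N ½ + z) (trans (sym (ℚ.*-distribʳ-+ (½ ^ N) ½ ½))
        (ℚ.*-identityˡ (½ ^ N))) ⟩
    expSum N ½ + ½ ^ N
      ≤⟨ expSum-½ N ⟩
    ν 2 ∎
    where
    open ℚ.≤-Reasoning
    h = ½ ^ suc N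
    0≤½ : 0ℚ ≤ ½
    0≤½ = ℚ.nonNegative⁻¹ ½
    0≤h : 0ℚ ≤ h
    0≤h = ^-nonNegative 0≤½ (suc N)

  -- Rounding to 0 would require (log n)^c < 1. But log n > 0 for n ≥ 2, and the supremum defining
  -- the power admits the exponent t = 0, so s^0 = 1 is a member.
  rounds⇒pos : ∀ n c m → 2 ℕ.≤ n → fromℕ 0 <ℝ c → (log n ^ℝ c) RoundsTo m → 1 ℕ.≤ m
  rounds⇒pos n c (suc m) 2≤n 0<c _ = s≤s z≤n
  rounds⇒pos n c zero    2≤n 0<c ((q , L∌q , q<1) , _) = ⊥-elim
      (L∌q (inj₂ (1ℚ , (0≤ν 1 , s , 0ℚ , 0<s , log∋s , ℚ.≤-refl , c∋0 , ℚ.≤-refl) , q<1)))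
    where
    between = ℚ.<-dense (ℚ.positive⁻¹ ½)
    s = proj₁ between
    0<s = proj₁ (proj₂ between)
    log∋s : log n ∋ s
    log∋s = inj₂ (½ , (ℚ.nonNegative⁻¹ ½ , λ N → ℚ.≤-trans
      (subst (_≤ expSum N ½ + ½ ^ N) (ℚ.+-identityʳ (expSum N ½))
          (ℚ.+-monoʳ-≤ (expSum N ½) (^-nonNegative {½} (ℚ.nonNegative⁻¹ ½) N)))
      (ℚ.≤-trans (expSum-½ N) (ν-mono-≤ 2≤n))) , proj₂ (proj₂ between))
    c∋0 : c ∋ 0ℚ
    c∋0 = let r , 0<r , c∋r = <ℝ⇒∋pos {c} 0<c in ℝ.downward c 0<r c∋r

module Threshold (em : ExcludedMiddle 0ℓ) where

  open import Data.Nat.Base as ℕ using (ℕ; zero; suc; z≤n; s≤s; _∸_)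
  import Data.Nat.Properties as ℕ
  open import Data.Nat.Divisibility using (_∣_)
  open import Data.Nat.Combinatorics using (_C_)
  open import Data.Fin.Subset using () renaming (∣_∣ to card)
  open import Data.List.Extrema.Nat using (min≤⊤)
  open import Data.Integer.Base using (+_; ∣_∣)
  open import Data.Rational.Base as ℚ using (ℚ; 0ℚ; _/_; _+_; _*_; -_; _<_; _≤_; ↥_; ↧ₙ_)
  import Data.Rational.Properties as ℚ
  open ℝ using (_∋_)
  open Finite using (nCk>0)
  open Counting em using (¬¬-elim; Forces)
  open Reals

  -- Extracting a rational threshold from the limsup

  least : (P : ℕ → Set) → ∀ N → P N → ∃ λ i → P i × ∀ j → j ℕ.< i → ¬ P j
  least P zero    p = 0 , p , λ _ ()
  least P (suc N) p with em {P 0}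
  ... | yes p₀ = 0 , p₀ , λ _ ()
  ... | no ¬p₀ = let i , q , below = least (P ∘ suc) N p in
    suc i , q , λ { zero _ → ¬p₀ ; (suc j) (s≤s j<i) → below j j<i }

  greatest : (P : ℕ → Set) → ∀ B → (∀ x → P x → x ℕ.≤ B) → ∀ x → P x → ∃ λ D → P D × ∀ y → P y → y
      ℕ.≤ D
  greatest P zero    P≤B x p = x , p , λ y q → ℕ.≤-trans (P≤B y q) z≤n
  greatest P (suc B) P≤B x p with em {P (suc B)}
  ... | yes q = suc B , q , P≤B
  ... | no ¬q = greatest P B (λ y q → ℕ.≤-pred (ℕ.≤∧≢⇒< (P≤B y q) λ { refl → ¬q q })) x p

  -- The mesh 1/w is chosen so fine that 8/w lies below ε. For the least i with i/w outside δ, (i -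
  -- 1)/w is inside, so δ + ε reaches past (i + 6)/w: of the 8 units one is lost to the mesh and one
  -- to strictness. For i = 0 the role of (i - 1)/w is played by a negative number, which δ contains
  -- by assumption.
  locate : ∀ (δ ε : ℝ) → (∀ {q} → q < 0ℚ → δ ∋ q) → fromℕ 0 <ℝ ε →
    ∃₂ λ w′ i → ¬ δ ∋ (+ i / suc w′) × (δ +ℝ ε) ∋ (+ (i ℕ.+ 6) / suc w′)
  locate δ ε δ∋neg 0<ε = w′ , i , ¬δ∋i , sum i ¬δ∋i below
    where
    positive = <ℝ⇒∋pos {ε} 0<ε
    r = proj₁ positive
    ε∋r = proj₂ (proj₂ positive)
    w = 8 ℕ.* ↧ₙ r
    w′ = ℕ.pred w
    frac : ℕ → ℚ
    frac i = + i / suc w′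
    r*w : ν 8 ≤ r * ν w
    r*w = subst (ν 8 ≤_)
      (trans (ℚ.*-comm (ν 8) (r * ν (↧ₙ r))) (trans (ℚ.*-assoc r (ν (↧ₙ r)) (ν 8))
          (cong (r *_) (trans (ℚ.*-comm (ν (↧ₙ r)) (ν 8)) (sym (ν-* 8 (↧ₙ r)))))))
      (*-monoʳ-≤ (ν 8) (0≤ν 8) (1≤*-denominator (proj₁ (proj₂ positive))))
    N = ∣ ↥ (proj₁ (ℝ.bounded δ) * ν w) ∣
    ¬δ∋N : ¬ δ ∋ frac N
    ¬δ∋N h = proj₂ (ℝ.bounded δ) (∋-≤ δ (*-cancelʳ-≤ (ν w) (ν-mono-< {0} {w} (s≤s z≤n))
      (subst (proj₁ (ℝ.bounded δ) * ν w ≤_) (sym (/*ν N w′))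
          (≤-numerator (proj₁ (ℝ.bounded δ) * ν w)))) h)
    search = least (λ i → ¬ δ ∋ frac i) N ¬δ∋N
    i = proj₁ search
    ¬δ∋i = proj₁ (proj₂ search)
    below = proj₂ (proj₂ search)
    add : ∀ i x → δ ∋ x → ν (i ℕ.+ 6) < x * ν w + ν 8 → (δ +ℝ ε) ∋ frac (i ℕ.+ 6)
    add i x δ∋x lt = x , r , δ∋x , ε∋r , *-cancelʳ-< (ν w) (0≤ν w)
        (subst₂ _<_ (sym (/*ν (i ℕ.+ 6) w′)) (sym (ℚ.*-distribʳ-+ (ν w) x r))
      (ℚ.<-≤-trans lt (ℚ.+-monoʳ-≤ (x * ν w) r*w)))
    sum : ∀ i → ¬ δ ∋ frac i → (∀ j → j ℕ.< i → ¬ ¬ δ ∋ frac j) → (δ +ℝ ε) ∋ frac (i ℕ.+ 6)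
    sum zero    _ _     = add 0 (- frac 1) (δ∋neg
        (ℚ.neg-antimono-< (*-cancelʳ-< {0ℚ} {frac 1} (ν w) (0≤ν w)
        (subst₂ _<_ (sym (ℚ.*-zeroˡ (ν w))) (sym (/*ν 1 w′)) (ν-mono-< {0} {1} (s≤s z≤n))))))
      (subst (λ z → ν 6 < z + ν 8) (trans (cong -_ (sym (/*ν 1 w′)))
          (ℚ.neg-distribˡ-* (frac 1) (ν w))) (ν-mono-< {6} {7} ℕ.≤-refl))
    sum (suc i) _ below = add (suc i) (frac i) (¬¬-elim (below i ℕ.≤-refl))
      (subst (ν (suc i ℕ.+ 6) <_) (trans (ν-+ i 8) (cong (_+ ν 8) (sym (/*ν i w′))))
          (ν-mono-< (ℕ.≤-reflexive (trans (cong suc (sym (ℕ.+-suc i 6))) (sym (ℕ.+-suc i 7))))))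

  degree-bound : ∀ Z w′ A x D → x ∋ (+ A / suc w′) → (Z · x) ≤ℝ fromℕ D → A ℕ.* Z ℕ.≤ suc w′ ℕ.* D
  degree-bound Z w′ A x D x∋A Zx≤D = ν-cancel-≤ (subst₂ _≤_
    (trans (ℚ.*-assoc (ν Z) (+ A / suc w′) (ν (suc w′)))
        (trans (cong (ν Z *_) (/*ν A w′)) (trans (ℚ.*-comm (ν Z) (ν A)) (sym (ν-* A Z)))))
    (trans (ℚ.*-comm (ν D) (ν (suc w′))) (sym (ν-* (suc w′) D)))
    (*-monoˡ-≤ (ν (suc w′)) (0≤ν (suc w′)) (ℚ.≮⇒≥ λ D< → ℚ.<-irrefl refl (Zx≤D (·∋ Z x x∋A D<)))))

  ÷-bound : ∀ D Z a w′ → 0 ℕ.< Z → D ÷ Z ≤ + a / suc w′ → suc w′ ℕ.* D ℕ.≤ a ℕ.* Z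
  ÷-bound D (suc Z′) a w′ _ h = ν-cancel-≤ (subst₂ _≤_
    (trans (cong (_* ν w) (/*ν D Z′)) (trans (ℚ.*-comm (ν D) (ν w)) (sym (ν-* w D))))
    (trans (ℚ.*-assoc (+ a / w) (ν Z) (ν w)) (trans (cong ((+ a / w) *_) (ℚ.*-comm (ν Z) (ν w)))
      (trans (sym (ℚ.*-assoc (+ a / w) (ν w) (ν Z)))
          (trans (cong (_* ν Z) (/*ν a w′)) (sym (ν-* a Z))))))
    (*-monoˡ-≤ (ν w) (0≤ν w) (*-monoˡ-≤ (ν Z) (0≤ν Z) h)))
    where
    w = suc w′
    Z = suc Z′

  minDegree≤C : ∀ {k n} d (H : KGraph k n) → minDegree d H ℕ.≤ (n ∸ d) C (k ∸ d)
  minDegree≤C {k} {n} d H = min≤⊤ ((n ∸ d) C (k ∸ d))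
      (map (degree H) (filter (λ S → card S ℕ.≟ d) (subsets n)))

  -- Otherwise, for arbitrarily large s, some graph without a loose Hamilton cycle has degree ratio
  -- above (i + 1)/w, and so does the extremal one. Then (i + 1)/w lies in every tail supremum, and
  -- the smaller i/w in the limsup. By k ≤ s the ratio is not the junk value of division by 0.
  eventually-forces : ∀ k d w′ i → d ℕ.≤ k → ¬ δLHC k d ∋ (+ i / suc w′) →
    ∃ λ N → ∀ s → N ℕ.≤ s → k ℕ.≤ s → (k ∸ 1) ∣ s → Forces k d s (suc w′) (suc i)
  eventually-forces k d w′ i d≤k δ∌ with em {∃ λ N → ∀ s → N ℕ.≤ s → k ℕ.≤ s → (k ∸ 1) ∣ s → Forces k d s (suc w′) (suc i)}
  ... | yes h = h
  ... | no ¬h = ⊥-elim (δ∌ (+ suc i / suc w′ , frac< , λ N → often N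
      (¬¬-elim λ ¬bad → ¬h (N , λ s N≤s k≤s div G lt →
      ¬¬-elim λ ¬lh → ¬bad (s , N≤s , k≤s , div , G , lt , ¬lh)))))
    where
    frac< : + i / suc w′ < + suc i / suc w′
    frac< = *-cancelʳ-< (ν (suc w′)) (0≤ν (suc w′))
        (subst₂ _<_ (sym (/*ν i w′)) (sym (/*ν (suc i) w′)) (ν-mono-< {i} {suc i} ℕ.≤-refl))
    Bad : ℕ → Set
    Bad N = ∃ λ s → N ℕ.≤ s × k ℕ.≤ s × (k ∸ 1) ∣ s × Σ (KGraph k s) λ G →
      suc i ℕ.* ((s ∸ d) C (k ∸ d)) ℕ.< suc w′ ℕ.* minDegree d G × ¬ LooseHamiltonian G
    often : ∀ N → Bad N → (+ suc i / suc w′) < 0ℚ ⊎ ∃ λ y →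
        (∃ λ n → N ℕ.≤ n × (k ∸ 1) ∣ n × ∃ λ D → IsLHCThreshold k d n D × y ≡ D ÷
        ((n ∸ d) C (k ∸ d))) × (+ suc i / suc w′) < y
    often N (s , N≤s , k≤s , div , G , lt , ¬lh) = inj₂
        (D ÷ C′ , (s , N≤s , div , D , (proj₁ (proj₂ top) , λ H ¬lhH → proj₂ (proj₂ top) _
        (H , ¬lhH , refl)) , refl) ,
      ℚ.≰⇒> λ ≤ → ℕ.<-irrefl refl (ℕ.<-≤-trans lt
          (ℕ.≤-trans (ℕ.*-monoʳ-≤ (suc w′) (proj₂ (proj₂ top) _ (G , ¬lh , refl)))
        (÷-bound D C′ (suc i) w′ (nCk>0 (ℕ.∸-monoˡ-≤ d k≤s)) ≤))))
      where
      C′ = (s ∸ d) C (k ∸ d)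
      top = greatest (λ D → Σ (KGraph k s) λ H → ¬ LooseHamiltonian H × minDegree d H ≡ D) C′
        (λ { _ (H , _ , refl) → minDegree≤C d H }) (minDegree d G) (G , ¬lh , refl)
      D = proj₁ top

module Parameters (em : ExcludedMiddle 0ℓ) where

  open import Data.Nat.Base
  open import Data.Nat.Properties hiding (*-monoˡ-≤; *-monoʳ-≤; *-cancelʳ-≤; *-cancelʳ-<; ^-monoʳ-≤)
  import Data.Nat.Properties as ℕ
  open import Data.Nat.DivMod using (m≡m%n+[m/n]*n; m%n<n; m/n*n≤m)
  open import Data.Nat.Divisibility using (_∣_; divides)
  open import Data.Nat.Combinatorics using (_C_)
  open import Data.Nat.Tactic.RingSolver using (solve-∀)
  import Data.Integer.Base as ℤ
  open import Data.Rational.Base as ℚ using (ℚ; 0ℚ; 1ℚ)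
  import Data.Rational.Properties as ℚ
  open import Data.Fin.Subset using (Subset; _∈_; ∣_∣)
  open import Data.List.Membership.Propositional using () renaming (_∈_ to _∈ˡ_)
  open import Data.List.Relation.Unary.Any using (here; there)
  open ℝ using (_∋_)
  open Finite
  open Counting em using (order; Forces; Covering; finite-covering)
  open Reals
  open Threshold em

  -- Choice of the parameters

  cube-root : ∀ s → ∃ λ y → y ^ 3 ≤ s × s < suc y ^ 3
  cube-root zero = 0 , z≤n , s≤s z≤n
  cube-root (suc s) with cube-root s
  ... | y , y³≤s , s<[1+y]³ with suc s <? suc y ^ 3
  ...   | yes lt = y , m≤n⇒m≤1+n y³≤s , lt
  ...   | no ≮   = suc y , ≮⇒≥ ≮ , ≤-<-trans s<[1+y]³ (^-monoˡ-< 3 (n<1+n (suc y)))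

  -- This is (1 + 1/h)^y ≥ 1 + y/h with denominators cleared.
  h^y*y≤ : ∀ h y → h ^ y * (h + y) ≤ h * suc h ^ y
  h^y*y≤ h zero    = ≤-reflexive (e h)
    where
    e : ∀ h → 1 * (h + 0) ≡ h * 1
    e = solve-∀
  h^y*y≤ h (suc y) = begin
    h * h ^ y * (h + suc y)           ≤⟨ m≤m+n _ (h ^ y * y) ⟩
    h * h ^ y * (h + suc y) + h ^ y * y ≡⟨ e₁ h y (h ^ y) ⟩
    h ^ y * (h + y) * suc h           ≤⟨ ℕ.*-monoˡ-≤ (suc h) (h^y*y≤ h y) ⟩
    h * suc h ^ y * suc h             ≡⟨ e₂ h (suc h) (suc h ^ y) ⟩
    h * (suc h * suc h ^ y)           ∎
    where
    open ≤-Reasoning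
    e₁ : ∀ h y m → h * m * (h + suc y) + m * y ≡ m * (h + y) * suc h
    e₁ = solve-∀
    e₂ : ∀ h g m → h * m * g ≡ h * (g * m)
    e₂ = solve-∀

  -- The number b of sampled blocks is of order s^(1/3): small enough for a
  -- sample to be injective, large enough for h/(h+1) to the power b to beat
  -- every power of s.
  sample-size : ∀ w a d j → let c = 2 + a ; h = 1 + c * (2 + c) in
    ∃ λ S → ∀ s → S ≤ s → ∃ λ b → 0 < b ×
      c * (w * b * (j * (suc d + w * b * j))) ≤ s × 8 * s * (s ^ d * (c * h ^ b)) ≤ suc h ^ b
  sample-size w a d j = suc K ^ 3 , λ s S≤s → choose s S≤s (cube-root s)
    where
    open ≤-Reasoning
    c = 2 + a
    h = 1 + c * (2 + c)
    -- From s < (y + 1)³ follows s^(d + 1) ≤ (2y)^g, and by `h^y*y≤` the gain ((h + 1)/h)^(yf) is at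
    -- least (y/h)^f. As f = g + 1, one factor y > K is left over to absorb the constants.
    g = 3 * suc d
    f = suc g
    K₁ = h ^ f * (8 * c * 2 ^ g)
    K₂ = c * (w * f * (j * (suc d + w * f * j)))
    K = K₁ + K₂
    choose : ∀ s → suc K ^ 3 ≤ s → (∃ λ y → y ^ 3 ≤ s × s < suc y ^ 3) → ∃ λ b → 0 < b ×
      c * (w * b * (j * (suc d + w * b * j))) ≤ s × 8 * s * (s ^ d * (c * h ^ b)) ≤ suc h ^ b
    choose s S≤s (y , y³≤s , s<) = y * f , *-mono-< 0<y z<s , few , decay
      where
      K<y : K < y
      K<y = ≰⇒> λ y≤K → <-irrefl refl (<-≤-trans s< (≤-trans (^-monoˡ-≤ 3 (s≤s y≤K)) S≤s))
      0<y : 0 < y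
      0<y = ≤-<-trans z≤n K<y
      e₁ : ∀ c w f j d y → c * (w * (y * f) * (j * (suc d * y + w * (y * f) * j))) ≡ c *
          (w * f * (j * (suc d + w * f * j))) * (y * (y * 1))
      e₁ = solve-∀
      few : c * (w * (y * f) * (j * (suc d + w * (y * f) * j))) ≤ s
      few = begin
        c * (w * (y * f) * (j * (suc d + w * (y * f) * j)))
          ≤⟨ ℕ.*-monoʳ-≤ c (ℕ.*-monoʳ-≤ (w * (y * f))
            (ℕ.*-monoʳ-≤ j (+-monoˡ-≤ _ (m≤m*n (suc d) y {{>-nonZero 0<y}})))) ⟩
        c * (w * (y * f) * (j * (suc d * y + w * (y * f) * j)))
          ≡⟨ e₁ c w f j d y ⟩
        K₂ * y ^ 2
          ≤⟨ ℕ.*-monoˡ-≤ (y ^ 2) (≤-trans (m≤n+m K₂ K₁) (<⇒≤ K<y)) ⟩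
        y ^ 3
          ≤⟨ y³≤s ⟩
        s ∎
      s≤ : s ^ suc d ≤ 2 ^ g * y ^ g
      s≤ = begin
        s ^ suc d               ≤⟨ ^-monoˡ-≤ (suc d) (<⇒≤ s<) ⟩
        (suc y ^ 3) ^ suc d     ≡⟨ ^-*-assoc (suc y) 3 (suc d) ⟩
        suc y ^ g               ≤⟨ ^-monoˡ-≤ g (≤-trans (+-monoˡ-≤ y 0<y)
            (≤-reflexive (cong (y +_) (sym (+-identityʳ y))))) ⟩
        (2 * y) ^ g             ≡⟨ ^-distribʳ-* g 2 y ⟩
        2 ^ g * y ^ g           ∎
      e₂ : ∀ H s m c x → H * (8 * s * (m * (c * x))) ≡ H * (8 * c) * (s * m) * x
      e₂ = solve-∀
      e₃ : ∀ H c t z x → H * (8 * c) * (t * z) * x ≡ H * (8 * c * t) * (z * x)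
      e₃ = solve-∀
      e₄ : ∀ y z x → y * (z * x) ≡ x * (y * z)
      e₄ = solve-∀
      decay : 8 * s * (s ^ d * (c * h ^ (y * f))) ≤ suc h ^ (y * f)
      decay = *-cancelˡ-≤ (h ^ f) {{m^n≢0 h f}} (begin
        h ^ f * (8 * s * (s ^ d * (c * h ^ (y * f))))
          ≡⟨ e₂ (h ^ f) s (s ^ d) c _ ⟩
        h ^ f * (8 * c) * s ^ suc d * h ^ (y * f)
          ≤⟨ ℕ.*-monoˡ-≤ _ (ℕ.*-monoʳ-≤ (h ^ f * (8 * c)) s≤) ⟩
        h ^ f * (8 * c) * (2 ^ g * y ^ g) * h ^ (y * f)
          ≡⟨ e₃ (h ^ f) c (2 ^ g) (y ^ g) _ ⟩
        K₁ * (y ^ g * h ^ (y * f))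
          ≤⟨ ℕ.*-monoˡ-≤ _ (≤-trans (m≤m+n K₁ K₂) (<⇒≤ K<y)) ⟩
        y * (y ^ g * h ^ (y * f))
          ≡⟨ e₄ y (y ^ g) _ ⟩
        h ^ (y * f) * y ^ f
          ≡⟨ cong (_* y ^ f) (^-*-assoc h y f) ⟨
        (h ^ y) ^ f * y ^ f
          ≡⟨ ^-distribʳ-* f (h ^ y) y ⟨
        (h ^ y * y) ^ f
          ≤⟨ ^-monoˡ-≤ f (≤-trans (ℕ.*-monoʳ-≤ (h ^ y) (m≤n+m y h)) (h^y*y≤ h y)) ⟩
        (h * suc h ^ y) ^ f
          ≡⟨ ^-distribʳ-* f h (suc h ^ y) ⟩
        h ^ f * (suc h ^ y) ^ f
          ≡⟨ cong (h ^ f *_) (^-*-assoc (suc h) y f) ⟩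
        h ^ f * suc h ^ (y * f) ∎)

  -- Here u + 1 is m. The room needed is 2 to a polynomial of degree s in u, whereas n will be at
  -- least 2 ^ x for every x up to u ^ (s + 1) / 2; the extra power of u beats the constant 2G.
  room-size : ∀ s′ e Λ → let s = suc s′ in ∃ λ B → ∀ u → B ≤ u → 1 ≤ u × ∃ λ x → 2 * x ≤ u ^ suc s ×
    s * (2 ^ (e * (2 + Λ * suc u) ^ s) * (s * (Λ * suc u))) ≤ 2 ^ x
  room-size s′ e Λ = suc (2 * G) , λ u B≤u → ≤-trans (s≤s z≤n) B≤u , x u , exponent u B≤u , total u
    where
    open ≤-Reasoning
    s = suc s′
    G = s + e * (2 + 2 * Λ) ^ s + s * (2 * Λ)
    x : ℕ → ℕ
    x u = s + e * (2 + Λ * suc u) ^ s + s * (Λ * suc u)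
    total : ∀ u → s * (2 ^ (e * (2 + Λ * suc u) ^ s) * (s * (Λ * suc u))) ≤ 2 ^ x u
    total u = begin
      s * (2 ^ y * (s * (Λ * suc u)))   ≤⟨ *-mono-≤ (n≤2^n s) (ℕ.*-monoʳ-≤ (2 ^ y) (n≤2^n _)) ⟩
      2 ^ s * (2 ^ y * 2 ^ z)           ≡⟨ *-assoc (2 ^ s) (2 ^ y) (2 ^ z) ⟨
      2 ^ s * 2 ^ y * 2 ^ z             ≡⟨ trans (^-distribˡ-+-* 2 (s + y) z)
          (cong (_* 2 ^ z) (^-distribˡ-+-* 2 s y)) ⟨
      2 ^ x u                           ∎
      where
      y = e * (2 + Λ * suc u) ^ s
      z = s * (Λ * suc u)
    exponent : ∀ u → suc (2 * G) ≤ u → 2 * x u ≤ u ^ suc s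
    exponent u B≤u = begin
      2 * x u          ≤⟨ ℕ.*-monoʳ-≤ 2 x≤ ⟩
      2 * (G * u ^ s)  ≡⟨ *-assoc 2 G _ ⟨
      2 * G * u ^ s    ≤⟨ ℕ.*-monoˡ-≤ (u ^ s) (≤-trans (n≤1+n _) B≤u) ⟩
      u ^ suc s        ∎
      where
      1≤u : 1 ≤ u
      1≤u = ≤-trans (s≤s z≤n) B≤u
      instance _ = >-nonZero 1≤u
      1+u≤2u : suc u ≤ 2 * u
      1+u≤2u = ≤-trans (+-monoˡ-≤ u 1≤u) (≤-reflexive (cong (u +_) (sym (+-identityʳ u))))
      e₁ : ∀ Λ u → 2 * u + Λ * (2 * u) ≡ (2 + 2 * Λ) * u
      e₁ = solve-∀
      e₂ : ∀ s Λ u → s * (Λ * (2 * u)) ≡ s * (2 * Λ) * u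
      e₂ = solve-∀
      e₃ : ∀ a b c z → a * z + b * z + c * z ≡ (a + b + c) * z
      e₃ = solve-∀
      x≤ : x u ≤ G * u ^ s
      x≤ = begin
        s + e * (2 + Λ * suc u) ^ s + s * (Λ * suc u)
          ≤⟨ +-mono-≤ (+-mono-≤ (m≤m*n s (u ^ s) {{m^n≢0 u s}})
               (ℕ.*-monoʳ-≤ e (^-monoˡ-≤ s (≤-trans (+-mono-≤ (m≤m*n 2 u) (ℕ.*-monoʳ-≤ Λ 1+u≤2u))
                   (≤-reflexive (e₁ Λ u))))))
               (≤-trans (ℕ.*-monoʳ-≤ s (ℕ.*-monoʳ-≤ Λ 1+u≤2u))
                   (≤-trans (≤-reflexive (e₂ s Λ u)) (ℕ.*-monoʳ-≤ (s * (2 * Λ))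
                   (m≤m*n u (u ^ s′) {{m^n≢0 u s′}})))) ⟩
        s * u ^ s + e * ((2 + 2 * Λ) * u) ^ s + s * (2 * Λ) * u ^ s
          ≡⟨ cong (λ z → s * u ^ s + z + s * (2 * Λ) * u ^ s)
            (trans (cong (e *_) (^-distribʳ-* s (2 + 2 * Λ) u)) (sym (*-assoc e _ _))) ⟩
        s * u ^ s + e * (2 + 2 * Λ) ^ s * u ^ s + s * (2 * Λ) * u ^ s
          ≡⟨ e₃ s (e * (2 + 2 * Λ) ^ s) (s * (2 * Λ)) (u ^ s) ⟩
        G * u ^ s ∎

  upper-bound : ∀ (f : ℕ → ℕ) N → ∃ λ B → ∀ u → u < N → f u ≤ B
  upper-bound f zero    = 0 , λ _ ()
  upper-bound f (suc N) = let B , f≤B = upper-bound f N in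
    f N + B , λ u u≤N → case u ≟ N of λ
      { (yes refl) → m≤m+n _ _
      ; (no u≢N)   → ≤-trans (f≤B u (≤∧≢⇒< (≤-pred u≤N) u≢N)) (m≤n+m B (f N)) }

  δLHC∋neg : ∀ k d {q} → q ℚ.< 0ℚ → ℝ._∋_ (δLHC k d) q
  δLHC∋neg k d q<0 = let r , q<r , r<0 = ℚ.<-dense q<0 in r , q<r , λ _ → inj₁ r<0

  k∸1∣order : ∀ {k} ℓ → 2 ≤ k → (k ∸ 1) ∣ order k ℓ
  k∸1∣order {suc (suc k)} ℓ _ = divides ℓ (sym (*-suc ℓ k))
  k∸1∣order {suc zero}    ℓ (s≤s ())

  ≤-quotient : ∀ {n s q} x → s * x ≤ n → n < s + s * q → x ≤ q
  ≤-quotient {n} {s} {q} x sx≤n n< = ≤-pred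
      (*-cancelˡ-< s x (suc q) (≤-<-trans sx≤n (<-≤-trans n< (≤-reflexive (sym (*-suc s q))))))

  -- From integer bounds to the statement over the reals

  BlowUpCover : ∀ {k n} → ℕ → ℕ → ℝ → KGraph k n → Set
  BlowUpCover {k} {n} m ℓ η H = ∃ λ (t : ℕ) →
    Σ (Fin t → Copy (blowUp m (looseCycle k ℓ)) H) λ B →
    (∀ i j → i ≢ j → ∀ v → Copy.Covers (B i) v → ¬ Copy.Covers (B j) v) ×
    Σ (Subset n) λ U →
    (∀ v → v ∈ U ⊎ ∃ λ i → Copy.Covers (B i) v) ×
    (fromℕ ∣ U ∣ ≤ℝ n · η)

  fraction-≤ : ∀ {x u n r} E (η : ℝ) → 0ℚ ℚ.< r → η ∋ r → 1ℚ ℚ.≤ r ℚ.* ν E →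
    x ≤ u → E * u ≤ n → fromℕ x ≤ℝ n · η
  fraction-≤ {x} {u} {n} {r} E η 0<r η∋r 1≤rE x≤u Eu≤n z<x =
    ·∋ n η η∋r (ℚ.<-≤-trans z<x (ℚ.≤-trans (ν-mono-≤ x≤u) u≤nr))
    where
    open ℚ.≤-Reasoning
    u≤nr : ν u ℚ.≤ ν n ℚ.* r
    u≤nr = begin
      ν u                    ≡⟨ ℚ.*-identityʳ (ν u) ⟨
      ν u ℚ.* 1ℚ             ≤⟨ *-monoʳ-≤ (ν u) (0≤ν u) 1≤rE ⟩
      ν u ℚ.* (r ℚ.* ν E)    ≡⟨ trans (cong (ν u ℚ.*_) (ℚ.*-comm r (ν E)))
          (sym (ℚ.*-assoc (ν u) (ν E) r)) ⟩
      ν u ℚ.* ν E ℚ.* r      ≡⟨ cong (ℚ._* r) (trans (ℚ.*-comm (ν u) (ν E)) (sym (ν-* E u))) ⟩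
      ν (E * u) ℚ.* r        ≤⟨ *-monoˡ-≤ r (ℚ.<⇒≤ 0<r) (ν-mono-≤ Eu≤n) ⟩
      ν n ℚ.* r              ∎

  covering⇒cover : ∀ {k n ℓ s′} (H : KGraph k n) (order≡s : order k ℓ ≡ suc s′) m {r} E (η : ℝ) →
    0ℚ ℚ.< r → η ∋ r → 1ℚ ℚ.≤ r ℚ.* ν E →
    (∃ λ u → E * u ≤ n × Covering {ℓ = ℓ} H order≡s m u) → BlowUpCover m ℓ η H
  covering⇒cover H order≡s m E η 0<r η∋r 1≤rE (u , Eu≤n , t , B , disjoint , U , cover , |U|) =
    t , B , disjoint , U , cover , λ {z} → fraction-≤ E η 0<r η∋r 1≤rE |U| Eu≤n {z}

  module _ {k d ℓ s′ w′ i b : ℕ} (d≤k : d ≤ k) (order≡s : order k ℓ ≡ suc s′) (0<b : 0 < b) (ε : ℝ) where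

    private
      s = suc s′
      w = suc w′
      a = suc i
      j = k ∸ d
      c = 2 + a
      h = 1 + c * (2 + c)

    module _ (k≤s : k ≤ s) (forces : Forces k d s w a)
      (few : c * (w * b * (j * (suc d + w * b * j))) ≤ s)
      (decay : 8 * s * (s ^ d * (c * h ^ b)) ≤ suc h ^ b)
      (threshold : (δLHC k d +ℝ ε) ∋ ((ℤ.+ (i + 6)) ℚ./ w)) where

      exponent : ℕ → ℕ
      exponent E = 8 * (3 * E) * (s ^ s * (s ^ s) ^ s)

      room : ℕ → ℕ → ℕ
      room E m = 2 ^ (exponent E * (2 + 3 * E * s * m) ^ s) * (s * (3 * E * s * m))

      -- The lower bounds on n that do not involve m; their sum stands in for the maximum.
      orders : ℕ → List ℕ
      orders E = 2 ∷ k ∷ (5 + a) * (j * k) ∷ 8 * s * (s′ * s) ∷ 3 * E * s ∷ s * 1 ∷ s * (2 * s′) ∷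
          []

      cover-at : ∀ E {r} (η : ℝ) → 0 < E → 0ℚ ℚ.< r → η ∋ r → 1ℚ ℚ.≤ r ℚ.* ν E →
        ∀ n m (H : KGraph k n) → ∑ (orders E) id ≤ n → 1 ≤ m → s * room E m ≤ n →
        (((n ∸ d) C j) · (δLHC k d +ℝ ε)) ≤ℝ fromℕ (minDegree d H) → BlowUpCover m ℓ η H
      cover-at E η 0<E 0<r η∋r 1≤rE n m H n-large 1≤m R≤n deg = covering⇒cover H order≡s m E η 0<r
          η∋r 1≤rE
        (finite-covering {ℓ = ℓ} w a b E m q H d≤k order≡s a<w 0<b k≤s forces few decay 0<E 1≤m
            sq≤n n<s+sq
          (≤-trans (s≤s z≤n) 2≤n) k≤n (≤n {(5 + a) * (j * k)} (there (there (here refl))))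
          (≤n {8 * s * (s′ * s)} (there (there (there (here refl)))))
          (≤n {3 * E * s} (there (there (there (there (here refl))))))
          (≤-quotient {s = s} 1 (≤n {s * 1} (there (there (there (there (there (here refl)))))))
              n<s+sq)
          (≤-trans (≤-quotient {s = s} (2 * s′) (≤n {s * (2 * s′)}
              (there (there (there (there (there (there (here refl)))))))) n<s+sq) (n≤1+n q))
          (≤-quotient {s = s} (room E m) R≤n n<s+sq) degree≥)
        where
        ≤n : ∀ {x} → x ∈ˡ orders E → x ≤ n
        ≤n x∈ = ≤-trans (∑-∈ id x∈) n-large
        2≤n : 2 ≤ n
        2≤n = ≤n (here refl)
        k≤n : k ≤ n
        k≤n = ≤n (there (here refl))
        C₀ = (n ∸ d) C j
        degree≥ : (5 + a) * C₀ ≤ w * minDegree d H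
        degree≥ = subst (λ z → z * C₀ ≤ w * minDegree d H) (trans (+-comm i 6) (sym (+-suc 5 i)))
          (degree-bound C₀ w′ (i + 6) (δLHC k d +ℝ ε) (minDegree d H) threshold deg)
        -- This comes from the existence of H: its minimum degree is at most C₀, so (5 + a) C₀ ≤ w
        -- C₀.
        a<w : a < w
        a<w = ≤-trans (+-monoˡ-≤ a {1} {5} (s≤s z≤n))
            (ℕ.*-cancelʳ-≤ (5 + a) w C₀ {{>-nonZero (nCk>0 (∸-monoˡ-≤ d k≤n))}}
          (≤-trans degree≥ (ℕ.*-monoʳ-≤ w (minDegree≤C d H))))
        q = n / s
        sq≤n : s * q ≤ n
        sq≤n = ≤-trans (≤-reflexive (*-comm s q)) (m/n*n≤m n s)
        n<s+sq : n < s + s * q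
        n<s+sq = subst₂ _<_ (sym (m≡m%n+[m/n]*n n s)) (cong (s +_) (*-comm q s))
            (+-monoˡ-< (q * s) (m%n<n n s))

      cover-eventually : ∀ (c η : ℝ) → fromℕ 0 <ℝ c → c ≤ℝ fromℚ ((ℤ.+ 1) ℚ./ suc s) → fromℕ 0 <ℝ
          η →
        ∃ λ n₀ → ∀ n → n₀ ≤ n → ∀ m → (log n ^ℝ c) RoundsTo m → ∀ (H : KGraph k n) →
        (((n ∸ d) C j) · (δLHC k d +ℝ ε)) ≤ℝ fromℕ (minDegree d H) → BlowUpCover m ℓ η H
      cover-eventually c η 0<c c≤ 0<η = with-fraction (<ℝ⇒∋pos {η} 0<η)
        where
        Conclusion : Set
        Conclusion = ∃ λ n₀ → ∀ n → n₀ ≤ n → ∀ m → (log n ^ℝ c) RoundsTo m → ∀ (H : KGraph k n) →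
          (((n ∸ d) C j) · (δLHC k d +ℝ ε)) ≤ℝ fromℕ (minDegree d H) → BlowUpCover m ℓ η H
        with-bounds : ∀ E {r} → 0 < E → 0ℚ ℚ.< r → η ∋ r → 1ℚ ℚ.≤ r ℚ.* ν E →
          (big : ∃ λ B → ∀ u → B ≤ u → 1 ≤ u × ∃ λ x → 2 * x ≤ u ^ suc s × s * room E (suc u) ≤ 2 ^
              x) →
          (∃ λ B → ∀ u → u < proj₁ big → s * room E (suc u) ≤ B) → Conclusion
        with-bounds E 0<E 0<r η∋r 1≤rE (B , big) (B′ , small) = B′ + ∑ (orders E) id ,
            λ n n₀≤n m round H deg →
          let n-large = ≤-trans (m≤n+m _ B′) n₀≤n
              2≤n     = ≤-trans (∑-∈ {xs = orders E} id (here refl)) n-large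
              1≤m     = rounds⇒pos n c m 2≤n 0<c round
          in cover-at E η 0<E 0<r η∋r 1≤rE n m H n-large 1≤m
               (fits n (≤-trans (s≤s z≤n) 2≤n) (≤-trans (m≤m+n B′ _) n₀≤n) m 1≤m round) deg
          where
          -- Two regimes: if u = m - 1 is below the constant B, the room takes finitely many values
          -- and B′ ≤ n bounds them; if u is large, n is exponential in u ^ (s + 1).
          fits : ∀ n → 1 ≤ n → B′ ≤ n → ∀ m → 1 ≤ m → (log n ^ℝ c) RoundsTo m → s * room E m ≤ n
          fits n 1≤n B′≤n (suc u) _ round = by-size (<-≤-connex u B)
            where
            by-size : u < B ⊎ B ≤ u → s * room E (suc u) ≤ n
            by-size (inj₁ u<B) = ≤-trans (small u u<B) B′≤n
            by-size (inj₂ B≤u) = let 1≤u , x , 2x≤ , R≤ = big u B≤u in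
              ≤-trans R≤ (rounds⇒2^≤ n c s u x 1≤n c≤ round 1≤u 2x≤)
        with-fraction : (∃ λ r → 0ℚ ℚ.< r × η ∋ r) → Conclusion
        with-fraction (r , 0<r , η∋r) = with-bounds E (s≤s z≤n) 0<r η∋r (1≤*-denominator 0<r) big
          (upper-bound (λ u → s * room E (suc u)) (proj₁ big))
          where
          E = ℚ.↧ₙ r
          big = room-size s′ (exponent E) (3 * E * s)

  CoveredFrom : (k d ℓ : ℕ) → ℝ → Set₁
  CoveredFrom k d ℓ ε = Σ ℝ λ c₀ → Σ ℝ λ η₀ → fromℕ 0 <ℝ c₀ × fromℕ 0 <ℝ η₀ ×
    (∀ (c η : ℝ) → fromℕ 0 <ℝ c → c ≤ℝ c₀ → fromℕ 0 <ℝ η → η ≤ℝ η₀ →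
    ∃ λ n₀ → ∀ n → n₀ ≤ n → ∀ m → (log n ^ℝ c) RoundsTo m → ∀ (H : KGraph k n) →
    (((n ∸ d) C (k ∸ d)) · (δLHC k d +ℝ ε)) ≤ℝ fromℕ (minDegree d H) → BlowUpCover m ℓ η H)

  covered : ∀ k d → 1 ≤ d → d < k → ∀ ε → fromℕ 0 <ℝ ε →
    ∃ λ ℓ₀ → ∀ ℓ → ℓ₀ ≤ ℓ → CoveredFrom k d ℓ ε
  covered k d 1≤d d<k ε 0<ε = with-threshold (locate (δLHC k d) ε (δLHC∋neg k d) 0<ε)
    where
    with-sample : ∀ w′ i → (δLHC k d +ℝ ε) ∋ ((ℤ.+ (i + 6)) ℚ./ suc w′) →
      (∃ λ N → ∀ s → N ≤ s → k ≤ s → (k ∸ 1) ∣ s → Forces k d s (suc w′) (suc i)) →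
      (let w = suc w′ ; j = k ∸ d ; c = 2 + suc i ; h = 1 + c * (2 + c) in ∃ λ S → ∀ s → S ≤ s →
          ∃ λ b → 0 < b ×
        c * (w * b * (j * (suc d + w * b * j))) ≤ s × 8 * s * (s ^ d * (c * h ^ b)) ≤ suc h ^ b) →
      ∃ λ ℓ₀ → ∀ ℓ → ℓ₀ ≤ ℓ → CoveredFrom k d ℓ ε
    -- Again a sum serves as a maximum. It bounds ℓ from below and hence the order s = ℓ + ℓ (k - 2)
    -- of the cycle, which is what the conditions concern.
    with-sample w′ i threshold (N , forced) (S , sampled) = ∑ sizes id , λ ℓ ℓ₀≤ℓ →
      by-order ℓ (λ x∈ → ≤-trans (∑-∈ {xs = sizes} id x∈) (≤-trans ℓ₀≤ℓ (m≤m+n ℓ _))) (order k ℓ)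
          refl
      where
      sizes = 1 ∷ k ∷ N ∷ S ∷ []
      by-order : ∀ ℓ → (∀ {x} → x ∈ˡ sizes → x ≤ order k ℓ) → ∀ s → order k ℓ ≡ s → CoveredFrom k d
          ℓ ε
      by-order ℓ ≤order zero     eq = ⊥-elim (n≮0 (subst (1 ≤_) eq (≤order (here refl))))
      by-order ℓ ≤order (suc s′) eq = with-b (sampled s
          (≤s {S} (there (there (there (here refl))))))
        where
        s = suc s′
        ≤s : ∀ {x} → x ∈ˡ sizes → x ≤ s
        ≤s {x} x∈ = subst (x ≤_) eq (≤order x∈)
        with-b : _ → CoveredFrom k d ℓ ε
        -- The value c₀ = 1/(s + 1) makes u ^ (s + 1) at most log n, one power more than the
        -- exponent in `box` consumes.
        with-b (b , 0<b , few , decay) = fromℚ ((ℤ.+ 1) ℚ./ suc s) , fromℕ 1 ,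
          (0ℚ , ℚ.<-irrefl refl , *-cancelʳ-< (ν (suc s)) (0≤ν (suc s))
            (subst₂ ℚ._<_ (sym (ℚ.*-zeroˡ (ν (suc s)))) (sym (/*ν 1 s))
                (ν-mono-< {0} {1} (s≤s z≤n)))) ,
          (0ℚ , ℚ.<-irrefl refl , ν-mono-< {0} {1} (s≤s z≤n)) ,
          λ c η 0<c c≤ 0<η _ → cover-eventually {b = b} (<⇒≤ d<k) eq 0<b ε
              (≤s {k} (there (here refl)))
            (forced s (≤s {N} (there (there (here refl)))) (≤s {k} (there (here refl)))
              (subst ((k ∸ 1) ∣_) eq (k∸1∣order ℓ (≤-trans (s≤s 1≤d) d<k))))
            few decay threshold c η 0<c c≤ 0<η
    with-threshold : (∃₂ λ w′ i → ¬ δLHC k d ∋ ((ℤ.+ i) ℚ./ suc w′) × (δLHC k d +ℝ ε) ∋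
        ((ℤ.+ (i + 6)) ℚ./ suc w′)) →
      ∃ λ ℓ₀ → ∀ ℓ → ℓ₀ ≤ ℓ → CoveredFrom k d ℓ ε
    with-threshold (w′ , i , δ∌ , threshold) = with-sample w′ i threshold
      (eventually-forces k d w′ i (<⇒≤ d<k) δ∌) (sample-size (suc w′) (suc i) d (k ∸ d))

open import Defs
open import Data.Nat.Base using (ℕ; _≤_; _<_; _∸_)
open import Data.Nat.Combinatorics using (_C_)
open import Data.Fin.Base using (Fin)
open import Data.Fin.Subset using (Subset; _∈_; ∣_∣)
open import Data.Product.Base using (Σ; ∃; _×_)
open import Data.Sum.Base using (_⊎_)
open import Relation.Nullary using (¬_)
open import Relation.Binary.PropositionalEquality using (_≢_)

theorem4p6 : ExcludedMiddle 0ℓ →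
  ∀ (k d : ℕ) → 1 ≤ d → d < k →
  ∀ (ε : ℝ) → fromℕ 0 <ℝ ε →
  ∃ λ (ℓ₀ : ℕ) → ∀ (ℓ : ℕ) → ℓ₀ ≤ ℓ →
  Σ ℝ λ c₀ → Σ ℝ λ η₀ → fromℕ 0 <ℝ c₀ × fromℕ 0 <ℝ η₀ ×
  (∀ (c η : ℝ) → fromℕ 0 <ℝ c → c ≤ℝ c₀ → fromℕ 0 <ℝ η → η ≤ℝ η₀ →
  ∃ λ (n₀ : ℕ) → ∀ (n : ℕ) → n₀ ≤ n →
  ∀ (m : ℕ) → (log n ^ℝ c) RoundsTo m →
  ∀ (H : KGraph k n) →
  ((n ∸ d) C (k ∸ d)) · (δLHC k d +ℝ ε) ≤ℝ fromℕ (minDegree d H) →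
  ∃ λ (t : ℕ) →
  Σ (Fin t → Copy (blowUp m (looseCycle k ℓ)) H) λ B →
  (∀ i j → i ≢ j → ∀ v → Copy.Covers (B i) v → ¬ Copy.Covers (B j) v) ×
  Σ (Subset n) λ U →
  (∀ v → v ∈ U ⊎ ∃ λ i → Copy.Covers (B i) v) ×
  (fromℕ ∣ U ∣ ≤ℝ n · η))
theorem4p6 em = Parameters.covered em
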